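{- Let $\phi=\frac{1+\sqrt5}{2}$. Then \[ \lim_{g\to\infty}\frac{1}{g^2}\mathbb{E}_g[w(S)]=\frac{1}{10\phi}, \] and for every fixed $\epsilon>0$, \[ \lim_{g\to\infty}\mathbb{P}_{g}\left[\left|w(S)-\tfrac{1}{10\phi}\, g^2 \right|< \epsilon g^2\right]=1. \]
   Context: A numerical semigroup $S$ is a submonoid of $\mathbb{N}_0$ with finite complement; $\mathcal{H}(S)=\mathbb{N}_0\setminus S$ is the set of gaps and $g=g(S)=|\mathcal{H}(S)|$ is the genus. The weight of $S$ is $w(S)=\left(\sum_{x\in\mathcal{H}(S)}x\right)-\frac{g(g+1)}{2}$. $\mathcal{S}_g$ is the finite set of numerical semigroups of genus $g$; $\mathbb{P}_g$ and $\mathbb{E}_g$ denote probability and expectation for the uniform distribution on $\mathcal{S}_g$. -}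

module Defs where

open import Data.Nat as ℕ using (ℕ; zero; suc)
open import Data.Integer as ℤ using (ℤ; +_)
open import Data.Rational as ℚ using (ℚ; 0ℚ; 1ℚ)
open import Data.Rational.Properties using (_<?_; _≤?_)
open import Data.List using (List; []; _∷_; length; map; foldr; filter)
open import Data.Nat.ListAction using (sum)
open import Data.List.Membership.Propositional using (_∈_; _∉_)
open import Data.List.Relation.Unary.Linked using (Linked)
open import Data.List.Relation.Unary.All using (All)
open import Data.List.Relation.Unary.Unique.Propositional using (Unique)
open import Data.Product using (_×_; Σ)
open import Data.Sum using (_⊎_)
open import Relation.Nullary using (Dec)
open import Relation.Nullary.Decidable using (_×-dec_; _⊎-dec_)
open import Relation.Binary.PropositionalEquality using (_≡_)

-- A numerical semigroup S is represented by its (finite) set of gaps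
-- H(S) = ℕ₀ \ S, written as a strictly increasing list (canonical form).
-- S = { n | n ∉ H } is a submonoid of ℕ₀ iff 0 ∉ H and S is closed under +.
-- The genus is the number of gaps, i.e. length H.
record IsGapSetOfGenus (g : ℕ) (H : List ℕ) : Set where
  field
    strictlySorted : Linked ℕ._<_ H
    genus          : length H ≡ g
    zero∈S         : 0 ∉ H
    closed         : ∀ a b → a ∉ H → b ∉ H → (a ℕ.+ b) ∉ H

Enumerates : ℕ → List (List ℕ) → Set
Enumerates g L =
  Unique L × All (IsGapSetOfGenus g) L × (∀ H → IsGapSetOfGenus g H → H ∈ L)

ℕ→ℚ : ℕ → ℚ
ℕ→ℚ n = (+ n) ℚ./ 1

ℤ→ℚ : ℤ → ℚ
ℤ→ℚ z = z ℚ./ 1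

-- division by a natural number (division by 0 gives 0; only used for n ≥ 1)
divℕ : ℚ → ℕ → ℚ
divℕ q zero    = 0ℚ
divℕ q (suc n) = q ℚ.* ((+ 1) ℚ./ suc n)

weight : List ℕ → ℚ
weight H = ℕ→ℚ (sum H) ℚ.- (ℕ→ℚ (g ℕ.* (g ℕ.+ 1)) ℚ.* ((+ 1) ℚ./ 2))
  where g = length H

-- The constant c = 1/(10φ) = (√5 - 1)/20, φ = (1+√5)/2, is irrational.
-- Comparisons of a rational q with c:  q < c  ⇔  20q+1 < √5,  c < q ⇔ √5 < 20q+1.
t : ℚ → ℚ
t q = ℕ→ℚ 20 ℚ.* q ℚ.+ 1ℚ

BelowC : ℚ → Set
BelowC q = (t q ℚ.< 0ℚ) ⊎ ((0ℚ ℚ.≤ t q) × (t q ℚ.* t q ℚ.< ℕ→ℚ 5))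

AboveC : ℚ → Set
AboveC q = (0ℚ ℚ.< t q) × (ℕ→ℚ 5 ℚ.< t q ℚ.* t q)

BelowC? : ∀ q → Dec (BelowC q)
BelowC? q = (t q <? 0ℚ) ⊎-dec ((0ℚ ≤? t q) ×-dec (t q ℚ.* t q <? ℕ→ℚ 5))

AboveC? : ∀ q → Dec (AboveC q)
AboveC? q = (0ℚ <? t q) ×-dec (ℕ→ℚ 5 <? t q ℚ.* t q)

-- | x - 1/(10φ) | < ε   ⇔   x - ε < 1/(10φ) < x + ε
Near : ℚ → ℚ → Set
Near ε x = BelowC (x ℚ.- ε) × AboveC (x ℚ.+ ε)

Near? : ∀ ε x → Dec (Near ε x)
Near? ε x = BelowC? (x ℚ.- ε) ×-dec AboveC? (x ℚ.+ ε)

sumℚ : List ℚ → ℚ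
sumℚ = foldr ℚ._+_ 0ℚ

expectW : List (List ℕ) → ℚ
expectW L = divℕ (sumℚ (map weight L)) (length L)

normMean : ℕ → List (List ℕ) → ℚ
normMean g L = divℕ (expectW L) (g ℕ.* g)

-- The event |w(S) - g²/(10φ)| < ε g², written (for g ≥ 1) as |w(S)/g² - 1/(10φ)| < ε
Event : ℕ → ℚ → List ℕ → Set
Event g ε H = Near ε (divℕ (weight H) (g ℕ.* g))

Event? : ∀ g ε H → Dec (Event g ε H)
Event? g ε H = Near? ε (divℕ (weight H) (g ℕ.* g))

prob : ℕ → ℚ → List (List ℕ) → ℚ
prob g ε L = divℕ (ℕ→ℚ (length (filter (Event? g ε) L))) (length L)

{-# OPTIONS --safe #-}
module Submission where

-- Semigroups S of multiplicity m with Frobenius number below 2m correspond to compositions of g into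
-- parts 1 and 2: the i-th part is 1 or 2 according to whether m + i lies in S.  So there are at
-- least fib g semigroups of genus g, and w(S) is the number of inversions of the composition
-- (a 1 before a 2).  The ratio of consecutive binomial coefficients shows that all prefixes of all
-- but an exponentially small fraction of the compositions have about φ ones for each two, and
-- then the number of inversions is about g² / (10 φ).
--
-- Conversely, every S is such a composition up to subexponentially many choices.  Let D be the
-- elements of S in the first window of bounded length that contains many of them, near m say;
-- S is sparse below m.  Scan the later positions in increasing order, keeping the set Y ⊆ S of
-- sums of earlier elements and D.  A position p for which p + D is mostly outside Y can belong to
-- S only rarely, since it then enlarges Y.  Every other position is in Y, hence in S, or free.
-- Counting pairs in (p, p + D) shows that there are at most m + o(g) free positions, while the
-- genus is at least m plus the number of free gaps plus the number e of other gaps found in the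
-- scan, up to o(g).  The free positions therefore form a composition of size at most g - e + o(g),
-- so a linear e costs an exponential factor, and for small e the weight of S is that of the
-- composition up to o(g²).  As w(S) = O(g²), concentration also gives the mean.

open import Defs
open import Data.Nat hiding (_<_; _<?_; _≤?_; _≟_)
import Data.Nat as ℕ
open import Data.Nat.Properties hiding (_<?_; _≤?_; _≟_)
import Data.Nat.Properties as ℕₚ
open import Data.Nat.Tactic.RingSolver using (solve-∀)
open import Data.Bool using (Bool; true; false; _∧_; _∨_; not; if_then_else_; T)
open import Data.Bool.Properties using (∨-identityʳ; ∧-zeroʳ)
open import Data.Unit using (⊤; tt)
open import Data.Nat.DivMod using (_/_; _%_; m≡m%n+[m/n]*n; m%n<n)
open import Data.Empty using (⊥; ⊥-elim)
open import Data.List using (List; []; _∷_; _++_; length; map; filter; concatMap; cartesianProduct; cartesianProductWith; upTo; replicate; deduplicate)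
open import Data.List.Properties using (length-++; length-map; length-upTo; ∷-injectiveˡ; ∷-injectiveʳ; length-replicate; ≡-dec)
open import Data.Nat.ListAction using (sum)
open import Data.List.Membership.Propositional using (_∈_; _∉_)
open import Data.List.Membership.Propositional.Properties
open import Data.List.Relation.Unary.Any using (here; there)
open import Data.List.Relation.Unary.All as All using (All; []; _∷_)
open import Data.List.Relation.Unary.AllPairs as AllPairs using (AllPairs; []; _∷_)
open import Data.List.Relation.Unary.Linked using (Linked; []; linked?)
open import Data.List.Relation.Unary.Linked.Properties using (Linked⇒AllPairs; AllPairs⇒Linked)
open import Data.List.Relation.Unary.Unique.Propositional using (Unique)
import Data.List.Relation.Unary.Unique.Propositional.Properties as Uniqueₚ
open import Data.List.Relation.Unary.Unique.DecPropositional.Properties using (deduplicate-!)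
open import Data.List.Membership.DecPropositional ℕ._≟_ using (_∈?_)
open import Data.Product using (_×_; Σ; ∃; ∃₂; _,_; proj₁; proj₂)
open import Data.Sum using (_⊎_; inj₁; inj₂)
open import Function using (_∘_; id)
open import Relation.Nullary using (Dec; yes; no; ¬_)
open import Relation.Nullary.Decidable using (⌊_⌋; _×-dec_; _⊎-dec_; ¬?; map′)
open import Relation.Binary.PropositionalEquality using (_≡_; refl; sym; trans; cong; cong₂; subst; subst₂)
import Data.Integer as ℤ
import Data.Integer.Properties as ℤₚ
import Data.Rational as ℚ
open import Data.Rational using (ℚ; 0ℚ; 1ℚ; _<_; _-_)
import Data.Rational.Properties as ℚₚ
import Data.Rational.Unnormalised as ℚᵘ
import Data.Rational.Unnormalised.Properties as ℚᵘₚ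
open import Data.Maybe using (nothing)
open import Algebra using (module CommutativeRing)
open import Tactic.RingSolver.Core.AlmostCommutativeRing using (AlmostCommutativeRing; fromCommutativeSemiring)
import Tactic.RingSolver as Ring

-- In a typical composition of size h the number k of twos satisfies h = (φ + 2) k, and the i-th two
-- is preceded by about φ i ones. The inversions are then φ k² / 2 = h² / (10 φ), because (φ + 2)² =
-- 5 φ². The golden ratio is bracketed by p / q and (p + 2) / q, so that all estimates are integer
-- inequalities with relative error O(1 / q), and √5 enters only through squares at the end.
--
-- The obstacle is the balance of entropy and gain. Besides the composition, a code holds two bit
-- lists of length O(g), and these must cost less than an exceptional composition gains. With u of
-- order g / n², a list of length O(n² u) with at most u ones costs, crudely, O(n u) bits. A
-- deviation, or a number e, of order n u gains a larger multiple of n u bits; as n u is of order g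
-- / n, the tolerated deviations are still small against g. Windows of density 1 / k with k of order
-- n² make the lists that sparse. Polynomial factors and terms linear in u vanish in the remaining
-- room. The number of exceptional codes is finally compared with `fib g`.

scale : ∀ k {x y} → x ≤ y → k * x ≤ k * y
scale k = *-monoʳ-≤ k

infixl 6 _⊞_
_⊞_ : ∀ {a b c d} → a ≤ b → c ≤ d → a + c ≤ b + d
_⊞_ = +-mono-≤

infixl 7 _⊠_
_⊠_ : ∀ {a b c d} → a ≤ b → c ≤ d → a * c ≤ b * d
_⊠_ = *-mono-≤

-- A Farkas-style certificate: b - a = (y - x) + s for a combination x ≤ y of hypotheses,
-- with both sides moved so that no subtraction occurs.
cert : ∀ {a b x y} s → x ≤ y → a + y + s ≡ b + x → a ≤ b
cert {a} {b} {x} {y} s x≤y eq = +-cancelʳ-≤ x a b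
  (≤-trans (+-monoʳ-≤ a x≤y) (≤-trans (m≤m+n (a + y) s) (≤-reflexive eq)))

*-cancelʳ-≤′ : ∀ {a b} c → 1 ≤ c → a * c ≤ b * c → a ≤ b
*-cancelʳ-≤′ {a} {b} (suc c) _ h = *-cancelʳ-≤ a b (suc c) h

^-≥1 : ∀ {a} n → 1 ≤ a → 1 ≤ a ^ n
^-≥1 zero    h = ≤-refl
^-≥1 (suc n) h = h ⊠ ^-≥1 n h

^-distribʳ-* : ∀ n a b → (a * b) ^ n ≡ a ^ n * b ^ n
^-distribʳ-* zero    a b = refl
^-distribʳ-* (suc n) a b = trans (cong (a * b *_) (^-distribʳ-* n a b)) (lem a b (a ^ n) (b ^ n))
  where
  lem : ∀ a b x y → a * b * (x * y) ≡ a * x * (b * y)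
  lem = solve-∀

bernoulli : ∀ x n → x ^ suc n + suc n * x ^ n ≤ suc x ^ suc n
bernoulli x zero    = ≤-reflexive (lem x)
  where
  lem : ∀ x → x * 1 + 1 * 1 ≡ suc x * 1
  lem = solve-∀
bernoulli x (suc n) = ≤-trans (cert (n * x ^ n + x ^ n) ≤-refl (lem x n (x ^ n))) (scale (suc x) (bernoulli x n))
  where
  lem : ∀ x n z → x * (x * z) + suc (suc n) * (x * z) + 0 + (n * z + z) ≡ suc x * (x * z + suc n * z) + 0
  lem = solve-∀

2*-^≤suc-^ : ∀ x n → x ≤ n → 2 * x ^ n ≤ suc x ^ n ⊎ n ≡ 0
2*-^≤suc-^ x zero    h = inj₂ refl
2*-^≤suc-^ x (suc n) h = inj₁ (≤-trans (cert 0 (h ⊠ ≤-refl {x ^ n}) (lem x n (x ^ n))) (bernoulli x n))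
  where
  lem : ∀ x n z → 2 * (x * z) + suc n * z + 0 ≡ x * z + suc n * z + x * z
  lem = solve-∀

-- By Bernoulli, (1 + 1 / x)^W is at least 2 for 1 ≤ x ≤ W. This turns a ratio of bounded integers
-- that merely exceeds 1 into an explicit exponential gain.
gap-power : ∀ {x y} W j → x ℕ.< y → x ≤ W → 1 ≤ W → 2 ^ j * x ^ (W * j) ≤ y ^ (W * j)
gap-power {x} {y} (suc W) j x<y x≤W _ = subst₂′ (trans (^-distribʳ-* j 2 (x ^ suc W)) (cong (2 ^ j *_) (^-*-assoc x (suc W) j))) (^-*-assoc y (suc W) j)
    (^-monoˡ-≤ j (≤-trans step (^-monoˡ-≤ (suc W) x<y)))
  where
  step : 2 * x ^ suc W ≤ suc x ^ suc W
  step with 2*-^≤suc-^ x (suc W) x≤W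
  ... | inj₁ h = h
  subst₂′ : ∀ {a b c d} → a ≡ b → c ≡ d → a ≤ c → b ≤ d
  subst₂′ refl refl h = h

-- The index is shifted: `fib n` is the number of compositions of n into parts 1 and 2.
fib : ℕ → ℕ
fib 0             = 1
fib 1             = 1
fib (suc (suc n)) = fib (suc n) + fib n

fib≤fib-suc : ∀ n → fib n ≤ fib (suc n)
fib≤fib-suc zero    = ≤-refl
fib≤fib-suc (suc n) = m≤m+n _ _

fib-mono : ∀ {m n} → m ≤ n → fib m ≤ fib n
fib-mono {m} {n} h = subst (λ k → fib m ≤ fib k) (m∸n+n≡m h) (go (n ∸ m))
  where
  go : ∀ k → fib m ≤ fib (k + m)
  go zero    = ≤-refl
  go (suc k) = ≤-trans (go k) (fib≤fib-suc (k + m))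

fib-pos : ∀ n → 1 ≤ fib n
fib-pos n = fib-mono {0} {n} z≤n

-- Concatenation embeds pairs of compositions of m and n into the compositions of m + n.
fib-supermul : ∀ m n → fib m * fib n ≤ fib (m + n)
fib-supermul 0 n = ≤-reflexive (+-identityʳ (fib n))
fib-supermul 1 n = ≤-trans (≤-reflexive (+-identityʳ (fib n))) (fib≤fib-suc n)
fib-supermul (suc (suc m)) n =
  ≤-trans (≤-reflexive (*-distribʳ-+ (fib n) (fib (suc m)) (fib m))) (fib-supermul (suc m) n ⊞ fib-supermul m n)

2^*fib≤fib : ∀ y x → 2 ^ y * fib x ≤ fib (2 * y + x)
2^*fib≤fib zero    x = ≤-reflexive (+-identityʳ _)
2^*fib≤fib (suc y) x = subst (λ k → 2 ^ suc y * fib x ≤ fib (k + x)) (lem₂ y)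
  (≤-trans (≤-reflexive (*-assoc 2 (2 ^ y) (fib x))) (≤-trans (scale 2 (2^*fib≤fib y x))
    (cert 0 (fib≤fib-suc (2 * y + x)) (lem (fib (2 * y + x)) (fib (suc (2 * y + x)))))))
  where
  lem : ∀ a b → 2 * a + b + 0 ≡ b + a + a
  lem = solve-∀
  lem₂ : ∀ y → 2 + 2 * y ≡ 2 * suc y
  lem₂ = solve-∀

fib≤2^*fib : ∀ k x → fib (k + x) ≤ 2 ^ k * fib x
fib≤2^*fib zero    x = ≤-reflexive (sym (+-identityʳ _))
fib≤2^*fib (suc k) x = ≤-trans (step (k + x)) (≤-trans (scale 2 (fib≤2^*fib k x)) (≤-reflexive (sym (*-assoc 2 (2 ^ k) (fib x)))))
  where
  step : ∀ n → fib (suc n) ≤ 2 * fib n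
  step zero    = s≤s z≤n
  step (suc n) = cert 0 (fib≤fib-suc n) (lem (fib (suc n)) (fib n))
    where
    lem : ∀ a b → a + b + a + 0 ≡ 2 * a + b
    lem = solve-∀

-- Pigeonhole principle. `ys` may repeat entries, so candidate codes can be collected by mere
-- concatenation.
length-injection : ∀ {A B : Set} (f : A → B) (xs : List A) (ys : List B) → Unique xs →
  (∀ {x} → x ∈ xs → f x ∈ ys) → (∀ {x y} → x ∈ xs → y ∈ xs → f x ≡ f y → x ≡ y) → length xs ≤ length ys
length-injection f []       ys _        _  _   = z≤n
length-injection f (x ∷ xs) ys (x∉ ∷ u) f∈ inj with ∈-∃++ (f∈ (here refl))
... | as , bs , refl = ≤-trans (s≤s (length-injection f xs (as ++ bs) u f∈′ (λ p q → inj (there p) (there q))))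
      (≤-reflexive (trans (cong suc (length-++ as)) (trans (sym (+-suc _ _)) (sym (length-++ as)))))
  where
  f∈′ : ∀ {z} → z ∈ xs → f z ∈ as ++ bs
  f∈′ z∈ with ∈-++⁻ as (f∈ (there z∈))
  ... | inj₁ p           = ∈-++⁺ˡ p
  ... | inj₂ (there p)   = ∈-++⁺ʳ as p
  ... | inj₂ (here fz≡fx) = ⊥-elim (All.lookup x∉ z∈ (sym (inj (there z∈) (here refl) fz≡fx)))

-- The factor `c` stands for an exponential saving `2 ^ j`, kept on the left in place of a division.
length-concatMap-≤ : ∀ {A B : Set} (f : A → List B) c k (xs : List A) → (∀ x → c * length (f x) ≤ k) → c * length (concatMap f xs) ≤ length xs * k
length-concatMap-≤ f c k []       h = ≤-reflexive (*-zeroʳ c)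
length-concatMap-≤ f c k (x ∷ xs) h = ≤-trans (≤-reflexive (trans (cong (c *_) (length-++ (f x))) (*-distribˡ-+ c _ _)))
  (h x ⊞ length-concatMap-≤ f c k xs h)

∈-concatMap : ∀ {A B : Set} (f : A → List B) {x xs y} → x ∈ xs → y ∈ f x → y ∈ concatMap f xs
∈-concatMap f {xs = x ∷ xs} (here refl) y∈ = ∈-++⁺ˡ y∈
∈-concatMap f {xs = x ∷ xs} (there x∈)  y∈ = ∈-++⁺ʳ (f x) (∈-concatMap f x∈ y∈)

length-cartesianProductWith : ∀ {A B C : Set} (f : A → B → C) xs ys → length (cartesianProductWith f xs ys) ≡ length xs * length ys
length-cartesianProductWith f []       ys = refl
length-cartesianProductWith f (x ∷ xs) ys = trans (length-++ (map (f x) ys)) (cong₂ _+_ (length-map (f x) ys) (length-cartesianProductWith f xs ys))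

-- Compositions into parts 1 and 2

trues falses size : List Bool → ℕ
trues []           = 0
trues (true  ∷ v)  = suc (trues v)
trues (false ∷ v)  = trues v
falses []          = 0
falses (true  ∷ v) = falses v
falses (false ∷ v) = suc (falses v)
size []            = 0
size (true  ∷ v)   = 1 + size v
size (false ∷ v)   = 2 + size v

trues-++ : ∀ v w → trues (v ++ w) ≡ trues v + trues w
trues-++ []          w = refl
trues-++ (true  ∷ v) w = cong suc (trues-++ v w)
trues-++ (false ∷ v) w = trues-++ v w

falses-++ : ∀ v w → falses (v ++ w) ≡ falses v + falses w
falses-++ []          w = refl
falses-++ (true  ∷ v) w = falses-++ v w
falses-++ (false ∷ v) w = cong suc (falses-++ v w)

trues+falses : ∀ v → trues v + falses v ≡ length v
trues+falses []          = refl
trues+falses (true  ∷ v) = cong suc (trues+falses v)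
trues+falses (false ∷ v) = trans (+-suc (trues v) (falses v)) (cong suc (trues+falses v))

size-++ : ∀ v w → size (v ++ w) ≡ size v + size w
size-++ []          w = refl
size-++ (true  ∷ v) w = cong suc (size-++ v w)
size-++ (false ∷ v) w = cong (λ k → suc (suc k)) (size-++ v w)

size≡ : ∀ v → size v ≡ trues v + 2 * falses v
size≡ []          = refl
size≡ (true  ∷ v) = cong suc (size≡ v)
size≡ (false ∷ v) = trans (cong (2 +_) (size≡ v)) (lem (trues v) (falses v))
  where
  lem : ∀ a b → 2 + (a + 2 * b) ≡ a + 2 * (1 + b)
  lem = solve-∀

-- The compositions of h into parts 1 (true) and 2 (false).
words : ℕ → List (List Bool)
words 0             = [] ∷ []
words 1             = (true ∷ []) ∷ []
words (suc (suc h)) = map (true ∷_) (words (suc h)) ++ map (false ∷_) (words h)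

length-words : ∀ h → length (words h) ≡ fib h
length-words 0             = refl
length-words 1             = refl
length-words (suc (suc h)) = trans (length-++ (map (true ∷_) (words (suc h))))
  (cong₂ _+_ (trans (length-map _ (words (suc h))) (length-words (suc h))) (trans (length-map _ (words h)) (length-words h)))

∈-words : ∀ v → v ∈ words (size v)
∈-words []          = here refl
∈-words (true  ∷ v) = go (size v) (∈-words v)
  where
  go : ∀ h → v ∈ words h → (true ∷ v) ∈ words (suc h)
  go zero    (here refl) = here refl
  go (suc h) v∈          = ∈-++⁺ˡ (∈-map⁺ (true ∷_) v∈)
∈-words (false ∷ v) = ∈-++⁺ʳ (map (true ∷_) (words (suc (size v)))) (∈-map⁺ (false ∷_) (∈-words v))

size-words : ∀ h {v} → v ∈ words h → size v ≡ h
size-words 0             (here refl) = refl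
size-words 1             (here refl) = refl
size-words (suc (suc h)) v∈ with ∈-++⁻ (map (true ∷_) (words (suc h))) v∈
... | inj₁ p with ∈-map⁻ (true ∷_) p
...   | w , w∈ , refl = cong suc (size-words (suc h) w∈)
size-words (suc (suc h)) v∈ | inj₂ p with ∈-map⁻ (false ∷_) p
...   | w , w∈ , refl = cong (2 +_) (size-words h w∈)

words-unique : ∀ h → Unique (words h)
words-unique 0             = [] ∷ []
words-unique 1             = [] ∷ []
words-unique (suc (suc h)) = Uniqueₚ.++⁺ (Uniqueₚ.map⁺ ∷-injectiveʳ (words-unique (suc h))) (Uniqueₚ.map⁺ ∷-injectiveʳ (words-unique h)) disjoint
  where
  disjoint : ∀ {v} → ¬ (v ∈ map (true ∷_) (words (suc h)) × v ∈ map (false ∷_) (words h))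
  disjoint (p , q) with ∈-map⁻ (true ∷_) p | ∈-map⁻ (false ∷_) q
  ... | _ , _ , refl | _ , _ , ()

-- Large deviations of the ratio of ones (b of them) to twos (a of them)

arrangements : ℕ → ℕ → List (List Bool)
arrangements zero    zero    = [] ∷ []
arrangements (suc b) zero    = map (true ∷_) (arrangements b zero)
arrangements zero    (suc a) = map (false ∷_) (arrangements zero a)
arrangements (suc b) (suc a) = map (true ∷_) (arrangements b (suc a)) ++ map (false ∷_) (arrangements (suc b) a)

∈-arrangements : ∀ v → v ∈ arrangements (trues v) (falses v)
∈-arrangements []         = here refl
∈-arrangements (true ∷ v) = go (falses v) (∈-arrangements v)
  where
  go : ∀ a → v ∈ arrangements (trues v) a → (true ∷ v) ∈ arrangements (suc (trues v)) a
  go zero    v∈ = ∈-map⁺ (true ∷_) v∈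
  go (suc a) v∈ = ∈-++⁺ˡ (∈-map⁺ (true ∷_) v∈)
∈-arrangements (false ∷ v) = go (trues v) (∈-arrangements v)
  where
  go : ∀ b → v ∈ arrangements b (falses v) → (false ∷ v) ∈ arrangements b (suc (falses v))
  go zero    v∈ = ∈-map⁺ (false ∷_) v∈
  go (suc b) v∈ = ∈-++⁺ʳ (map (true ∷_) (arrangements b (suc (falses v)))) (∈-map⁺ (false ∷_) v∈)

-- The binomial coefficient of a + b over a.
binom : ℕ → ℕ → ℕ
binom zero    a       = 1
binom (suc b) zero    = 1
binom (suc b) (suc a) = binom b (suc a) + binom (suc b) a

length-arrangements : ∀ b a → length (arrangements b a) ≡ binom b a
length-arrangements zero    zero    = refl
length-arrangements (suc zero) zero = refl
length-arrangements (suc (suc b)) zero = trans (length-map _ (arrangements (suc b) zero)) (length-arrangements (suc b) zero)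
length-arrangements zero    (suc a) = trans (length-map _ (arrangements zero a)) (length-arrangements zero a)
length-arrangements (suc b) (suc a) = trans (length-++ (map (true ∷_) (arrangements b (suc a))))
  (cong₂ _+_ (trans (length-map _ (arrangements b (suc a))) (length-arrangements b (suc a)))
             (trans (length-map _ (arrangements (suc b) a)) (length-arrangements (suc b) a)))

-- The two absorption identities need each other: Pascal's rule splits one side into two terms, and
-- the two identities together convert one of these into a multiple of the other.
binom-sucʳ : ∀ b a → suc a * binom b (suc a) ≡ suc (a + b) * binom b a
binom-sucˡ : ∀ b a → suc b * binom (suc b) a ≡ suc (a + b) * binom b a

binom-sucʳ zero    a = cong (λ k → suc k * 1) (sym (+-identityʳ a))
binom-sucʳ (suc b) a = trans (*-distribˡ-+ (suc a) (binom b (suc a)) (binom (suc b) a))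
  (trans (cong (_+ suc a * binom (suc b) a) (trans (binom-sucʳ b a) (sym (binom-sucˡ b a))))
  (lem a b (binom (suc b) a)))
  where
  lem : ∀ a b z → (1 + b) * z + (1 + a) * z ≡ (1 + (a + (1 + b))) * z
  lem = solve-∀

binom-sucˡ zero    zero    = refl
binom-sucˡ (suc b) zero    = refl
binom-sucˡ b       (suc a) = trans (*-distribˡ-+ (suc b) (binom b (suc a)) (binom (suc b) a))
  (trans (cong (suc b * binom b (suc a) +_) (trans (binom-sucˡ b a) (sym (binom-sucʳ b a))))
  (lem a b (binom b (suc a))))
  where
  lem : ∀ a b z → (1 + b) * z + (1 + a) * z ≡ (1 + ((1 + a) + b)) * z
  lem = solve-∀

binom≤fib : ∀ b a → binom b a ≤ fib (b + 2 * a)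
binom≤fib zero    a       = fib-pos (2 * a)
binom≤fib (suc b) zero    = fib-pos (suc (b + 0))
binom≤fib (suc b) (suc a) = subst (binom (suc b) (suc a) ≤_) (cong fib (lem₃ b a))
  (≤-trans (binom≤fib b (suc a) ⊞ binom≤fib (suc b) a) (≤-reflexive (cong₂ _+_ (cong fib (lem₁ b a)) (cong fib (lem₂ b a)))))
  where
  lem₁ : ∀ b a → b + 2 * (1 + a) ≡ 1 + (1 + (b + 2 * a))
  lem₁ = solve-∀
  lem₂ : ∀ b a → 1 + b + 2 * a ≡ 1 + (b + 2 * a)
  lem₂ = solve-∀
  lem₃ : ∀ b a → 1 + (1 + (1 + (b + 2 * a))) ≡ 1 + b + 2 * (1 + a)
  lem₃ = solve-∀

-- Trading two 1-parts for one 2-part: the ratio of consecutive counts is a rational function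
-- of b and a that crosses 1 where b / a crosses the golden ratio.
binom-exchange : ∀ b a → binom b (suc a) * (suc a * suc (suc (a + b))) ≡ binom (suc (suc b)) a * (suc (suc b) * suc b)
binom-exchange b a = trans (lem₁ (binom b (suc a)) (suc a) (suc (suc (a + b)))) (trans (cong (_* suc (suc (a + b))) (binom-sucʳ b a))
  (trans (lem₂ (suc (suc (a + b))) (suc (a + b)) (binom b a))
  (trans (cong (suc (suc (a + b)) *_) (sym (binom-sucˡ b a)))
  (trans (lem₃ (suc (suc (a + b))) (suc b) (binom (suc b) a))
  (trans (cong (suc b *_) (trans (cong (λ k → suc k * binom (suc b) a) (sym (+-suc a b))) (sym (binom-sucˡ (suc b) a))))
    (lem₄ (suc b) (suc (suc b)) (binom (suc (suc b)) a)))))))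
  where
  lem₁ : ∀ z x y → z * (x * y) ≡ x * z * y
  lem₁ = solve-∀
  lem₂ : ∀ x y z → y * z * x ≡ x * (y * z)
  lem₂ = solve-∀
  lem₃ : ∀ x y z → x * (y * z) ≡ y * (x * z)
  lem₃ = solve-∀
  lem₄ : ∀ x y z → x * (y * z) ≡ z * (y * x)
  lem₄ = solve-∀

module _ {p q : ℕ} where

  -- With x = b / a the ratio in `binom-exchange` is about x² / (1 + x). This is increasing in x and
  -- equals p² / (p q + q²) at x = p / q.
  few-ones-step : ∀ b a → q * suc (suc b) ≤ p * suc a → (p * q + q * q) * binom b (suc a) ≤ p * p * binom (suc (suc b)) a
  few-ones-step b a h = *-cancelʳ-≤′ (suc a * suc (suc (a + b))) (s≤s z≤n)
    (≤-trans (≤-reflexive (trans (*-assoc (p * q + q * q) (binom b (suc a)) _) (cong ((p * q + q * q) *_) (binom-exchange b a))))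
    (≤-trans (≤-reflexive (lem₁ (p * q + q * q) (binom (suc (suc b)) a) (suc (suc b) * suc b)))
    (≤-trans (scale (binom (suc (suc b)) a) (cert (q * q * suc (suc b)) (h ⊠ h ⊞ scale (p * suc b) h) (lem₂ p q a b)))
    (≤-reflexive (lem₃ (binom (suc (suc b)) a) (p * p) (suc a * suc (suc (a + b))))))))
    where
    lem₁ : ∀ x n y → x * (n * y) ≡ n * (x * y)
    lem₁ = solve-∀
    lem₂ : ∀ p q a b → (p * q + q * q) * ((2 + b) * (1 + b)) + (p * (1 + a) * (p * (1 + a)) + p * (1 + b) * (p * (1 + a))) + q * q * (2 + b)
         ≡ p * p * ((1 + a) * (2 + (a + b))) + (q * (2 + b) * (q * (2 + b)) + p * (1 + b) * (q * (2 + b)))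
    lem₂ = solve-∀
    lem₃ : ∀ n x y → n * (x * y) ≡ x * n * y
    lem₃ = solve-∀

  many-ones-step : ∀ b a → p * suc a ≤ q * suc b → p * p * binom (suc (suc b)) a ≤ (p * q + q * q) * binom b (suc a)
  many-ones-step b a h = *-cancelʳ-≤′ (suc (suc b) * suc b) (s≤s z≤n)
    (≤-trans (≤-reflexive (trans (*-assoc (p * p) (binom (suc (suc b)) a) _) (cong (p * p *_) (sym (binom-exchange b a)))))
    (≤-trans (≤-reflexive (lem₁ (p * p) (binom b (suc a)) (suc a * suc (suc (a + b)))))
    (≤-trans (scale (binom b (suc a)) (cert (q * q * suc b + p * q * suc b) (h ⊠ h ⊞ scale (p * suc b) h) (lem₂ p q a b)))
    (≤-reflexive (lem₃ (binom b (suc a)) (p * q + q * q) (suc (suc b) * suc b))))))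
    where
    lem₁ : ∀ x n y → x * (n * y) ≡ n * (x * y)
    lem₁ = solve-∀
    lem₂ : ∀ p q a b → p * p * ((1 + a) * (2 + (a + b))) + (q * (1 + b) * (q * (1 + b)) + p * (1 + b) * (q * (1 + b))) + (q * q * (1 + b) + p * q * (1 + b))
         ≡ (p * q + q * q) * ((2 + b) * (1 + b)) + (p * (1 + a) * (p * (1 + a)) + p * (1 + b) * (p * (1 + a)))
    lem₂ = solve-∀
    lem₃ : ∀ n x y → n * (x * y) ≡ x * n * y
    lem₃ = solve-∀

  -- A chain of s exchanges. The hypothesis is imposed at the end with the most ones, where it is
  -- hardest to satisfy; in `many-ones` the critical end is the one with the fewest.
  few-ones : ∀ s b a → q * (b + 2 * s) ≤ p * suc a → binom b (s + a) * (p * q + q * q) ^ s ≤ (p * p) ^ s * binom (b + 2 * s) a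
  few-ones zero    b a h = ≤-reflexive (trans (*-identityʳ _) (trans (cong (λ k → binom k a) (sym (+-identityʳ b))) (sym (+-identityʳ _))))
  few-ones (suc s) b a h =
    ≤-trans (≤-reflexive (lem₁ (binom b (suc (s + a))) (p * q + q * q) ((p * q + q * q) ^ s)))
    (≤-trans (few-ones-step b (s + a) h₁ ⊠ ≤-refl {(p * q + q * q) ^ s})
    (≤-trans (≤-reflexive (*-assoc (p * p) _ _))
    (≤-trans (scale (p * p) (few-ones s (suc (suc b)) a (subst (λ k → q * k ≤ p * suc a) (lem₂ b s) h)))
    (≤-reflexive (trans (sym (*-assoc (p * p) _ _)) (cong (λ k → (p * p) ^ suc s * binom k a) (sym (lem₂ b s))))))))
    where
    lem₁ : ∀ n x y → n * (x * y) ≡ x * n * y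
    lem₁ = solve-∀
    lem₂ : ∀ b s → b + 2 * (1 + s) ≡ 2 + (b + 2 * s)
    lem₂ = solve-∀
    h₁ : q * suc (suc b) ≤ p * suc (s + a)
    h₁ = ≤-trans (scale q (≤-trans (m≤m+n (suc (suc b)) (2 * s)) (≤-reflexive (sym (lem₂ b s))))) (≤-trans h (scale p (s≤s (m≤n+m a s))))

  many-ones : ∀ s b a → p * (s + a) ≤ q * suc b → binom (b + 2 * s) a * (p * p) ^ s ≤ (p * q + q * q) ^ s * binom b (s + a)
  many-ones zero    b a h = ≤-reflexive (trans (*-identityʳ _) (trans (cong (λ k → binom k a) (+-identityʳ b)) (sym (+-identityʳ _))))
  many-ones (suc s) b a h =
    ≤-trans (≤-reflexive (trans (cong (λ k → binom k a * (p * p) ^ suc s) (lem₂ b s)) (lem₁ (binom (suc (suc b) + 2 * s) a) (p * p) ((p * p) ^ s))))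
    (≤-trans (scale (p * p) (many-ones s (suc (suc b)) a h₁))
    (≤-trans (≤-reflexive (lem₃ (p * p) ((p * q + q * q) ^ s) (binom (suc (suc b)) (s + a))))
    (≤-trans (≤-refl {(p * q + q * q) ^ s} ⊠ many-ones-step b (s + a) h)
    (≤-reflexive (lem₄ ((p * q + q * q) ^ s) (p * q + q * q) (binom b (suc (s + a))))))))
    where
    lem₁ : ∀ n x y → n * (x * y) ≡ x * (n * y)
    lem₁ = solve-∀
    lem₂ : ∀ b s → b + 2 * (1 + s) ≡ 2 + (b + 2 * s)
    lem₂ = solve-∀
    lem₃ : ∀ x y n → x * (y * n) ≡ y * (x * n)
    lem₃ = solve-∀
    lem₄ : ∀ x y n → x * (y * n) ≡ y * x * n
    lem₄ = solve-∀
    h₁ : p * (s + a) ≤ q * suc (suc (suc b))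
    h₁ = ≤-trans (scale p (n≤1+n (s + a))) (≤-trans h (scale q (s≤s (m≤n+m b 2))))

-- p / q and P / q will be approximations of the golden ratio from below and from above.
Deviates : (q p P Δ b a : ℕ) → Set
Deviates q p P Δ b a = (q * b + Δ ≤ p * a) ⊎ (P * a + Δ ≤ q * b)

deviates? : ∀ q p P Δ b a → Dec (Deviates q p P Δ b a)
deviates? q p P Δ b a = (q * b + Δ ℕₚ.≤? p * a) ⊎-dec (P * a + Δ ℕₚ.≤? q * b)

module LargeDeviations (q p P j : ℕ) (1≤q : 1 ≤ q) (1≤p : 1 ≤ p) (p≤P : p ≤ P)
  (below : p * p ℕ.< p * q + q * q) (above : P * q + q * q ℕ.< P * P) where

  -- An exchange changes b by 2 and a by 1, hence q b by 2 q and P a by P, so a deviation of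
  -- `margin` survives `steps` exchanges. P * P is the W of `gap-power`: it bounds the smaller of
  -- the two integers compared, and that many exchanges gain a factor 2.
  steps margin : ℕ
  steps  = P * P * j
  margin = steps * (P + 2 * q)

  cancel-power : ∀ {x y n m} → x ℕ.< y → 1 ≤ x → x ≤ P * P → n * y ^ steps ≤ x ^ steps * m → 2 ^ j * n ≤ m
  cancel-power {x} {y} {n} {m} x<y 1≤x x≤W h = *-cancelʳ-≤′ (x ^ steps) (^-≥1 steps 1≤x)
    (≤-trans (≤-reflexive (lem₁ (2 ^ j) n (x ^ steps)))
    (≤-trans (scale n (gap-power (P * P) j x<y x≤W ((≤-trans 1≤p p≤P) ⊠ (≤-trans 1≤p p≤P))))
    (≤-trans h (≤-reflexive (*-comm (x ^ steps) m)))))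
    where
    lem₁ : ∀ t n y → t * n * y ≡ n * (t * y)
    lem₁ = solve-∀

  -- Exchanging `steps` times towards the golden ratio keeps b + 2 a and multiplies the count by at
  -- least `2 ^ j`, and the count reached is still at most the number of compositions of b + 2 a.
  binom-deviates : ∀ b a → Deviates q p P margin b a → 2 ^ j * binom b a ≤ fib (b + 2 * a)
  binom-deviates b a (inj₁ h) = cancel-power below (1≤p ⊠ 1≤p) (p≤P ⊠ p≤P)
      (subst (λ k → binom b k * (p * q + q * q) ^ steps ≤ (p * p) ^ steps * fib (b + 2 * a)) (m+[n∸m]≡n steps≤a)
        (≤-trans (few-ones {p} {q} steps b (a ∸ steps) h₁)
        (scale ((p * p) ^ steps) (subst (λ k → binom (b + 2 * steps) (a ∸ steps) ≤ fib k) (trans (lem b steps (a ∸ steps)) (cong (λ k → b + 2 * k) (m+[n∸m]≡n steps≤a))) (binom≤fib (b + 2 * steps) (a ∸ steps))))))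
    where
    lem : ∀ b s a → b + 2 * s + 2 * a ≡ b + 2 * (s + a)
    lem = solve-∀
    steps≤a : steps ≤ a
    steps≤a = *-cancelʳ-≤′ p 1≤p (≤-trans (scale steps p≤P) (≤-trans (cert (q * b + 2 * q * steps) h (lem₂ steps P q b (p * a))) (≤-reflexive (*-comm p a))))
      where
      lem₂ : ∀ s P q b x → s * P + x + (q * b + 2 * q * s) ≡ x + (q * b + s * (P + 2 * q))
      lem₂ = solve-∀
    h₁ : q * (b + 2 * steps) ≤ p * suc (a ∸ steps)
    h₁ = cert (p + steps * (P ∸ p)) (subst (λ k → q * b + steps * (k + 2 * q) ≤ p * (steps + (a ∸ steps))) (sym (m+[n∸m]≡n p≤P)) (subst (λ k → q * b + margin ≤ p * k) (sym (m+[n∸m]≡n steps≤a)) h)) (lem₃ q b steps p (a ∸ steps) (P ∸ p))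
      where
      lem₃ : ∀ q b s p a r → q * (b + 2 * s) + p * (s + a) + (p + s * r) ≡ p * (1 + a) + (q * b + s * (p + r + 2 * q))
      lem₃ = solve-∀
  binom-deviates b a (inj₂ h) = cancel-power above ((≤-trans 1≤p p≤P ⊠ 1≤q) ⊞ z≤n {q * q}) (<⇒≤ above)
      (subst (λ k → binom k a * (P * P) ^ steps ≤ (P * q + q * q) ^ steps * fib (b + 2 * a)) (m∸n+n≡m 2steps≤b)
        (≤-trans (many-ones {P} {q} steps (b ∸ 2 * steps) a h₁)
        (scale ((P * q + q * q) ^ steps) (subst (λ k → binom (b ∸ 2 * steps) (steps + a) ≤ fib k) (trans (lem (b ∸ 2 * steps) steps a) (cong (_+ 2 * a) (m∸n+n≡m 2steps≤b))) (binom≤fib (b ∸ 2 * steps) (steps + a))))))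
    where
    lem : ∀ b s a → b + 2 * (s + a) ≡ b + 2 * s + 2 * a
    lem = solve-∀
    2steps≤b : 2 * steps ≤ b
    2steps≤b = *-cancelʳ-≤′ q 1≤q (≤-trans (cert (P * a + steps * P) h (lem₂ steps P q a (q * b))) (≤-reflexive (*-comm q b)))
      where
      lem₂ : ∀ s P q a x → 2 * s * q + x + (P * a + s * P) ≡ x + (P * a + s * (P + 2 * q))
      lem₂ = solve-∀
    h₁ : P * (steps + a) ≤ q * suc (b ∸ 2 * steps)
    h₁ = cert q (subst (λ k → P * a + margin ≤ q * k) (sym (m∸n+n≡m 2steps≤b)) h) (lem₃ P steps a q (b ∸ 2 * steps))
      where
      lem₃ : ∀ P s a q b → P * (s + a) + q * (b + 2 * s) + q ≡ q * (1 + b) + (P * a + s * (P + 2 * q))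
      lem₃ = solve-∀

  deviating-from : ℕ → ℕ → ℕ → List (List Bool)
  deviating-from h b a with deviates? q p P margin b a ×-dec (b + 2 * a ℕₚ.≤? h)
  ... | yes _ = cartesianProductWith _++_ (arrangements b a) (words (h ∸ (b + 2 * a)))
  ... | no  _ = []

  deviating : ℕ → List (List Bool)
  deviating h = concatMap (λ b → concatMap (deviating-from h b) (upTo (suc h))) (upTo (suc h))

  ∈-deviating : ∀ v w → Deviates q p P margin (trues v) (falses v) → v ++ w ∈ deviating (size (v ++ w))
  ∈-deviating v w d = ∈-concatMap (λ b → concatMap (deviating-from h b) (upTo (suc h))) (∈-upTo⁺ (s≤s b≤)) (∈-concatMap (deviating-from h (trues v)) (∈-upTo⁺ (s≤s a≤)) in-from)
    where
    h = size (v ++ w)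
    sz : trues v + 2 * falses v + size w ≡ h
    sz = trans (cong (_+ size w) (sym (size≡ v))) (sym (size-++ v w))
    t≤ : trues v + 2 * falses v ≤ h
    t≤ = ≤-trans (m≤m+n _ (size w)) (≤-reflexive sz)
    b≤ : trues v ≤ h
    b≤ = ≤-trans (m≤m+n _ _) t≤
    a≤ : falses v ≤ h
    a≤ = ≤-trans (≤-trans (m≤m+n (falses v) _) (m≤n+m _ (trues v))) t≤
    in-from : v ++ w ∈ deviating-from h (trues v) (falses v)
    in-from with deviates? q p P margin (trues v) (falses v) ×-dec (trues v + 2 * falses v ℕₚ.≤? h)
    ... | no ¬x = ⊥-elim (¬x (d , t≤))
    ... | yes _ = ∈-cartesianProductWith⁺ _++_ (∈-arrangements v)
          (subst (λ k → w ∈ words k) (trans (sym (m+n∸m≡n (trues v + 2 * falses v) (size w))) (cong (_∸ (trues v + 2 * falses v)) sz)) (∈-words w))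

  -- Union bound over the counts (b, a) of the deviating prefix. The remainder is an arbitrary
  -- composition, and `fib-supermul` merges the two factors.
  length-deviating : ∀ h → 2 ^ j * length (deviating h) ≤ suc h * (suc h * fib h)
  length-deviating h = ≤-trans (length-concatMap-≤ (λ b → concatMap (deviating-from h b) (upTo (suc h))) (2 ^ j) (suc h * fib h) (upTo (suc h)) inner) (≤-reflexive (cong (_* (suc h * fib h)) (length-upTo (suc h))))
    where
    from : ∀ b a → 2 ^ j * length (deviating-from h b a) ≤ fib h
    from b a with deviates? q p P margin b a ×-dec (b + 2 * a ℕₚ.≤? h)
    ... | no  _        = ≤-trans (≤-reflexive (*-zeroʳ (2 ^ j))) z≤n
    ... | yes (d , le) = ≤-trans (≤-reflexive (trans (cong (2 ^ j *_) (trans (length-cartesianProductWith _++_ (arrangements b a) _) (cong₂ _*_ (length-arrangements b a) (length-words (h ∸ (b + 2 * a)))))) (sym (*-assoc (2 ^ j) _ _))))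
           (≤-trans (binom-deviates b a d ⊠ ≤-refl {fib (h ∸ (b + 2 * a))}) (≤-trans (fib-supermul (b + 2 * a) _) (≤-reflexive (cong fib (m+[n∸m]≡n le)))))
    inner : ∀ b → 2 ^ j * length (concatMap (deviating-from h b) (upTo (suc h))) ≤ suc h * fib h
    inner b = ≤-trans (length-concatMap-≤ (deviating-from h b) (2 ^ j) (fib h) (upTo (suc h)) (from b)) (≤-reflexive (cong (_* fib h) (length-upTo (suc h))))

-- Applied to the indicator of S ∖ {0}, this is the weight w(S): gap number i + 1 exceeds i + 1
-- by the number of nonzero elements of S below it.
inversions : List Bool → ℕ
inversions []          = 0
inversions (true  ∷ v) = falses v + inversions v
inversions (false ∷ v) = inversions v

inversions-++ : ∀ v w → inversions (v ++ w) ≡ inversions v + inversions w + trues v * falses w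
inversions-++ []          w = sym (+-identityʳ _)
inversions-++ (true  ∷ v) w = trans (cong₂ _+_ (falses-++ v w) (inversions-++ v w)) (lem (falses v) (falses w) (inversions v) (inversions w) (trues v))
  where
  lem : ∀ a b c d e → a + b + (c + d + e * b) ≡ a + c + d + (1 + e) * b
  lem = solve-∀
inversions-++ (false ∷ v) w = inversions-++ v w

inversions≤ : ∀ v → inversions v ≤ trues v * falses v
inversions≤ []          = z≤n
inversions≤ (true  ∷ v) = +-monoʳ-≤ (falses v) (inversions≤ v)
inversions≤ (false ∷ v) = ≤-trans (inversions≤ v) (scale (trues v) (n≤1+n (falses v)))

-- Inversions of compositions all of whose prefixes are balanced

module _ (q p P Δ : ℕ) where

  Balanced : ℕ → ℕ → List Bool → Set
  Balanced b a []          = ¬ Deviates q p P Δ b a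
  Balanced b a (true  ∷ v) = ¬ Deviates q p P Δ b a × Balanced (suc b) a v
  Balanced b a (false ∷ v) = ¬ Deviates q p P Δ b a × Balanced b (suc a) v

  balanced-or-deviates : ∀ b a v → (∃₂ λ v₁ v₂ → v ≡ v₁ ++ v₂ × Deviates q p P Δ (trues v₁ + b) (falses v₁ + a)) ⊎ Balanced b a v
  balanced-or-deviates b a v with deviates? q p P Δ b a
  balanced-or-deviates b a v           | yes d = inj₁ ([] , v , refl , d)
  balanced-or-deviates b a []          | no ¬d = inj₂ ¬d
  balanced-or-deviates b a (true ∷ v)  | no ¬d with balanced-or-deviates (suc b) a v
  ... | inj₁ (v₁ , v₂ , refl , d) = inj₁ (true ∷ v₁ , v₂ , refl , subst (λ k → Deviates q p P Δ k (falses v₁ + a)) (+-suc (trues v₁) b) d)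
  ... | inj₂ bal                  = inj₂ (¬d , bal)
  balanced-or-deviates b a (false ∷ v) | no ¬d with balanced-or-deviates b (suc a) v
  ... | inj₁ (v₁ , v₂ , refl , d) = inj₁ (false ∷ v₁ , v₂ , refl , subst (Deviates q p P Δ (trues v₁ + b)) (+-suc (falses v₁) a) d)
  ... | inj₂ bal                  = inj₂ (¬d , bal)

  not-few : ∀ {b a} → ¬ Deviates q p P Δ b a → p * a ≤ q * b + Δ
  not-few ¬d = <⇒≤ (≰⇒> (¬d ∘ inj₁))

  not-many : ∀ {b a} → ¬ Deviates q p P Δ b a → q * b ≤ P * a + Δ
  not-many ¬d = <⇒≤ (≰⇒> (¬d ∘ inj₂))

  balanced-end : ∀ b a v → Balanced b a v → ¬ Deviates q p P Δ (trues v + b) (falses v + a)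
  balanced-end b a []          bal       = bal
  balanced-end b a (true  ∷ v) (_ , bal) = subst (λ k → ¬ Deviates q p P Δ k (falses v + a)) (+-suc (trues v) b) (balanced-end (suc b) a v bal)
  balanced-end b a (false ∷ v) (_ , bal) = subst (λ k → ¬ Deviates q p P Δ (trues v + b) k) (+-suc (falses v) a) (balanced-end b (suc a) v bal)

  -- `b * falses v + inversions v` counts the inversions whose two lies in v when b ones precede v.
  -- A two with a twos before it sees at most (P a + Δ) / q ones, and the sum over a telescopes to P
  -- a² / (2 q).
  balanced-inversions-≤ : ∀ b a v → Balanced b a v →
    2 * q * (b * falses v + inversions v) + P * (a * a) ≤ P * ((a + falses v) * (a + falses v)) + 2 * Δ * falses v
  balanced-inversions-≤ b a []          _          = ≤-reflexive (lem q b P a Δ)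
    where
    lem : ∀ q b P a Δ → 2 * q * (b * 0 + 0) + P * (a * a) ≡ P * ((a + 0) * (a + 0)) + 2 * Δ * 0
    lem = solve-∀
  balanced-inversions-≤ b a (true  ∷ v) (_ , bal)  = subst (λ k → 2 * q * k + P * (a * a) ≤ P * ((a + falses v) * (a + falses v)) + 2 * Δ * falses v) (lem b (falses v) (inversions v)) (balanced-inversions-≤ (suc b) a v bal)
    where
    lem : ∀ b f i → (1 + b) * f + i ≡ b * f + (f + i)
    lem = solve-∀
  balanced-inversions-≤ b a (false ∷ v) (¬d , bal) = cert P (balanced-inversions-≤ b (suc a) v bal ⊞ scale 2 (not-many ¬d)) (lem q b (falses v) (inversions v) P a Δ)
    where
    lem : ∀ q b f i P a Δ → 2 * q * (b * (1 + f) + i) + P * (a * a) + (P * ((1 + a + f) * (1 + a + f)) + 2 * Δ * f + 2 * (P * a + Δ)) + P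
      ≡ P * ((a + (1 + f)) * (a + (1 + f))) + 2 * Δ * (1 + f) + (2 * q * (b * f + i) + P * ((1 + a) * (1 + a)) + 2 * (q * b))
    lem = solve-∀

  -- The same sum with p / q. The extra p for every two is the 1 in (a + 1)² - a² = 2 a + 1, which
  -- here works against the bound.
  balanced-inversions-≥ : ∀ b a v → Balanced b a v →
    p * ((a + falses v) * (a + falses v)) ≤ p * (a * a) + 2 * q * (b * falses v + inversions v) + (2 * Δ + p) * falses v
  balanced-inversions-≥ b a []          _          = ≤-reflexive (lem q b p a Δ)
    where
    lem : ∀ q b p a Δ → p * ((a + 0) * (a + 0)) ≡ p * (a * a) + 2 * q * (b * 0 + 0) + (2 * Δ + p) * 0
    lem = solve-∀
  balanced-inversions-≥ b a (true  ∷ v) (_ , bal)  = subst (λ k → p * ((a + falses v) * (a + falses v)) ≤ p * (a * a) + 2 * q * k + (2 * Δ + p) * falses v) (lem b (falses v) (inversions v)) (balanced-inversions-≥ (suc b) a v bal)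
    where
    lem : ∀ b f i → (1 + b) * f + i ≡ b * f + (f + i)
    lem = solve-∀
  balanced-inversions-≥ b a (false ∷ v) (¬d , bal) = cert 0 (balanced-inversions-≥ b (suc a) v bal ⊞ scale 2 (not-few ¬d)) (lem q b (falses v) (inversions v) p a Δ)
    where
    lem : ∀ q b f i p a Δ → p * ((a + (1 + f)) * (a + (1 + f))) + (p * ((1 + a) * (1 + a)) + 2 * q * (b * f + i) + (2 * Δ + p) * f + 2 * (q * b + Δ)) + 0
      ≡ p * (a * a) + 2 * q * (b * (1 + f) + i) + (2 * Δ + p) * (1 + f) + (p * ((1 + a + f) * (1 + a + f)) + 2 * (p * a))
    lem = solve-∀

-- inversions v ≈ p q h² / (2 Π²) with Π = p + 2 q, where h is the size of the balanced word v.
module _ (q p Δ : ℕ) (1≤q : 1 ≤ q) (v : List Bool) (bal : Balanced q p (2 + p) Δ 0 0 v) (Δ≤h : Δ ≤ size v) where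

  private
    P Π h k b i : ℕ
    P = 2 + p
    Π = p + 2 * q
    h = size v
    k = falses v
    b = trues v
    i = inversions v
    h≡ : h ≡ b + 2 * k
    h≡ = size≡ v
    end : ¬ Deviates q p P Δ b k
    end = subst₂′ (+-identityʳ b) (+-identityʳ k) (balanced-end q p P Δ 0 0 v bal)
      where
      subst₂′ : ∀ {x y x′ y′} → x ≡ x′ → y ≡ y′ → ¬ Deviates q p P Δ x y → ¬ Deviates q p P Δ x′ y′
      subst₂′ refl refl d = d
    k≤h : k ≤ h
    k≤h = ≤-trans (cert (b + k) (≤-refl {0}) (lem b k)) (≤-reflexive (sym h≡))
      where
      lem : ∀ b k → k + 0 + (b + k) ≡ b + 2 * k + 0
      lem = solve-∀

  word-inversions-≤ : 2 * q * (Π * Π) * i ≤ p * (q * q) * (h * h) + 6 * (Π * Π) * (h * h)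
  word-inversions-≤ =
    ≤-trans (cert 0 (scale (Π * Π) (balanced-inversions-≤ q p P Δ 0 0 v bal)) (lem₁ q Π i P k Δ))
    (≤-trans (scale P (A≤ ⊠ A≤) ⊞ scale (2 * Π) (Δ≤h ⊠ A≤))
    (≤-trans (≤-reflexive (lem₂ P Π q h)) (≤-trans (scale (h * h) coeff) (≤-reflexive (lem₃ p q Π h)))))
    where
    -- From p k ≤ q b + Δ and h = b + 2 k follows Π k ≤ q h + Δ: the twos number about q h / Π.
    A≤ : Π * k ≤ (q + 1) * h
    A≤ = ≤-trans (cert 0 (not-few q p P Δ end ⊞ scale q (≤-reflexive (sym h≡)) ⊞ Δ≤h) (lem p q k b Δ h)) ≤-refl
      where
      lem : ∀ p q k b Δ h → (p + 2 * q) * k + (q * b + Δ + q * h + h) + 0 ≡ (q + 1) * h + (p * k + q * (b + 2 * k) + Δ)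
      lem = solve-∀
    lem₁ : ∀ q Π i P k Δ → 2 * q * (Π * Π) * i + Π * Π * (P * ((0 + k) * (0 + k)) + 2 * Δ * k) + 0 ≡ P * (Π * k * (Π * k)) + 2 * Π * (Δ * (Π * k)) + Π * Π * (2 * q * (0 * k + i) + P * (0 * 0))
    lem₁ = solve-∀
    lem₂ : ∀ P Π q h → P * ((q + 1) * h * ((q + 1) * h)) + 2 * Π * (h * ((q + 1) * h)) ≡ h * h * (P * ((q + 1) * (q + 1)) + 2 * Π * (q + 1))
    lem₂ = solve-∀
    lem₃ : ∀ p q Π h → h * h * (p * (q * q) + 6 * (Π * Π)) ≡ p * (q * q) * (h * h) + 6 * (Π * Π) * (h * h)
    lem₃ = solve-∀
    coeff : P * ((q + 1) * (q + 1)) + 2 * Π * (q + 1) ≤ p * (q * q) + 6 * (Π * Π)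
    coeff = cert (6 * p * p + 17 * p * q + 8 * q * q) (scale (3 * p) 1≤q ⊞ scale (8 * q) 1≤q ⊞ scale 2 (1≤q ⊠ 1≤q)) (lem p q)
      where
      lem : ∀ p q → (2 + p) * ((q + 1) * (q + 1)) + 2 * (p + 2 * q) * (q + 1) + (3 * p * q + 8 * q * q + 2 * (q * q)) + (6 * p * p + 17 * p * q + 8 * q * q)
        ≡ p * (q * q) + 6 * ((p + 2 * q) * (p + 2 * q)) + (3 * p * 1 + 8 * q * 1 + 2 * (1 * 1))
      lem = solve-∀

  word-inversions-≥ : p ≤ h → p * (q * q) * (h * h) ≤ 2 * q * (Π * Π) * i + 18 * (Π * Π) * (h * h)
  word-inversions-≥ p≤h =
    ≤-trans (≤-reflexive (lem₀ p q h)) (≤-trans (scale p (qh≤ ⊠ qh≤))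
    (≤-trans (≤-reflexive (lem₁ p Π k h)) (≤-trans (scale (Π * Π) main ⊞ (scale (p * (4 * Π + 4)) (k≤h ⊠ k≤h) ⊞ scale (2 * p * (2 + Π)) (k≤h ⊠ ≤-refl {h}) ⊞ ≤-refl {p * (h * h)}))
    (≤-trans (≤-reflexive (lem₂ Π q i h p)) (+-monoʳ-≤ (2 * q * (Π * Π) * i) (≤-trans (scale (h * h) coeff) (≤-reflexive (lem₃ Π h))))))))
    where
    qh≤ : q * h ≤ (2 + Π) * k + h
    qh≤ = cert 0 (not-many q p P Δ end ⊞ scale q (≤-reflexive h≡) ⊞ Δ≤h) (lem p q k b Δ h)
      where
      lem : ∀ p q k b Δ h → q * h + ((2 + p) * k + Δ + q * (b + 2 * k) + h) + 0 ≡ (2 + (p + 2 * q)) * k + h + (q * b + q * h + Δ)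
      lem = solve-∀
    main : p * (k * k) ≤ 2 * q * i + 3 * (h * h)
    main = ≤-trans (cert 0 (balanced-inversions-≥ q p P Δ 0 0 v bal ⊞ (scale 2 Δ≤h ⊞ p≤h) ⊠ k≤h) (lem p k q i Δ h)) ≤-refl
      where
      lem : ∀ p k q i Δ h → p * (k * k) + (p * (0 * 0) + 2 * q * (0 * k + i) + (2 * Δ + p) * k + (2 * h + h) * h) + 0
        ≡ 2 * q * i + 3 * (h * h) + (p * ((0 + k) * (0 + k)) + (2 * Δ + p) * k)
      lem = solve-∀
    lem₀ : ∀ p q h → p * (q * q) * (h * h) ≡ p * (q * h * (q * h))
    lem₀ = solve-∀
    lem₁ : ∀ p Π k h → p * (((2 + Π) * k + h) * ((2 + Π) * k + h)) ≡ Π * Π * (p * (k * k)) + (p * (4 * Π + 4) * (k * k) + 2 * p * (2 + Π) * (k * h) + p * (h * h))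
    lem₁ = solve-∀
    lem₂ : ∀ Π q i h p → Π * Π * (2 * q * i + 3 * (h * h)) + (p * (4 * Π + 4) * (h * h) + 2 * p * (2 + Π) * (h * h) + p * (h * h))
      ≡ 2 * q * (Π * Π) * i + h * h * (3 * (Π * Π) + (p * (4 * Π + 4) + 2 * p * (2 + Π) + p))
    lem₂ = solve-∀
    lem₃ : ∀ Π h → h * h * (18 * (Π * Π)) ≡ 18 * (Π * Π) * (h * h)
    lem₃ = solve-∀
    1≤Π : 1 ≤ Π
    1≤Π = ≤-trans 1≤q (≤-trans (m≤m+n q (q + 0)) (m≤n+m (2 * q) p))
    coeff : 3 * (Π * Π) + (p * (4 * Π + 4) + 2 * p * (2 + Π) + p) ≤ 18 * (Π * Π)
    coeff = cert 0 (scale 1 (p≤Π ⊠ (scale 4 (≤-refl {Π}) ⊞ scale 4 1≤Π)) ⊞ (scale 2 p≤Π ⊠ (scale 2 1≤Π ⊞ ≤-refl {Π})) ⊞ (p≤Π ⊠ 1≤Π)) (lem p Π)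
      where
      p≤Π : p ≤ Π
      p≤Π = m≤m+n p _
      lem : ∀ p Π → 3 * (Π * Π) + (p * (4 * Π + 4) + 2 * p * (2 + Π) + p) + (1 * (Π * (4 * Π + 4 * Π)) + 2 * Π * (2 * Π + Π) + Π * Π) + 0 ≡ 18 * (Π * Π) + (1 * (p * (4 * Π + 4 * 1)) + 2 * p * (2 * 1 + Π) + p * 1)
      lem = solve-∀

positions : ℕ → List Bool → List ℕ
positions a []          = []
positions a (true  ∷ v) = positions (suc a) v
positions a (false ∷ v) = a ∷ positions (suc a) v

length-positions : ∀ a v → length (positions a v) ≡ falses v
length-positions a []          = refl
length-positions a (true  ∷ v) = length-positions (suc a) v
length-positions a (false ∷ v) = cong suc (length-positions (suc a) v)

-- The false with i falses before it sits at a + i plus the number of trues before it, and these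
-- numbers of trues add up to the inversions.
sum-positions : ∀ a v → 2 * sum (positions a v) + falses v ≡ 2 * inversions v + falses v * falses v + 2 * a * falses v
sum-positions a []          = sym (*-zeroʳ (2 * a))
sum-positions a (true  ∷ v) = trans (sum-positions (suc a) v) (lem (inversions v) (falses v) a)
  where
  lem : ∀ i f a → 2 * i + f * f + 2 * (1 + a) * f ≡ 2 * (f + i) + f * f + 2 * a * f
  lem = solve-∀
sum-positions a (false ∷ v) = trans (lem₁ a (sum (positions (suc a) v)) (falses v)) (trans (cong (λ k → 2 * a + 1 + k) (sum-positions (suc a) v)) (lem₂ (inversions v) (falses v) a))
  where
  lem₁ : ∀ a s f → 2 * (a + s) + (1 + f) ≡ 2 * a + 1 + (2 * s + f)
  lem₁ = solve-∀
  lem₂ : ∀ i f a → 2 * a + 1 + (2 * i + f * f + 2 * (1 + a) * f) ≡ 2 * i + (1 + f) * (1 + f) + 2 * a * (1 + f)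
  lem₂ = solve-∀

-- Sums over intervals of ℕ

bit : Bool → ℕ
bit true  = 1
bit false = 0

bit≤1 : ∀ b → bit b ≤ 1
bit≤1 true  = ≤-refl
bit≤1 false = z≤n

sumFrom : (ℕ → ℕ) → ℕ → ℕ → ℕ
sumFrom f a zero    = 0
sumFrom f a (suc n) = f a + sumFrom f (suc a) n

sumFrom-mono : ∀ {f g} a n → (∀ i → f i ≤ g i) → sumFrom f a n ≤ sumFrom g a n
sumFrom-mono a zero    h = z≤n
sumFrom-mono a (suc n) h = +-mono-≤ (h a) (sumFrom-mono (suc a) n h)

sumFrom-cong : ∀ {f g} a n → (∀ i → f i ≡ g i) → sumFrom f a n ≡ sumFrom g a n
sumFrom-cong a zero    h = refl
sumFrom-cong a (suc n) h = cong₂ _+_ (h a) (sumFrom-cong (suc a) n h)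

sumFrom-+ : ∀ f g a n → sumFrom (λ i → f i + g i) a n ≡ sumFrom f a n + sumFrom g a n
sumFrom-+ f g a zero    = refl
sumFrom-+ f g a (suc n) = trans (cong (f a + g a +_) (sumFrom-+ f g (suc a) n)) (lem (f a) (g a) _ _)
  where
  lem : ∀ x y u v → x + y + (u + v) ≡ x + u + (y + v)
  lem = solve-∀

sumFrom-*ˡ : ∀ c f a n → sumFrom (λ i → c * f i) a n ≡ c * sumFrom f a n
sumFrom-*ˡ c f a zero    = sym (*-zeroʳ c)
sumFrom-*ˡ c f a (suc n) = trans (cong (c * f a +_) (sumFrom-*ˡ c f (suc a) n)) (sym (*-distribˡ-+ c (f a) _))

sumFrom-shift : ∀ c f a n → sumFrom (λ i → f (c + i)) a n ≡ sumFrom f (c + a) n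
sumFrom-shift c f a zero    = refl
sumFrom-shift c f a (suc n) = cong (f (c + a) +_) (trans (sumFrom-shift c f (suc a) n) (cong (λ k → sumFrom f k n) (+-suc c a)))

sumFrom-split : ∀ f a m n → sumFrom f a (m + n) ≡ sumFrom f a m + sumFrom f (m + a) n
sumFrom-split f a zero    n = refl
sumFrom-split f a (suc m) n = trans (cong (f a +_) (trans (sumFrom-split f (suc a) m n) (cong (λ k → sumFrom f (suc a) m + sumFrom f k n) (+-suc m a)))) (sym (+-assoc (f a) _ _))

sumFrom-≤ : ∀ f c a n → (∀ i → f i ≤ c) → sumFrom f a n ≤ n * c
sumFrom-≤ f c a zero    h = z≤n
sumFrom-≤ f c a (suc n) h = +-mono-≤ (h a) (sumFrom-≤ f c (suc a) n h)

sumFrom-≤-local : ∀ f g a n → (∀ i → i ℕ.< a + n → f i ≤ g i) → sumFrom f a n ≤ sumFrom g a n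
sumFrom-≤-local f g a zero    h = z≤n
sumFrom-≤-local f g a (suc n) h = +-mono-≤ (h a (m<m+n a (s≤s z≤n))) (sumFrom-≤-local f g (suc a) n (λ i i< → h i (≤-trans i< (≤-reflexive (sym (+-suc a n))))))

sumFrom-swap : ∀ (F : ℕ → ℕ → ℕ) a m b n → sumFrom (λ i → sumFrom (F i) b n) a m ≡ sumFrom (λ j → sumFrom (λ i → F i j) a m) b n
sumFrom-swap F a zero    b n = sym (zeros b n)
  where
  zeros : ∀ b n → sumFrom (λ _ → 0) b n ≡ 0
  zeros b zero    = refl
  zeros b (suc n) = zeros (suc b) n
sumFrom-swap F a (suc m) b n = trans (cong (sumFrom (F a) b n +_) (sumFrom-swap F (suc a) m b n)) (sym (sumFrom-+ (F a) _ b n))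

sumFrom-within : ∀ f a n B → a + n ≤ B → sumFrom f a n ≤ sumFrom f 0 B
sumFrom-within f a n B h = ≤-trans (m≤n+m _ (sumFrom f 0 a)) (≤-trans (≤-reflexive (cong (λ k → sumFrom f 0 a + sumFrom f k n) (sym (+-identityʳ a))))
  (≤-trans (≤-reflexive (sym (sumFrom-split f 0 a n))) (≤-trans (m≤m+n _ (sumFrom f (a + n + 0) (B ∸ (a + n)))) (≤-reflexive (trans (sym (sumFrom-split f 0 (a + n) (B ∸ (a + n)))) (cong (sumFrom f 0) (m+[n∸m]≡n h)))))))

-- The translated interval sticks out of the original one by at most c positions.
sumFrom-translate : ∀ (Z : ℕ → Bool) c a n → sumFrom (λ i → bit (Z (c + i))) a n ≤ sumFrom (bit ∘ Z) a n + c
sumFrom-translate Z c a n = ≤-trans (≤-reflexive (sumFrom-shift c (bit ∘ Z) a n))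
  (≤-trans (m≤n+m _ (sumFrom (bit ∘ Z) a c)) (≤-trans (≤-reflexive (trans (sym (sumFrom-split (bit ∘ Z) a c n)) (trans (cong (sumFrom (bit ∘ Z) a) (+-comm c n)) (sumFrom-split (bit ∘ Z) a n c))))
  (+-monoʳ-≤ _ (≤-trans (sumFrom-≤ (bit ∘ Z) 1 (n + a) c (bit≤1 ∘ Z)) (≤-reflexive (*-identityʳ c))))))

-- The online compression of a semigroup beyond its first dense window

emit : Bool → Bool → List Bool → List Bool
emit true  b v = b ∷ v
emit false b v = v

length-emit : ∀ c b v → length (emit c b v) ≡ bit c + length v
length-emit true  b v = refl
length-emit false b v = refl

emit-++ : ∀ c b v w → emit c b (v ++ w) ≡ emit c b v ++ w
emit-++ true  b v w = refl
emit-++ false b v w = refl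

-- A greedy online compression of the part of S beyond its first dense window lo + D, D ⊆ [0, L).
-- The state Y is the set of positions already known to lie in S, as sums of an element of
-- lo + D and an earlier element.  A position p is heavy when lo + p + D contains at least K
-- positions outside Y; a heavy element of S adds this translate to Y, so there are few of them.
-- Positions that are neither in Y nor heavy are free.
module Scan (K lo L : ℕ) (D : ℕ → Bool) (1≤lo : 1 ≤ lo) where

  cover : (ℕ → Bool) → ℕ → ℕ
  cover Y p = sumFrom (λ j → bit (D j ∧ Y (lo + p + j))) 0 L

  fresh : (ℕ → Bool) → ℕ → ℕ
  fresh Y p = sumFrom (λ j → bit (D j ∧ not (Y (lo + p + j)))) 0 L

  card : ℕ
  card = sumFrom (bit ∘ D) 0 L

  heavy : (ℕ → Bool) → ℕ → Bool
  heavy Y p = K ≤ᵇ fresh Y p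

  extend : ℕ → (ℕ → Bool) → ℕ → Bool
  extend p Y r = Y r ∨ ((lo + p ≤ᵇ r) ∧ D (r ∸ (lo + p)))

  -- A heavy element extends Y even if it was itself forced: `covered` counts the translates of
  -- forced positions too and relies on this.
  next : (ℕ → Bool) → ℕ → Bool → ℕ → Bool
  next Y p b = if b ∧ heavy Y p then extend p Y else Y

  heavyBits freeBits : ℕ → (ℕ → Bool) → List Bool → List Bool
  heavyBits p Y []      = []
  heavyBits p Y (b ∷ v) = emit (not (Y p) ∧ heavy Y p) b (heavyBits (suc p) (next Y p b) v)
  freeBits p Y []       = []
  freeBits p Y (b ∷ v)  = emit (not (Y p) ∧ not (heavy Y p)) b (freeBits (suc p) (next Y p b) v)

  forced : ℕ → (ℕ → Bool) → List Bool → ℕ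
  forced p Y []      = 0
  forced p Y (b ∷ v) = bit (Y p) + forced (suc p) (next Y p b) v

  final : ℕ → (ℕ → Bool) → List Bool → ℕ → Bool
  final p Y []      = Y
  final p Y (b ∷ v) = final (suc p) (next Y p b) v

  Valid : ℕ → (ℕ → Bool) → List Bool → Set
  Valid p Y []      = ⊤
  Valid p Y (b ∷ v) = (Y p ≡ true → b ≡ true) × Valid (suc p) (next Y p b) v

  -- Which stream the bit at p goes to, if any, depends only on Y and hence on earlier bits, so a
  -- decoder can replay the scan and draw each bit from the right stream.
  scan-injective : ∀ p Y v w → length v ≡ length w → Valid p Y v → Valid p Y w →
    heavyBits p Y v ≡ heavyBits p Y w → freeBits p Y v ≡ freeBits p Y w → v ≡ w
  scan-injective p Y []      []       _   _         _         _  _  = refl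
  scan-injective p Y (b ∷ v) (b′ ∷ w) len (ok , vv) (ok′ , vw) hb fb with separate (Y p) (heavy Y p) ok ok′ hb fb
    where
    separate : ∀ y h {b b′ xs xs′ zs zs′} → (y ≡ true → b ≡ true) → (y ≡ true → b′ ≡ true) →
      emit (not y ∧ h) b xs ≡ emit (not y ∧ h) b′ xs′ → emit (not y ∧ not h) b zs ≡ emit (not y ∧ not h) b′ zs′ → b ≡ b′ × xs ≡ xs′ × zs ≡ zs′
    separate true  h     t t′ p q = trans (t refl) (sym (t′ refl)) , p , q
    separate false true  t t′ p q = ∷-injectiveˡ p , ∷-injectiveʳ p , q
    separate false false t t′ p q = ∷-injectiveˡ q , p , ∷-injectiveʳ q
  ... | refl , hb′ , fb′ = cong (b ∷_) (scan-injective (suc p) (next Y p b) v w (cong pred len) vv vw hb′ fb′)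

  scan-length : ∀ p Y v → length (heavyBits p Y v) + length (freeBits p Y v) + forced p Y v ≡ length v
  scan-length p Y []      = refl
  scan-length p Y (b ∷ v) = trans (cong₂ (λ x y → x + y + (bit (Y p) + forced (suc p) (next Y p b) v)) (length-emit (not (Y p) ∧ heavy Y p) b _) (length-emit (not (Y p) ∧ not (heavy Y p)) b _))
    (trans (lem (bit (not (Y p) ∧ heavy Y p)) (bit (not (Y p) ∧ not (heavy Y p))) (bit (Y p)) _ _ _) (cong₂ _+_ (one (Y p) (heavy Y p)) (scan-length (suc p) (next Y p b) v)))
    where
    lem : ∀ x y z u v w → x + u + (y + v) + (z + w) ≡ x + y + z + (u + v + w)
    lem = solve-∀
    one : ∀ y h → bit (not y ∧ h) + bit (not y ∧ not h) + bit y ≡ 1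
    one true  h     = refl
    one false true  = refl
    one false false = refl

  scan-falses : ∀ p Y v → Valid p Y v → falses v ≡ falses (heavyBits p Y v) + falses (freeBits p Y v)
  scan-falses p Y []      _         = refl
  scan-falses p Y (b ∷ v) (ok , vv) = step (Y p) (heavy Y p) b ok (scan-falses (suc p) (next Y p b) v vv)
    where
    step : ∀ y h b {v xs zs} → (y ≡ true → b ≡ true) → falses v ≡ falses xs + falses zs →
      falses (b ∷ v) ≡ falses (emit (not y ∧ h) b xs) + falses (emit (not y ∧ not h) b zs)
    step true  h     false ok e with ok refl
    ... | ()
    step true  h     true  ok e = e
    step false true  true  ok e = e
    step false true  false ok e = cong suc e
    step false false true  ok e = e
    step false false false {xs = xs} ok e = trans (cong suc e) (sym (+-suc (falses xs) _))

  scan-++ : ∀ p Y v w → heavyBits p Y (v ++ w) ≡ heavyBits p Y v ++ heavyBits (length v + p) (final p Y v) w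
    × freeBits p Y (v ++ w) ≡ freeBits p Y v ++ freeBits (length v + p) (final p Y v) w
  scan-++ p Y []      w = refl , refl
  scan-++ p Y (b ∷ v) w with scan-++ (suc p) (next Y p b) v w
  ... | hb , fb rewrite +-suc (length v) p =
    trans (cong (emit (not (Y p) ∧ heavy Y p) b) hb) (emit-++ (not (Y p) ∧ heavy Y p) b _ _) ,
    trans (cong (emit (not (Y p) ∧ not (heavy Y p)) b) fb) (emit-++ (not (Y p) ∧ not (heavy Y p)) b _ _)

  extend-before : ∀ p Y r → r ℕ.< lo + p → extend p Y r ≡ Y r
  extend-before p Y r r< with lo + p ≤ᵇ r in eq
  ... | false = ∨-identityʳ (Y r)
  ... | true  = ⊥-elim (<⇒≱ r< (≤ᵇ⇒≤ (lo + p) r (subst T (sym eq) tt)))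

  next-before : ∀ Y p b r → r ℕ.< lo + p → next Y p b r ≡ Y r
  next-before Y p b r r< with b ∧ heavy Y p
  ... | true  = extend-before p Y r r<
  ... | false = refl

  next-mono : ∀ Y p b r → Y r ≡ true → next Y p b r ≡ true
  next-mono Y p b r e with b ∧ heavy Y p
  ... | true  = cong (_∨ ((lo + p ≤ᵇ r) ∧ D (r ∸ (lo + p)))) e
  ... | false = e

  final-before : ∀ p Y v r → r ℕ.< lo + p → final p Y v r ≡ Y r
  final-before p Y []      r r< = refl
  final-before p Y (b ∷ v) r r< = trans (final-before (suc p) (next Y p b) v r (≤-trans r< (+-monoʳ-≤ lo (n≤1+n p)))) (next-before Y p b r r<)

  final-mono : ∀ p Y v r → Y r ≡ true → final p Y v r ≡ true
  final-mono p Y []      r e = e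
  final-mono p Y (b ∷ v) r e = final-mono (suc p) (next Y p b) v r (next-mono Y p b r e)

  -- An element p changes Y only from lo + p > p on, so the verdict on a scanned position is already
  -- that of the final Y.
  forced-count : ∀ p Y v → forced p Y v ≡ sumFrom (bit ∘ final p Y v) p (length v)
  forced-count p Y []      = refl
  forced-count p Y (b ∷ v) = cong₂ _+_ (cong bit (sym (final-before p Y (b ∷ v) p (m<n+m p 1≤lo)))) (forced-count (suc p) (next Y p b) v)

  -- Elements at p or later add only sums from lo + p on, so Y stays empty below lo + p and the
  -- first lo scanned positions are never forced.
  unforced : ∀ c p Y v → (∀ r → r ℕ.< c → Y r ≡ false) → p + length v ≤ c → c ≤ lo + p → forced p Y v ≡ 0
  unforced c p Y []      none _  _  = refl
  unforced c p Y (b ∷ v) none le c≤ = cong₂ _+_ (cong bit (none p (≤-trans (s≤s (m≤m+n p (length v))) le′)))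
      (unforced c (suc p) (next Y p b) v (λ r r< → trans (next-before Y p b r (≤-trans r< c≤)) (none r r<)) le′ (≤-trans c≤ (+-monoʳ-≤ lo (n≤1+n p))))
    where
    le′ : suc p + length v ≤ c
    le′ = ≤-trans (≤-reflexive (sym (+-suc p (length v)))) le

  cover-mono : ∀ {Y Z} p → (∀ r → Y r ≡ true → Z r ≡ true) → cover Y p ≤ cover Z p
  cover-mono {Y} {Z} p h = sumFrom-mono 0 L (λ j → step (D j) (Y (lo + p + j)) (Z (lo + p + j)) (h (lo + p + j)))
    where
    step : ∀ d y z → (y ≡ true → z ≡ true) → bit (d ∧ y) ≤ bit (d ∧ z)
    step false y     z h = z≤n
    step true  false z h = z≤n
    step true  true  z h = ≤-reflexive (cong bit (sym (h refl)))

  cover+fresh : ∀ Y p → cover Y p + fresh Y p ≡ card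
  cover+fresh Y p = trans (sym (sumFrom-+ _ _ 0 L)) (sumFrom-cong 0 L (λ j → step (D j) (Y (lo + p + j))))
    where
    step : ∀ d y → bit (d ∧ y) + bit (d ∧ not y) ≡ bit d
    step false y     = refl
    step true  true  = refl
    step true  false = refl

  extend-translate : ∀ p Y j → extend p Y (lo + p + j) ≡ Y (lo + p + j) ∨ D j
  extend-translate p Y j = cong₂ (λ x y → Y (lo + p + j) ∨ (x ∧ D y)) (≤⇒≤ᵇ≡true (m≤m+n (lo + p) j)) (m+n∸m≡n (lo + p) j)
    where
    ≤⇒≤ᵇ≡true : ∀ {m n} → m ≤ n → (m ≤ᵇ n) ≡ true
    ≤⇒≤ᵇ≡true {m} {n} h with m ≤ᵇ n | ≤⇒≤ᵇ h
    ... | true | _ = refl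

  cover-extend : ∀ p Y → cover (extend p Y) p ≡ card
  cover-extend p Y = sumFrom-cong 0 L (λ j → trans (cong (λ z → bit (D j ∧ z)) (extend-translate p Y j)) (step (D j) (Y (lo + p + j))))
    where
    step : ∀ d y → bit (d ∧ (y ∨ d)) ≡ bit d
    step false y     = refl
    step true  true  = refl
    step true  false = refl

  size-extend : ∀ p Y B → lo + p + L ≤ B → sumFrom (bit ∘ Y) 0 B + fresh Y p ≤ sumFrom (bit ∘ extend p Y) 0 B
  size-extend p Y B h = ≤-trans (+-monoʳ-≤ _ new≤) (≤-reflexive (trans (sym (sumFrom-+ _ _ 0 B)) (sumFrom-cong 0 B (λ r → split (Y r) (extend p Y r) (λ e → cong (_∨ ((lo + p ≤ᵇ r) ∧ D (r ∸ (lo + p)))) e)))))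
    where
    split : ∀ y z → (y ≡ true → z ≡ true) → bit y + bit (z ∧ not y) ≡ bit z
    split true  true  h = refl
    split true  false h with h refl
    ... | ()
    split false true  h = refl
    split false false h = refl
    step : ∀ d y z → z ≡ y ∨ d → bit (d ∧ not y) ≡ bit (z ∧ not y)
    step true  true  _ refl = refl
    step true  false _ refl = refl
    step false true  _ refl = refl
    step false false _ refl = refl
    new≤ : fresh Y p ≤ sumFrom (λ r → bit (extend p Y r ∧ not (Y r))) 0 B
    new≤ = ≤-trans (≤-reflexive (trans (sumFrom-cong 0 L (λ j → step (D j) (Y (lo + p + j)) _ (extend-translate p Y j)))
      (trans (sumFrom-shift (lo + p) (λ r → bit (extend p Y r ∧ not (Y r))) 0 L) (cong (λ k → sumFrom (λ r → bit (extend p Y r ∧ not (Y r))) k L) (+-identityʳ (lo + p))))))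
      (sumFrom-within _ (lo + p) L B h)

  ≤ᵇ-true : ∀ Y p → heavy Y p ≡ true → K ≤ fresh Y p
  ≤ᵇ-true Y p e = ≤ᵇ⇒≤ K (fresh Y p) (subst T (sym e) tt)

  ≤ᵇ-false : ∀ Y p → heavy Y p ≡ false → fresh Y p ≤ K
  ≤ᵇ-false Y p e = <⇒≤ (≰⇒> (λ h → subst T e (≤⇒≤ᵇ h)))

  -- Y inside [0, B) serves as a potential: it gains at least K at every heavy element, and all
  -- translates end below B.
  heavy-trues : ∀ p Y v B → lo + p + length v + L ≤ B →
    trues (heavyBits p Y v) * K + sumFrom (bit ∘ Y) 0 B ≤ sumFrom (bit ∘ final p Y v) 0 B
  heavy-trues p Y []      B h = ≤-refl
  heavy-trues p Y (b ∷ v) B h = ≤-trans (step b (heavy Y p) refl) (heavy-trues (suc p) (next Y p b) v B (≤-trans (≤-reflexive (lem lo p (length v) L)) h))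
    where
    lem : ∀ a p n L → a + (1 + p) + n + L ≡ a + p + (1 + n) + L
    lem = solve-∀
    rest : List Bool
    rest = heavyBits (suc p) (next Y p b) v
    room : lo + p + L ≤ B
    room = ≤-trans (+-monoˡ-≤ L (m≤m+n (lo + p) _)) h
    extended : heavy Y p ≡ true → K + sumFrom (bit ∘ Y) 0 B ≤ sumFrom (bit ∘ extend p Y) 0 B
    extended e = ≤-trans (+-monoˡ-≤ _ (≤ᵇ-true Y p e)) (≤-trans (≤-reflexive (+-comm (fresh Y p) _)) (size-extend p Y B room))
    emitted : ∀ c b v → trues (emit c b v) ≤ bit b + trues v
    emitted true  true  v = ≤-refl
    emitted true  false v = ≤-refl
    emitted false b     v = m≤n+m _ (bit b)
    step : ∀ b′ h → h ≡ heavy Y p → trues (emit (not (Y p) ∧ h) b′ rest) * K + sumFrom (bit ∘ Y) 0 B ≤ trues rest * K + sumFrom (bit ∘ (if b′ ∧ h then extend p Y else Y)) 0 B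
    step true  true  e = ≤-trans (+-monoˡ-≤ _ (*-monoˡ-≤ K (emitted (not (Y p) ∧ true) true rest))) (≤-trans (≤-reflexive (lem′ K (trues rest) _)) (+-monoʳ-≤ _ (extended (sym e))))
      where
      lem′ : ∀ K t s → (1 + t) * K + s ≡ t * K + (K + s)
      lem′ = solve-∀
    step false true  e = +-monoˡ-≤ _ (*-monoˡ-≤ K (emitted (not (Y p) ∧ true) false rest))
    step true  false e = +-monoˡ-≤ _ (*-monoˡ-≤ K (≤-reflexive (cong (λ c → trues (emit c true rest)) (∧-zeroʳ (not (Y p))))))
    step false false e = +-monoˡ-≤ _ (*-monoˡ-≤ K (emitted (not (Y p) ∧ false) false rest))

  -- Lower count of the pairs (r, j) with j in D and lo + r + j in the final Y. A light r misses at
  -- most K of its translates; a forced heavy r lies in S and has put all of them into Y.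
  covered : ∀ p Y v → Valid p Y v →
    (length (freeBits p Y v) + forced p Y v) * card ≤ sumFrom (cover (final p Y v)) p (length v) + (length (freeBits p Y v) + forced p Y v) * K
  covered p Y []      _         = z≤n
  covered p Y (b ∷ v) (ok , vv) = ≤-trans (≤-reflexive (trans (cong (λ k → (k + (bit (Y p) + F)) * card) (length-emit light b _)) (lem₁ (bit light) (bit (Y p)) N F card)))
      (≤-trans (+-mono-≤ (step (Y p) (heavy Y p) b refl refl ok) (covered (suc p) (next Y p b) v vv))
      (≤-reflexive (trans (lem₂ (cover Z p) (bit light) (bit (Y p)) K (sumFrom (cover Z) (suc p) (length v)) N F) (cong (λ k → cover Z p + sumFrom (cover Z) (suc p) (length v) + (k + (bit (Y p) + F)) * K) (sym (length-emit light b _))))))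
    where
    light : Bool
    light = not (Y p) ∧ not (heavy Y p)
    N F : ℕ
    N = length (freeBits (suc p) (next Y p b) v)
    F = forced (suc p) (next Y p b) v
    Z : ℕ → Bool
    Z = final (suc p) (next Y p b) v
    lem₁ : ∀ l y n f c → (l + n + (y + f)) * c ≡ (l + y) * c + (n + f) * c
    lem₁ = solve-∀
    lem₂ : ∀ c l y K s n f → c + (l + y) * K + (s + (n + f) * K) ≡ c + s + (l + n + (y + f)) * K
    lem₂ = solve-∀
    by-light : heavy Y p ≡ false → 1 * card ≤ cover Z p + 1 * K
    by-light e = ≤-trans (≤-reflexive (trans (+-identityʳ card) (sym (cover+fresh Y p)))) (+-mono-≤ (cover-mono p (λ r → final-mono p Y (b ∷ v) r)) (≤-trans (≤ᵇ-false Y p e) (≤-reflexive (sym (+-identityʳ K)))))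
    by-heavy : heavy Y p ≡ true → b ≡ true → 1 * card ≤ cover Z p + 1 * K
    by-heavy e refl = ≤-trans (≤-reflexive (trans (+-identityʳ card) (sym (cover-extend p Y)))) (≤-trans (cover-mono p (λ r h → final-mono (suc p) (next Y p true) v r (trans (cong (λ h → (if h then extend p Y else Y) r) e) h))) (m≤m+n _ _))
    step : ∀ y h b′ → y ≡ Y p → h ≡ heavy Y p → (y ≡ true → b ≡ true) → (bit (not y ∧ not h) + bit y) * card ≤ cover Z p + (bit (not y ∧ not h) + bit y) * K
    step true  true  _ ey eh ok = by-heavy (sym eh) (ok refl)
    step true  false _ ey eh ok = by-light (sym eh)
    step false true  _ ey eh ok = z≤n
    step false false _ ey eh ok = by-light (sym eh)

  -- Upper count of the same pairs: for fixed j in D the admissible r form a translate of Z by lo +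
  -- j, and j < L.
  cover-total : ∀ (Z : ℕ → Bool) p n → sumFrom (cover Z) p n ≤ card * (sumFrom (bit ∘ Z) p n + (lo + L))
  cover-total Z p n = ≤-trans (≤-reflexive (sumFrom-swap (λ i j → bit (D j ∧ Z (lo + i + j))) p n 0 L))
      (≤-trans (sumFrom-≤-local _ (λ j → (sumFrom (bit ∘ Z) p n + (lo + L)) * bit (D j)) 0 L step)
      (≤-reflexive (trans (sumFrom-*ˡ (sumFrom (bit ∘ Z) p n + (lo + L)) (bit ∘ D) 0 L) (*-comm (sumFrom (bit ∘ Z) p n + (lo + L)) card))))
    where
    step : ∀ j → j ℕ.< L → sumFrom (λ i → bit (D j ∧ Z (lo + i + j))) p n ≤ (sumFrom (bit ∘ Z) p n + (lo + L)) * bit (D j)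
    step j j< with D j
    ... | false = ≤-trans (sumFrom-≤ _ 0 p n (λ _ → z≤n)) (≤-trans (≤-reflexive (*-zeroʳ n)) z≤n)
    ... | true  = ≤-trans (≤-reflexive (sumFrom-cong p n (λ i → cong (bit ∘ Z) (lem lo i j)))) (≤-trans (sumFrom-translate Z (lo + j) p n)
        (≤-trans (+-monoʳ-≤ (sumFrom (bit ∘ Z) p n) (+-monoʳ-≤ lo (<⇒≤ j<))) (≤-reflexive (sym (*-identityʳ _)))))
      where
      lem : ∀ a i j → a + i + j ≡ a + j + i
      lem = solve-∀

  -- When the two counts are combined, the forced positions cancel, which leaves at most about lo +
  -- L free ones once K is small against `card`.
  free-bound : ∀ p Y v → Valid p Y v →
    (length (freeBits p Y v) + forced p Y v) * card ≤ card * (forced p Y v + (lo + L)) + (length (freeBits p Y v) + forced p Y v) * K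
  free-bound p Y v ok = ≤-trans (covered p Y v ok) (+-monoˡ-≤ _ (≤-trans (cover-total (final p Y v) p (length v)) (≤-reflexive (cong (λ k → card * (k + (lo + L))) (sym (forced-count p Y v))))))

  falses-free : ∀ p Y v → falses (freeBits p Y v) ≤ falses v
  falses-free p Y []      = z≤n
  falses-free p Y (b ∷ v) = step (not (Y p) ∧ not (heavy Y p)) b (falses-free (suc p) (next Y p b) v)
    where
    step : ∀ c b {v w} → falses v ≤ falses w → falses (emit c b v) ≤ falses (b ∷ w)
    step true  true  h = h
    step true  false h = s≤s h
    step false true  h = h
    step false false h = m≤n⇒m≤1+n h

  inversions-free : ∀ p Y v → inversions (freeBits p Y v) ≤ inversions v
  inversions-free p Y []      = z≤n
  inversions-free p Y (b ∷ v) = step (not (Y p) ∧ not (heavy Y p)) b (falses-free (suc p) (next Y p b) v) (inversions-free (suc p) (next Y p b) v)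
    where
    step : ∀ c b {v w} → falses v ≤ falses w → inversions v ≤ inversions w → inversions (emit c b v) ≤ inversions (b ∷ w)
    step true  true  h i = +-mono-≤ h i
    step true  false h i = i
    step false true  {w = w} h i = ≤-trans i (m≤n+m _ (falses w))
    step false false h i = i

  -- With nothing forced, v is a shuffle of the two streams, and deleting a heavy bit destroys at
  -- most `length v` inversions.
  inversions-unforced : ∀ p Y v → Valid p Y v → forced p Y v ≡ 0 →
    inversions v ≤ inversions (freeBits p Y v) + length (heavyBits p Y v) * length v
  inversions-unforced p Y []      _         _ = z≤n
  inversions-unforced p Y (b ∷ v) (ok , vv) e = step (Y p) (heavy Y p) b (m+n≡0⇒m≡0 _ e) (scan-falses (suc p) (next Y p b) v vv)
      (inversions-unforced (suc p) (next Y p b) v vv (m+n≡0⇒n≡0 (bit (Y p)) e))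
    where
    falses≤length : ∀ w → falses w ≤ length w
    falses≤length w = ≤-trans (m≤n+m _ (trues w)) (≤-reflexive (trues+falses w))
    step : ∀ y h b {v hs fs} → bit y ≡ 0 → falses v ≡ falses hs + falses fs → inversions v ≤ inversions fs + length hs * length v →
      inversions (b ∷ v) ≤ inversions (emit (not y ∧ not h) b fs) + length (emit (not y ∧ h) b hs) * length (b ∷ v)
    step true  h     b     () fe ih
    step false true  true  {v} {hs} {fs} e fe ih = cert (1 + length hs) (falses≤length v ⊞ ih) (lem (falses v) (inversions v) (length v) (inversions fs) (length hs))
      where
      lem : ∀ f i l j h → f + i + (l + (j + h * l)) + (1 + h) ≡ j + (1 + h) * (1 + l) + (f + i)
      lem = solve-∀
    step false true  false {v} {hs} {fs} e fe ih = cert (1 + length hs + length v) ih (lem (inversions v) (length v) (inversions fs) (length hs))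
      where
      lem : ∀ i l j h → i + (j + h * l) + (1 + h + l) ≡ j + (1 + h) * (1 + l) + i
      lem = solve-∀
    step false false true  {v} {hs} {fs} e fe ih = cert 0 (≤-reflexive fe ⊞ falses≤length hs ⊞ ih) (lem (falses v) (inversions v) (length v) (inversions fs) (length hs) (falses hs) (falses fs))
      where
      lem : ∀ f i l j h a b → f + i + (a + b + h + (j + h * l)) + 0 ≡ b + j + h * (1 + l) + (f + a + i)
      lem = solve-∀
    step false false false {v} {hs} {fs} e fe ih = cert (length hs) ih (lem (inversions v) (length v) (inversions fs) (length hs))
      where
      lem : ∀ i l j h → i + (j + h * l) + h ≡ j + h * (1 + l) + i
      lem = solve-∀

  extend-sound : ∀ {χ : ℕ → Bool} p Y → (∀ r → Y r ≡ true → χ r ≡ true) → (∀ j → D j ≡ true → χ (lo + p + j) ≡ true) → ∀ r → extend p Y r ≡ true → χ r ≡ true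
  extend-sound {χ} p Y Y⊆ D⊆ r e with Y r in eY | lo + p ≤ᵇ r in el
  ... | true  | _    = Y⊆ r eY
  ... | false | true = subst (λ k → χ k ≡ true) (m+[n∸m]≡n (≤ᵇ⇒≤ (lo + p) r (subst T (sym el) tt))) (D⊆ (r ∸ (lo + p)) e)

-- Gap sets as bit lists

indicator : List ℕ → ℕ → Bool
indicator H p = not ⌊ p ∈? H ⌋

indicator-∉ : ∀ {H p} → p ∉ H → indicator H p ≡ true
indicator-∉ {H} {p} p∉ with p ∈? H
... | yes p∈ = ⊥-elim (p∉ p∈)
... | no  _  = refl

indicator-∈ : ∀ {H p} → p ∈ H → indicator H p ≡ false
indicator-∈ {H} {p} p∈ with p ∈? H
... | yes _  = refl
... | no  p∉ = ⊥-elim (p∉ p∈)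

indicator-true : ∀ H p → indicator H p ≡ true → p ∉ H
indicator-true H p e p∈ with trans (sym e) (indicator-∈ {H} p∈)
... | ()

indicator-false : ∀ H p → indicator H p ≡ false → p ∈ H
indicator-false H p e with p ∈? H
... | yes p∈ = p∈

indicator-ext : ∀ H H′ p → (p ∈ H → p ∈ H′) → (p ∈ H′ → p ∈ H) → indicator H p ≡ indicator H′ p
indicator-ext H H′ p f f′ with p ∈? H | p ∈? H′
... | yes _  | yes _   = refl
... | no  _  | no  _   = refl
... | yes p∈ | no  p∉  = ⊥-elim (p∉ (f p∈))
... | no  p∉ | yes p∈′ = ⊥-elim (p∉ (f′ p∈′))

bits : (ℕ → Bool) → ℕ → ℕ → List Bool
bits χ a zero    = []
bits χ a (suc n) = χ a ∷ bits χ (suc a) n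

length-bits : ∀ χ a n → length (bits χ a n) ≡ n
length-bits χ a zero    = refl
length-bits χ a (suc n) = cong suc (length-bits χ (suc a) n)

bits-++ : ∀ χ a m n → bits χ a (m + n) ≡ bits χ a m ++ bits χ (m + a) n
bits-++ χ a zero    n = refl
bits-++ χ a (suc m) n = cong (χ a ∷_) (trans (bits-++ χ (suc a) m n) (cong (λ k → bits χ (suc a) m ++ bits χ k n) (+-suc m a)))

bits-cong : ∀ {χ χ′} a n → (∀ i → a ≤ i → χ i ≡ χ′ i) → bits χ a n ≡ bits χ′ a n
bits-cong a zero    h = refl
bits-cong a (suc n) h = cong₂ _∷_ (h a ≤-refl) (bits-cong (suc a) n (λ i a< → h i (<⇒≤ a<)))

falses-bits : ∀ χ a n → falses (bits χ a n) ≡ sumFrom (bit ∘ not ∘ χ) a n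
falses-bits χ a zero    = refl
falses-bits χ a (suc n) with χ a
... | true  = falses-bits χ (suc a) n
... | false = cong suc (falses-bits χ (suc a) n)

positions-≥ : ∀ a v → All (a ≤_) (positions a v)
positions-≥ a []          = []
positions-≥ a (true  ∷ v) = All.map <⇒≤ (positions-≥ (suc a) v)
positions-≥ a (false ∷ v) = ≤-refl ∷ All.map <⇒≤ (positions-≥ (suc a) v)

positions-sorted : ∀ a v → AllPairs ℕ._<_ (positions a v)
positions-sorted a []          = []
positions-sorted a (true  ∷ v) = positions-sorted (suc a) v
positions-sorted a (false ∷ v) = positions-≥ (suc a) v ∷ positions-sorted (suc a) v

positions-unique : ∀ a v → Unique (positions a v)
positions-unique a v = AllPairs.map <⇒≢ (positions-sorted a v)

∈-positions-bits : ∀ χ a n {y} → y ∈ positions a (bits χ a n) → χ y ≡ false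
∈-positions-bits χ a (suc n) y∈ with χ a in e
∈-positions-bits χ a (suc n) y∈          | true  = ∈-positions-bits χ (suc a) n y∈
∈-positions-bits χ a (suc n) (here refl) | false = e
∈-positions-bits χ a (suc n) (there y∈)  | false = ∈-positions-bits χ (suc a) n y∈

positions-indicator : ∀ n a H → Linked ℕ._<_ H → All (a ≤_) H → All (ℕ._< a + n) H → positions a (bits (indicator H) a n) ≡ H
positions-indicator zero    a []      _  _         _         = refl
positions-indicator zero    a (x ∷ H) _  (a≤ ∷ _) (x< ∷ _) = ⊥-elim (<⇒≱ x< (≤-trans (≤-reflexive (+-identityʳ a)) a≤))
positions-indicator (suc n) a []      _  _         _         = positions-indicator n (suc a) [] [] [] []
positions-indicator (suc n) a (x ∷ H) sorted (a≤ ∷ a≤H) (x< ∷ <H) with Linked⇒AllPairs <-trans sorted | m≤n⇒m<n∨m≡n a≤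
... | x<H ∷ pairs | inj₂ refl = trans (cong (λ b → positions a (b ∷ bits (indicator (a ∷ H)) (suc a) n)) (indicator-∈ {a ∷ H} (here refl)))
      (cong (a ∷_) (trans (cong (positions (suc a)) (bits-cong (suc a) n same))
        (positions-indicator n (suc a) H (AllPairs⇒Linked pairs) x<H (All.map (λ h → ≤-trans h (≤-reflexive (+-suc a n))) <H))))
  where
  same : ∀ i → suc a ≤ i → indicator (a ∷ H) i ≡ indicator H i
  same i a<i = indicator-ext (a ∷ H) H i (λ { (here refl) → ⊥-elim (<-irrefl refl a<i) ; (there i∈) → i∈ }) there
... | x<H ∷ pairs | inj₁ a<x = trans (cong (λ b → positions a (b ∷ bits (indicator (x ∷ H)) (suc a) n)) (indicator-∉ {x ∷ H} a∉))
      (positions-indicator n (suc a) (x ∷ H) sorted (a<x ∷ All.map (<-trans a<x) x<H) (All.map (λ h → ≤-trans h (≤-reflexive (+-suc a n))) (x< ∷ <H)))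
  where
  a∉ : a ∉ x ∷ H
  a∉ (here refl) = <-irrefl refl a<x
  a∉ (there a∈)  = <-irrefl refl (<-trans a<x (All.lookup x<H a∈))

sumFrom-reverse : ∀ f x → sumFrom (λ i → f (x ∸ i)) 0 (suc x) ≡ sumFrom f 0 (suc x)
sumFrom-reverse f zero    = refl
sumFrom-reverse f (suc x) = trans (cong (f (suc x) +_) (trans (sym (sumFrom-shift 1 (λ i → f (suc x ∸ i)) 0 (suc x))) (sumFrom-reverse f x)))
  (trans (+-comm (f (suc x)) _) (trans (cong (sumFrom f 0 (suc x) +_) (sym (+-identityʳ (f (suc x)))))
  (sym (trans (cong (sumFrom f 0) (+-comm 1 (suc x))) (trans (sumFrom-split f 0 (suc x) 1) (cong (λ k → sumFrom f 0 (suc x) + (f k + 0)) (+-identityʳ (suc x))))))))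

module GapSet {g : ℕ} {H : List ℕ} (isGap : IsGapSetOfGenus g H) where
  open IsGapSetOfGenus isGap

  χ : ℕ → Bool
  χ = indicator H

  χ-closed : ∀ a b → χ a ≡ true → χ b ≡ true → χ (a + b) ≡ true
  χ-closed a b ea eb = indicator-∉ (closed a b (indicator-true H a ea) (indicator-true H b eb))

  -- For a gap x, one of i and x - i is a gap, for each i ≤ x.
  gap-bound : ∀ {x} → x ∈ H → suc x ≤ 2 * g
  gap-bound {x} x∈ = ≤-trans (≤-reflexive (ones (suc x) 0)) (≤-trans (sumFrom-≤-local (λ _ → 1) _ 0 (suc x) (λ i i≤ → pair i (≤-pred i≤)))
    (≤-trans (≤-reflexive (trans (sumFrom-+ gap (λ i → gap (x ∸ i)) 0 (suc x)) (trans (cong (sumFrom gap 0 (suc x) +_) (sumFrom-reverse gap x)) (cong (sumFrom gap 0 (suc x) +_) (sym (+-identityʳ _)))))) (scale 2 count)))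
    where
    gap : ℕ → ℕ
    gap = bit ∘ not ∘ χ
    ones : ∀ n a → n ≡ sumFrom (λ _ → 1) a n
    ones zero    a = refl
    ones (suc n) a = cong suc (ones n (suc a))
    count : sumFrom gap 0 (suc x) ≤ g
    count = ≤-trans (≤-reflexive (trans (sym (falses-bits χ 0 (suc x))) (sym (length-positions 0 (bits χ 0 (suc x))))))
      (≤-trans (length-injection id _ H (positions-unique 0 (bits χ 0 (suc x))) (λ {y} y∈ → indicator-false H y (∈-positions-bits χ 0 (suc x) y∈)) (λ _ _ e → e)) (≤-reflexive genus))
    pair : ∀ i → i ≤ x → 1 ≤ gap i + gap (x ∸ i)
    pair i i≤ with χ i in ei | χ (x ∸ i) in ej
    ... | false | _     = s≤s z≤n
    ... | true  | false = s≤s z≤n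
    ... | true  | true  with trans (sym (indicator-∈ {H} x∈)) (subst (λ k → χ k ≡ true) (m+[n∸m]≡n i≤) (χ-closed i (x ∸ i) ei ej))
    ...   | ()

  positive : All (1 ≤_) H
  positive = All.tabulate (λ { {zero} x∈ → ⊥-elim (zero∈S x∈) ; {suc x} x∈ → s≤s z≤n })

  positions-χ : ∀ n → 2 * g ≤ 1 + n → positions 1 (bits χ 1 n) ≡ H
  positions-χ n h = positions-indicator n 1 H strictlySorted positive (All.tabulate (λ x∈ → ≤-trans (gap-bound x∈) h))

  falses-χ : ∀ n → 2 * g ≤ 1 + n → falses (bits χ 1 n) ≡ g
  falses-χ n h = trans (sym (length-positions 1 (bits χ 1 n))) (trans (cong length (positions-χ n h)) genus)

  sum≡ : ∀ n → 2 * g ≤ 1 + n → 2 * sum H ≡ 2 * inversions (bits χ 1 n) + g * (g + 1)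
  sum≡ n h = +-cancelʳ-≡ g _ _ (trans (subst₂′ (positions-χ n h) (falses-χ n h) (sum-positions 1 (bits χ 1 n))) (lem (inversions (bits χ 1 n)) g))
    where
    lem : ∀ i g → 2 * i + g * g + 2 * 1 * g ≡ 2 * i + g * (g + 1) + g
    lem = solve-∀
    subst₂′ : ∀ {P P′ f f′} → P ≡ P′ → f ≡ f′ → 2 * sum P + f ≡ 2 * inversions (bits χ 1 n) + f * f + 2 * 1 * f → 2 * sum P′ + f′ ≡ 2 * inversions (bits χ 1 n) + f′ * f′ + 2 * 1 * f′
    subst₂′ refl refl e = e

-- The first dense window

nth : List Bool → ℕ → Bool
nth []      j       = false
nth (b ∷ v) zero    = b
nth (b ∷ v) (suc j) = nth v j

nth-bits : ∀ χ a n j → nth (bits χ a n) j ≡ true → χ (a + j) ≡ true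
nth-bits χ a (suc n) zero    e = trans (cong χ (+-identityʳ a)) e
nth-bits χ a (suc n) (suc j) e = trans (cong χ (+-suc a j)) (nth-bits χ (suc a) n j e)

nth-++ : ∀ v w j → nth (v ++ w) (length v + j) ≡ nth w j
nth-++ []      w j = refl
nth-++ (b ∷ v) w j = nth-++ v w j

sum-nth : ∀ v → sumFrom (bit ∘ nth v) 0 (length v) ≡ trues v
sum-nth []          = refl
sum-nth (b ∷ v) = trans (cong (bit b +_) (trans (sym (sumFrom-shift 1 (bit ∘ nth (b ∷ v)) 0 (length v))) (sum-nth v))) (step b)
  where
  step : ∀ b → bit b + trues v ≡ trues (b ∷ v)
  step true  = refl
  step false = refl

module _ (χ : ℕ → Bool) (L Q : ℕ) where

  dense-window : ∀ n → (∃ λ i → trues (bits χ 1 (i * L)) ≤ i * Q × Q ≤ trues (bits χ (i * L + 1) L)) ⊎ trues (bits χ 1 (n * L)) ≤ n * Q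
  dense-window zero    = inj₂ z≤n
  dense-window (suc n) with dense-window n
  ... | inj₁ found = inj₁ found
  ... | inj₂ few with Q ℕₚ.≤? trues (bits χ (n * L + 1) L)
  ...   | yes dense = inj₁ (n , few , dense)
  ...   | no sparse = inj₂ (≤-trans (≤-reflexive (trans (cong (λ k → trues (bits χ 1 k)) (+-comm L (n * L))) (trans (cong trues (bits-++ χ 1 (n * L) L)) (trues-++ (bits χ 1 (n * L)) _))))
      (≤-trans (few ⊞ <⇒≤ (≰⇒> sparse)) (≤-reflexive (+-comm (n * Q) Q))))

-- Encoding a semigroup of genus g by two sparse bit lists and a composition

module Code (k g : ℕ) where

  -- With L = K³ and Q = K² both ratios that have to be small are 1 / K: the density Q / L allowed
  -- below the dense window, and the share K / `card` of translates that a light position may miss.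
  K Q L : ℕ
  K = suc k
  Q = K * K
  L = K * Q

  offset : (ℕ → Bool) → ℕ
  offset χ with dense-window χ L Q g
  ... | inj₁ (i , _) = i * L
  -- A default value: for gap sets of genus g ≥ 2 with k ≥ 2 this case is refuted in `found`.
  ... | inj₂ _       = 0

  prefix tail : (ℕ → Bool) → List Bool
  prefix χ = bits χ 1 (offset χ + L)
  -- Gaps are below 2 g, so prefix and tail together contain all of them.
  tail χ   = bits χ (offset χ + L + 1) (2 * g)

  -- D is read off the transmitted prefix, so the decoder knows it. Index M of the prefix is
  -- position M + 1, hence the value M + 1 for `lo`.
  window : ℕ → List Bool → ℕ → Bool
  window M v j = nth v (M + j)

  heavyPart freePart : ℕ → List Bool → List Bool → List Bool
  heavyPart M v = Scan.heavyBits K (M + 1) L (window M v) (m≤n+m 1 M) (M + L + 1) (λ _ → false)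
  freePart M v  = Scan.freeBits K (M + 1) L (window M v) (m≤n+m 1 M) (M + L + 1) (λ _ → false)

  heavyOf freeOf : List ℕ → List Bool
  heavyOf H = heavyPart (offset (indicator H)) (prefix (indicator H)) (tail (indicator H))
  freeOf H  = freePart (offset (indicator H)) (prefix (indicator H)) (tail (indicator H))

  code : List ℕ → List Bool × List Bool × List Bool
  code H = prefix (indicator H) , heavyOf H , freeOf H

  module _ {H : List ℕ} (isGap : IsGapSetOfGenus g H) where
    open GapSet isGap

    prefix++tail : bits χ 1 (offset χ + L + 2 * g) ≡ prefix χ ++ tail χ
    prefix++tail = bits-++ χ 1 (offset χ + L) (2 * g)

    2g≤ : 2 * g ≤ 1 + (offset χ + L + 2 * g)
    2g≤ = m≤n+m (2 * g) (1 + (offset χ + L))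

    window-sound : ∀ j → window (offset χ) (prefix χ) j ≡ true → χ (offset χ + 1 + j) ≡ true
    window-sound j e = trans (cong χ (lem (offset χ) j)) (nth-bits χ 1 (offset χ + L) (offset χ + j) e)
      where
      lem : ∀ m j → m + 1 + j ≡ 1 + (m + j)
      lem = solve-∀

    open Scan K (offset χ + 1) L (window (offset χ) (prefix χ)) (m≤n+m 1 (offset χ))

    valid : ∀ n p Y → (∀ r → Y r ≡ true → χ r ≡ true) → Valid p Y (bits χ p n)
    valid zero    p Y Y⊆ = tt
    valid (suc n) p Y Y⊆ = Y⊆ p , valid n (suc p) (next Y p (χ p)) next⊆
      where
      next⊆ : ∀ r → next Y p (χ p) r ≡ true → χ r ≡ true
      next⊆ r e with χ p in ep | heavy Y p
      ... | false | _     = Y⊆ r e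
      ... | true  | false = Y⊆ r e
      ... | true  | true  = extend-sound p Y Y⊆ (λ j ej → subst (λ k → χ k ≡ true) (lem (offset χ) j p) (χ-closed (offset χ + 1 + j) p (window-sound j ej) ep)) r e
        where
        lem : ∀ m j p → m + 1 + j + p ≡ m + 1 + p + j
        lem = solve-∀

    tail-valid : Valid (offset χ + L + 1) (λ _ → false) (tail χ)
    tail-valid = valid (2 * g) (offset χ + L + 1) (λ _ → false) (λ r ())

  -- The length of the prefix gives the offset, the prefix gives D, replaying the scan gives the
  -- tail, and the gaps are read off prefix and tail.
  code-injective : ∀ {H H′} → IsGapSetOfGenus g H → IsGapSetOfGenus g H′ → code H ≡ code H′ → H ≡ H′
  code-injective {H} {H′} isGap isGap′ e = trans (sym (GapSet.positions-χ isGap n (2g≤ isGap)))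
      (trans (cong (positions 1) whole) (trans (cong (λ m → positions 1 (bits χ′ 1 (m + L + 2 * g))) M≡) (GapSet.positions-χ isGap′ _ (2g≤ isGap′))))
    where
    χ χ′ : ℕ → Bool
    χ = indicator H
    χ′ = indicator H′
    n = offset χ + L + 2 * g
    prefix≡ : prefix χ ≡ prefix χ′
    prefix≡ = cong proj₁ e
    M≡ : offset χ ≡ offset χ′
    M≡ = +-cancelʳ-≡ L _ _ (trans (sym (length-bits χ 1 _)) (trans (cong length prefix≡) (length-bits χ′ 1 _)))
    same-scan : ∀ {M v t M′ v′ t′} → M ≡ M′ → v ≡ v′ → length t ≡ length t′ →
      Scan.Valid K (M + 1) L (window M v) (m≤n+m 1 M) (M + L + 1) (λ _ → false) t → Scan.Valid K (M′ + 1) L (window M′ v′) (m≤n+m 1 M′) (M′ + L + 1) (λ _ → false) t′ →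
      heavyPart M v t ≡ heavyPart M′ v′ t′ → freePart M v t ≡ freePart M′ v′ t′ → t ≡ t′
    same-scan {M} {v} refl refl = Scan.scan-injective K (M + 1) L (window M v) (m≤n+m 1 M) _ _ _ _
    tail≡ : tail χ ≡ tail χ′
    tail≡ = same-scan M≡ prefix≡ (trans (length-bits χ _ (2 * g)) (sym (length-bits χ′ _ (2 * g)))) (tail-valid isGap) (tail-valid isGap′) (cong (proj₁ ∘ proj₂) e) (cong (proj₂ ∘ proj₂) e)
    whole : bits χ 1 n ≡ bits χ′ 1 n
    whole = trans (prefix++tail isGap) (trans (cong₂ _++_ prefix≡ tail≡) (trans (sym (prefix++tail isGap′)) (cong (λ m → bits χ′ 1 (m + L + 2 * g)) (sym M≡))))

  -- `w` will be the weight and `e` the number of gaps in the heavy stream; u is the unit in which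
  -- all other errors are measured.
  record Summary (u : ℕ) (H : List ℕ) : Set where
    field
      prefix-length : length (prefix (indicator H)) ≤ 3 * g
      prefix-sparse : trues (prefix (indicator H)) ≤ u
      heavy-length  : length (heavyOf H) ≤ 3 * g
      heavy-sparse  : trues (heavyOf H) ≤ u
      w e           : ℕ
      sum≡          : 2 * sum H ≡ 2 * w + g * (g + 1)
      size-upper    : size (freeOf H) + e ≤ g + 2 * u + 1
      size-lower    : g ≤ size (freeOf H) + 2 * e + 2 * u
      w-lower       : inversions (freeOf H) ≤ w
      w-upper       : w ≤ inversions (freeOf H) + g * (7 * u + 6 * e)

  module _ (2≤k : 2 ≤ k) (2≤g : 2 ≤ g) {u : ℕ} (8g≤ku : 8 * g ≤ k * u) (2L≤u : 2 * L ≤ u) (u≤g : u ≤ g) {H : List ℕ} (isGap : IsGapSetOfGenus g H) where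
    open GapSet isGap hiding (sum≡)
    open Scan K (offset χ + 1) L (window (offset χ) (prefix χ)) (m≤n+m 1 (offset χ))

    private
      M p₁ x e n y a : ℕ
      M  = offset χ
      p₁ = M + L + 1
      none : ℕ → Bool
      none _ = false
      hb fb W : List Bool
      hb = heavyOf H
      fb = freeOf H
      x  = trues hb
      e  = falses hb
      n  = length fb
      a  = falses fb
      y  = forced p₁ none (tail χ)
      W  = bits χ (M + 1) L

      1≤k : 1 ≤ k
      1≤k = ≤-trans (s≤s z≤n) 2≤k

      1≤Q : 1 ≤ Q
      1≤Q = s≤s z≤n

      found : ∃ λ i → M ≡ i * L × trues (bits χ 1 (i * L)) ≤ i * Q × Q ≤ trues (bits χ (i * L + 1) L)
      found with dense-window χ L Q g
      ... | inj₁ (i , few , dense) = i , refl , few , dense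
      -- Otherwise g sparse windows contain at most g Q elements and g gaps, but they consist of g L
      -- = g Q + g k Q ≥ g Q + 2 g positions.
      ... | inj₂ few = ⊥-elim (2≰0 (cert 0 (double ⊞ 2≤g) (lem₃ g)))
        where
        lem₁ : ∀ g k Q → g * 2 + (g * (k * Q) + (g * Q + g)) + 0 ≡ g + (g * (2 * 1) + g * ((1 + k) * Q))
        lem₁ = solve-∀
        lem₂ : ∀ g k Q → 2 * g + g * (k * Q) + (1 + g * Q) ≡ 1 + g * ((1 + k) * Q) + g * (2 * 1)
        lem₂ = solve-∀
        lem₃ : ∀ g → 2 + (g + g) + 0 ≡ 0 + (g * 2 + 2)
        lem₃ = solve-∀
        2≰0 : ¬ (2 ≤ 0)
        2≰0 ()
        2kQ : g * (2 * 1) ≤ g * (k * Q)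
        2kQ = scale g (2≤k ⊠ 1≤Q)
        few′ : g * L ≤ g * Q + g
        few′ = ≤-trans (≤-reflexive (trans (sym (length-bits χ 1 (g * L))) (sym (trues+falses (bits χ 1 (g * L))))))
          (few ⊞ ≤-reflexive (falses-χ (g * L) (cert (1 + g * Q) 2kQ (lem₂ g k Q))))
        double : g * 2 ≤ g
        double = cert 0 (2kQ ⊞ few′) (lem₁ g k Q)

      i iQ : ℕ
      i  = proj₁ found
      iQ = i * Q

      P : List Bool
      P = bits χ 1 M

      M≡ : M ≡ iQ + k * iQ
      M≡ = trans (proj₁ (proj₂ found)) (lem i k Q)
        where
        lem : ∀ i k Q → i * ((1 + k) * Q) ≡ i * Q + k * (i * Q)
        lem = solve-∀

      trues-P : trues P ≤ iQ
      trues-P = subst (λ m → trues (bits χ 1 m) ≤ iQ) (sym (proj₁ (proj₂ found))) (proj₁ (proj₂ (proj₂ found)))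

      Q≤trues-W : Q ≤ trues W
      Q≤trues-W = subst (λ m → Q ≤ trues (bits χ (m + 1) L)) (sym (proj₁ (proj₂ found))) (proj₂ (proj₂ (proj₂ found)))

      prefix≡ : prefix χ ≡ P ++ W
      prefix≡ = bits-++ χ 1 M L

      total : ℕ
      total = M + L + 2 * g

      falses-total : falses (P ++ W) + falses (tail χ) ≡ g
      falses-total = trans (sym (falses-++ (P ++ W) (tail χ))) (trans (cong (λ v → falses (v ++ tail χ)) (sym prefix≡)) (trans (cong falses (sym (prefix++tail isGap))) (falses-χ total (2g≤ isGap))))

      falses-split : falses P + falses W + (e + a) ≡ g
      falses-split = trans (cong₂ _+_ (sym (falses-++ P W)) (sym (scan-falses p₁ none (tail χ) (tail-valid isGap)))) falses-total

      length-P : trues P + falses P ≡ M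
      length-P = trans (trues+falses P) (length-bits χ 1 M)

      length-W : trues W + falses W ≡ L
      length-W = trans (trues+falses W) (length-bits χ (M + 1) L)

      -- Of the M = (k + 1) iQ positions before the window at most iQ are elements; the others are
      -- gaps.
      kiQ≤g : k * iQ ≤ g
      kiQ≤g = cert (falses W + (e + a)) (≤-reflexive (sym M≡) ⊞ ≤-reflexive (sym length-P) ⊞ trues-P ⊞ ≤-reflexive falses-split) (lem (k * iQ) iQ M (trues P) (falses P) (falses W) (e + a) g)
        where
        lem : ∀ z q m t f w r g → z + (m + (t + f) + q + g) + (w + r) ≡ g + (q + z + m + t + (f + w + r))
        lem = solve-∀

      2iQ≤u : 2 * iQ ≤ u
      2iQ≤u = *-cancelʳ-≤′ k 1≤k (cert (6 * g) (scale 2 kiQ≤g ⊞ 8g≤ku) (lem iQ k g u))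
        where
        lem : ∀ q k g u → 2 * q * k + (2 * g + k * u) + 6 * g ≡ u * k + (2 * (k * q) + 8 * g)
        lem = solve-∀

      iQ+L≤u : iQ + L ≤ u
      iQ+L≤u = *-cancelʳ-≤′ 2 (s≤s z≤n) (cert 0 (2iQ≤u ⊞ 2L≤u) (lem iQ L u))
        where
        lem : ∀ q l u → (q + l) * 2 + (u + u) + 0 ≡ u * 2 + (2 * q + 2 * l)
        lem = solve-∀

      L≤u : L ≤ u
      L≤u = ≤-trans (m≤n+m L iQ) iQ+L≤u

      M+1≤2g : M + 1 ≤ 2 * g
      M+1≤2g = *-cancelʳ-≤′ 2 (s≤s z≤n) (cert 0 (scale 2 (≤-reflexive M≡) ⊞ 2iQ≤u ⊞ u≤g ⊞ scale 2 kiQ≤g ⊞ 2≤g) (lem M iQ (k * iQ) u g))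
        where
        lem : ∀ m q z u g → (m + 1) * 2 + (2 * (q + z) + u + g + 2 * g + g) + 0 ≡ 2 * g * 2 + (2 * m + 2 * q + u + 2 * z + 2)
        lem = solve-∀

      trues-prefix : trues (prefix χ) ≤ u
      trues-prefix = ≤-trans (≤-reflexive (trans (cong trues prefix≡) (trues-++ P W))) (≤-trans (trues-P ⊞ (≤-trans (m≤m+n (trues W) (falses W)) (≤-reflexive length-W))) iQ+L≤u)

      length-tail : length (tail χ) ≡ 2 * g
      length-tail = length-bits χ p₁ (2 * g)

      lengths : length hb + n + y ≡ 2 * g
      lengths = trans (scan-length p₁ none (tail χ)) length-tail

      hb-length : e + x ≡ length hb
      hb-length = trans (+-comm e x) (trues+falses hb)

      -- `heavy-trues` bounds x K by the end B of the last translate, and B ≤ 8 g ≤ k u. This is the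
      -- origin of the 8 in the hypothesis.
      x≤u : x ≤ u
      x≤u = *-cancelʳ-≤′ k 1≤k (cert (x + sumFrom (bit ∘ none) 0 B) (scale 1 (heavy-trues p₁ none (tail χ) B ≤-refl) ⊞ scale 1 (sumFrom-≤ (bit ∘ final p₁ none (tail χ)) 1 0 B (bit≤1 ∘ final p₁ none (tail χ))) ⊞ ≤-reflexive B≡ ⊞ scale 2 M+1≤2g ⊞ scale 2 L≤u ⊞ scale 2 u≤g ⊞ 8g≤ku)
          (lem x k (sumFrom (bit ∘ none) 0 B) (sumFrom (bit ∘ final p₁ none (tail χ)) 0 B) B M L g u))
        where
        B : ℕ
        B = M + 1 + p₁ + length (tail χ) + L
        B≡ : B ≡ M + 1 + (M + L + 1) + 2 * g + L
        B≡ = cong (λ l → M + 1 + p₁ + l + L) length-tail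
        lem : ∀ x k s f B m L g u → x * k + (1 * f + 1 * (B * 1) + (m + 1 + (m + L + 1) + 2 * g + L) + 2 * (2 * g) + 2 * u + 2 * g + k * u) + (x + s)
          ≡ u * k + (1 * (x * (1 + k) + s) + 1 * f + B + 2 * (m + 1) + 2 * L + 2 * u + 8 * g)
        lem = solve-∀

      card≡ : card ≡ trues W
      card≡ = trans (sumFrom-cong 0 L (λ j → cong bit (trans (cong (λ v → nth v (M + j)) prefix≡) (trans (cong (λ m → nth (P ++ W) (m + j)) (sym (length-bits χ 1 M))) (nth-++ P W j)))))
        (trans (cong (sumFrom (bit ∘ nth W) 0) (sym (length-bits χ (M + 1) L))) (sum-nth W))

      -- Let r be the excess of n over M + 1 + L. `free-bound` leaves card * r ≤ (n + y) K, and card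
      -- ≥ K² turns this into K r ≤ n + y ≤ 2 g, hence r ≤ u / 2. The other half of u pays for L.
      n≤ : n ≤ M + 1 + u
      n≤ with ≤-total n (M + 1 + L)
      ... | inj₁ small = ≤-trans small (+-monoʳ-≤ (M + 1) L≤u)
      ... | inj₂ large = ≤-trans (≤-reflexive (sym n≡)) (≤-trans (≤-reflexive (+-assoc (M + 1) L r)) (+-monoʳ-≤ (M + 1) L+r≤u))
        where
        r : ℕ
        r = n ∸ (M + 1 + L)
        n≡ : M + 1 + L + r ≡ n
        n≡ = m+[n∸m]≡n large
        Kr≤ : K * r ≤ n + y
        Kr≤ = *-cancelʳ-≤′ K (s≤s z≤n) (≤-trans (≤-reflexive (lem₁ K r)) (≤-trans (Q≤card ⊠ ≤-refl {r})
          (cert 0 (free-bound p₁ none (tail χ) (tail-valid isGap) ⊞ scale card (≤-reflexive n≡)) (lem₂ card r y (M + 1) L n K))))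
          where
          Q≤card : Q ≤ card
          Q≤card = ≤-trans Q≤trues-W (≤-reflexive (sym card≡))
          lem₁ : ∀ K r → K * r * K ≡ K * K * r
          lem₁ = solve-∀
          lem₂ : ∀ c r y m L n K → c * r + (c * (y + (m + L)) + (n + y) * K + c * n) + 0 ≡ (n + y) * K + ((n + y) * c + c * (m + L + r))
          lem₂ = solve-∀
        L+r≤u : L + r ≤ u
        L+r≤u = *-cancelʳ-≤′ 2 (s≤s z≤n) (cert 0 (2L≤u ⊞ 2r≤u) (lem L r u))
          where
          lem : ∀ L r u → (L + r) * 2 + (u + u) + 0 ≡ u * 2 + (2 * L + 2 * r)
          lem = solve-∀
          2r≤u : 2 * r ≤ u
          2r≤u = *-cancelʳ-≤′ k 1≤k (cert (2 * r + 4 * g + 2 * length hb) (scale 2 Kr≤ ⊞ scale 2 (≤-reflexive lengths) ⊞ 8g≤ku) (lem′ r k u n y g (length hb)))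
            where
            lem′ : ∀ r k u n y g h → 2 * r * k + (2 * (n + y) + 2 * (2 * g) + k * u) + (2 * r + 4 * g + 2 * h) ≡ u * k + (2 * ((1 + k) * r) + 2 * (h + n + y) + 8 * g)
            lem′ = solve-∀

      -- The tail is cut after lo = M + 1 positions. None of these is forced and at most e + u are
      -- heavy, so nearly all of the at most M + 1 + u free positions lie in `B₁`. Hence `B₂` has
      -- few gaps, and the weight is decided in `B₁`.
      B₁ B₂ hb₁ hb₂ fb₁ fb₂ : List Bool
      B₁  = bits χ p₁ (M + 1)
      B₂  = bits χ (M + 1 + p₁) (2 * g ∸ (M + 1))
      hb₁ = heavyBits p₁ none B₁
      fb₁ = freeBits p₁ none B₁
      hb₂ = heavyBits (length B₁ + p₁) (final p₁ none B₁) B₂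
      fb₂ = freeBits (length B₁ + p₁) (final p₁ none B₁) B₂

      tail≡ : tail χ ≡ B₁ ++ B₂
      tail≡ = trans (cong (bits χ p₁) (sym (m+[n∸m]≡n M+1≤2g))) (bits-++ χ p₁ (M + 1) _)

      hb≡ : hb ≡ hb₁ ++ hb₂
      hb≡ = trans (cong (heavyBits p₁ none) tail≡) (proj₁ (scan-++ p₁ none B₁ B₂))

      fb≡ : fb ≡ fb₁ ++ fb₂
      fb≡ = trans (cong (freeBits p₁ none) tail≡) (proj₂ (scan-++ p₁ none B₁ B₂))

      B₁-valid : Valid p₁ none B₁
      B₁-valid = valid isGap (M + 1) p₁ none (λ r ())

      B₁-unforced : forced p₁ none B₁ ≡ 0
      B₁-unforced = unforced (M + 1 + p₁) p₁ none B₁ (λ _ _ → refl) (≤-reflexive (trans (cong (p₁ +_) (length-bits χ p₁ (M + 1))) (+-comm p₁ (M + 1)))) ≤-refl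

      lengths₁ : length hb₁ + length fb₁ ≡ M + 1
      lengths₁ = trans (sym (+-identityʳ _)) (trans (cong (length hb₁ + length fb₁ +_) (sym B₁-unforced)) (trans (scan-length p₁ none B₁) (length-bits χ p₁ (M + 1))))

      length-fb : length fb₁ + length fb₂ ≡ n
      length-fb = trans (sym (length-++ fb₁)) (cong length (sym fb≡))

      length-hb₁ : length hb₁ ≤ e + u
      length-hb₁ = ≤-trans (m≤m+n (length hb₁) (length hb₂)) (≤-trans (≤-reflexive (trans (sym (length-++ hb₁)) (trans (cong length (sym hb≡)) (sym hb-length)))) (+-monoʳ-≤ e x≤u))

      length-fb₂ : length fb₂ ≤ e + 2 * u
      length-fb₂ = cert 0 (≤-reflexive length-fb ⊞ n≤ ⊞ ≤-reflexive (sym lengths₁) ⊞ length-hb₁) (lem (length fb₂) (length fb₁) n M u (length hb₁) e)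
        where
        lem : ∀ f₂ f₁ n m u h e → f₂ + (n + (m + 1 + u) + (h + f₁) + (e + u)) + 0 ≡ e + 2 * u + (f₁ + f₂ + n + (m + 1) + h)
        lem = solve-∀

      falses-B₂ : falses B₂ ≤ 2 * e + 2 * u
      falses-B₂ = cert (falses hb₁)
        (≤-reflexive (trans (sym (falses-++ B₁ B₂)) (trans (cong falses (sym tail≡)) (scan-falses p₁ none (tail χ) (tail-valid isGap))))
         ⊞ ≤-reflexive (sym (scan-falses p₁ none B₁ B₁-valid)) ⊞ ≤-reflexive (trans (cong falses fb≡) (falses-++ fb₁ fb₂))
         ⊞ (≤-trans (m≤n+m (falses fb₂) (trues fb₂)) (≤-trans (≤-reflexive (trues+falses fb₂)) length-fb₂)))
        (lem (falses B₁) (falses B₂) e a (falses hb₁) (falses fb₁) (falses fb₂) u)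
        where
        lem : ∀ b₁ b₂ e a h₁ f₁ f₂ u → b₂ + (e + a + b₁ + (f₁ + f₂) + (e + 2 * u)) + h₁ ≡ 2 * e + 2 * u + (b₁ + b₂ + (h₁ + f₁) + a + f₂)
        lem = solve-∀

      w₀ : ℕ
      w₀ = inversions (bits χ 1 total)

      w≡ : w₀ ≡ inversions (prefix χ) + inversions (tail χ) + trues (prefix χ) * falses (tail χ)
      w≡ = trans (cong inversions (prefix++tail isGap)) (inversions-++ (prefix χ) (tail χ))

      prefix-part : w₀ ≤ inversions (tail χ) + g * u
      prefix-part = ≤-trans (≤-reflexive w≡) (≤-trans (cert 0 (inversions≤ (prefix χ)) (lem (inversions (prefix χ)) (inversions (tail χ)) (trues (prefix χ)) (falses (prefix χ)) (falses (tail χ))))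
        (+-monoʳ-≤ _ (≤-trans (≤-reflexive (trans (cong (trues (prefix χ) *_) (trans (cong (λ v → falses v + falses (tail χ)) prefix≡) falses-total)) (*-comm _ g))) (scale g trues-prefix))))
        where
        lem : ∀ i j t f f′ → i + j + t * f′ + t * f + 0 ≡ j + t * (f + f′) + i
        lem = solve-∀

      tail-part : inversions (tail χ) ≤ inversions B₁ + 2 * g * (2 * e + 2 * u)
      tail-part = ≤-trans (≤-reflexive (trans (cong inversions tail≡) (inversions-++ B₁ B₂))) (≤-trans (cert 0 (inversions≤ B₂) (lem (inversions B₁) (inversions B₂) (trues B₁) (trues B₂) (falses B₂)))
        (+-monoʳ-≤ _ (trues≤ ⊠ falses-B₂)))
        where
        lem : ∀ i j t t′ f → i + j + t * f + t′ * f + 0 ≡ i + (t + t′) * f + j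
        lem = solve-∀
        trues≤ : trues B₁ + trues B₂ ≤ 2 * g
        trues≤ = ≤-trans (≤-reflexive (trans (sym (trues-++ B₁ B₂)) (cong trues (sym tail≡)))) (≤-trans (m≤m+n _ (falses (tail χ))) (≤-reflexive (trans (trues+falses (tail χ)) length-tail)))

      first-part : inversions B₁ ≤ inversions fb + (e + u) * (2 * g)
      first-part = ≤-trans (inversions-unforced p₁ none B₁ B₁-valid B₁-unforced)
        (≤-trans (m≤m+n _ _) (≤-trans (m≤m+n _ _) (≤-reflexive (trans (sym (inversions-++ fb₁ fb₂)) (cong inversions (sym fb≡))))) ⊞ length-hb₁ ⊠ (≤-trans (≤-reflexive (length-bits χ p₁ (M + 1))) M+1≤2g))

    summary : Summary u H
    summary = record
      { prefix-length = ≤-trans (≤-reflexive (length-bits χ 1 (M + L))) (≤-trans (m≤m+n (M + L) 1) (cert 0 (M+1≤2g ⊞ L≤u ⊞ u≤g) (lem₀ M L g u)))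
      ; prefix-sparse = trues-prefix
      ; heavy-length  = ≤-trans (m≤m+n _ n) (≤-trans (m≤m+n _ y) (≤-trans (≤-reflexive lengths) (*-monoˡ-≤ g {2} {3} (s≤s (s≤s z≤n)))))
      ; heavy-sparse  = x≤u
      ; w             = w₀
      ; e             = e
      ; sum≡          = GapSet.sum≡ isGap total (2g≤ isGap)
      -- The size of a word is its length plus its number of twos. The length n is at most M + 1 +
      -- u, and M exceeds the number of gaps in `P` by at most u, so n, a and e are all paid for by
      -- distinct gaps among the g.
      ; size-upper    = cert (falses W) (≤-reflexive size-fb ⊞ n≤ ⊞ ≤-reflexive (sym length-P) ⊞ (≤-trans trues-P (≤-trans (m≤m+n iQ L) iQ+L≤u)) ⊞ ≤-reflexive falses-split) (lem₁ (size fb) n a M u (trues P) (falses P) (falses W) e g)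
      ; size-lower    = cert (trues P + length fb₂ + trues W + 1) (≤-reflexive (sym falses-split) ⊞ ≤-reflexive length-P ⊞ ≤-reflexive (sym lengths₁) ⊞ length-hb₁ ⊞ ≤-reflexive length-fb ⊞ ≤-reflexive length-W ⊞ L≤u ⊞ ≤-reflexive (sym size-fb))
                          (lem₂ (size fb) n a M u (trues P) (falses P) (trues W) (falses W) e g (length hb₁) (length fb₁) (length fb₂) L)
      ; w-lower       = ≤-trans (inversions-free p₁ none (tail χ)) (≤-trans (≤-trans (m≤n+m _ (inversions (prefix χ))) (m≤m+n _ _)) (≤-reflexive (sym w≡)))
      ; w-upper       = cert 0 (prefix-part ⊞ tail-part ⊞ first-part) (lem₃ w₀ (inversions (tail χ)) (inversions B₁) (inversions fb) g u e)
      }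
      where
      size-fb : size fb ≡ n + a
      size-fb = trans (size≡ fb) (trans (lem (trues fb) a) (cong (_+ a) (trues+falses fb)))
        where
        lem : ∀ t f → t + 2 * f ≡ t + f + f
        lem = solve-∀
      lem₀ : ∀ m l g u → m + l + 1 + (2 * g + u + g) + 0 ≡ 3 * g + (m + 1 + l + u)
      lem₀ = solve-∀
      lem₁ : ∀ s n a m u t f w e g → s + e + (n + a + (m + 1 + u) + (t + f) + u + g) + w ≡ g + 2 * u + 1 + (s + n + m + t + (f + w + (e + a)))
      lem₁ = solve-∀
      lem₂ : ∀ s n a m u t f t′ w e g h f₁ f₂ l →
        g + (f + w + (e + a) + m + (h + f₁) + (e + u) + n + l + u + s) + (t + f₂ + t′ + 1)
        ≡ s + 2 * e + 2 * u + (g + (t + f) + (m + 1) + h + (f₁ + f₂) + (t′ + w) + l + (n + a))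
      lem₂ = solve-∀
      lem₃ : ∀ w t b f g u e → w + (t + g * u + (b + 2 * g * (2 * e + 2 * u)) + (f + (e + u) * (2 * g))) + 0 ≡ f + g * (7 * u + 6 * e) + (w + t + b)
      lem₃ = solve-∀

-- Counting the exceptional semigroups

sparse : ℕ → ℕ → List (List Bool)
sparse zero    μ       = [] ∷ []
sparse (suc l) zero    = map (false ∷_) (sparse l zero)
sparse (suc l) (suc μ) = map (false ∷_) (sparse l (suc μ)) ++ map (true ∷_) (sparse l μ)

∈-sparse : ∀ v {μ} → trues v ≤ μ → v ∈ sparse (length v) μ
∈-sparse []          _       = here refl
∈-sparse (true  ∷ v) {suc μ} (s≤s h) = ∈-++⁺ʳ (map (false ∷_) (sparse (length v) (suc μ))) (∈-map⁺ (true ∷_) (∈-sparse v h))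
∈-sparse (false ∷ v) {zero}  h = ∈-map⁺ (false ∷_) (∈-sparse v h)
∈-sparse (false ∷ v) {suc μ} h = ∈-++⁺ˡ (∈-map⁺ (false ∷_) (∈-sparse v h))

-- Weighting each true by 1 / J.
length-sparse : ∀ J l μ → 1 ≤ J → length (sparse l μ) * J ^ l ≤ suc J ^ l * J ^ μ
length-sparse J zero    μ       1≤J = ≤-trans (^-≥1 μ 1≤J) (≤-reflexive (sym (+-identityʳ _)))
length-sparse J (suc l) zero    1≤J = ≤-trans (≤-reflexive (cong (_* J ^ suc l) (length-map _ (sparse l zero))))
  (cert (suc J ^ l * J ^ 0) (scale J (length-sparse J l zero 1≤J)) (lem (length (sparse l zero)) J (J ^ l) (suc J ^ l) (J ^ 0)))
  where
  lem : ∀ c J x y z → c * (J * x) + J * (y * z) + y * z ≡ (1 + J) * y * z + J * (c * x)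
  lem = solve-∀
length-sparse J (suc l) (suc μ) 1≤J = ≤-trans (≤-reflexive (cong (_* J ^ suc l) (trans (length-++ (map (false ∷_) (sparse l (suc μ)))) (cong₂ _+_ (length-map _ (sparse l (suc μ))) (length-map _ (sparse l μ))))))
  (cert 0 (scale J (length-sparse J l (suc μ) 1≤J) ⊞ scale J (length-sparse J l μ 1≤J)) (lem (length (sparse l (suc μ))) (length (sparse l μ)) J (J ^ l) (suc J ^ l) (J ^ μ)))
  where
  lem : ∀ c d J x y z → (c + d) * (J * x) + (J * (y * (J * z)) + J * (y * z)) + 0 ≡ (1 + J) * y * (J * z) + (J * (c * x) + J * (d * x))
  lem = solve-∀

suc-^-≤ : ∀ x n → suc x ^ suc n ≤ x ^ suc n + suc n * suc x ^ n
suc-^-≤ x zero    = ≤-reflexive (lem x)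
  where
  lem : ∀ x → (1 + x) * 1 ≡ x * 1 + 1 * 1
  lem = solve-∀
suc-^-≤ x (suc n) = cert (suc n * suc x ^ n) (scale x (suc-^-≤ x n)) (lem x n (suc x ^ n) (x ^ suc n))
  where
  lem : ∀ x n y z → (1 + x) * ((1 + x) * y) + x * (z + (1 + n) * y) + (1 + n) * y ≡ x * z + (2 + n) * ((1 + x) * y) + x * ((1 + x) * y)
  lem = solve-∀

suc-^-≤-2* : ∀ m → suc (m + suc m) ^ suc m ≤ 2 * (m + suc m) ^ suc m
suc-^-≤-2* m = cert 0 (scale 2 (suc-^-≤ (m + suc m) m)) (lem m (suc (m + suc m) ^ m) ((m + suc m) ^ suc m))
  where
  lem : ∀ m x y → (1 + (m + (1 + m))) * x + 2 * (y + (1 + m) * x) + 0 ≡ 2 * y + 2 * ((1 + (m + (1 + m))) * x)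
  lem = solve-∀

n<2^n : ∀ n → suc n ≤ 2 ^ n
n<2^n zero    = ≤-refl
n<2^n (suc n) = ≤-trans (cert n (scale 2 (n<2^n n)) (lem n (2 ^ n))) ≤-refl
  where
  lem : ∀ n x → 2 + n + 2 * x + n ≡ 2 * x + 2 * (1 + n)
  lem = solve-∀

-- Chernoff's bound with J = 2 n - 1. For this J, (1 + 1 / J)^n ≤ 2, so that (1 + 1 / J)^l ≤ 2^r;
-- the factor J^μ is bounded crudely by 2^(n μ).
length-sparse-2^ : ∀ n r l μ → 1 ≤ n → l ≤ n * r → length (sparse l μ) ≤ 2 ^ (r + n * μ)
length-sparse-2^ (suc m) r l μ _ l≤ = *-cancelʳ-≤′ (J ^ (suc m * r)) (^-≥1 (suc m * r) 1≤J)
  (≤-trans (≤-reflexive (trans (cong (length (sparse l μ) *_) (trans (cong (J ^_) (sym (m+[n∸m]≡n l≤))) (^-distribˡ-+-* J l d))) (sym (*-assoc (length (sparse l μ)) (J ^ l) (J ^ d)))))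
  (≤-trans (length-sparse J l μ 1≤J ⊠ ^-monoˡ-≤ d (n≤1+n J))
  (≤-trans (≤-reflexive (trans (lem (suc J ^ l) (J ^ μ) (suc J ^ d)) (cong (_* J ^ μ) (trans (sym (^-distribˡ-+-* (suc J) l d)) (cong (suc J ^_) (m+[n∸m]≡n l≤))))))
  (≤-trans (≤-trans (≤-reflexive (sym (^-*-assoc (suc J) (suc m) r))) (≤-trans (^-monoˡ-≤ r (suc-^-≤-2* m)) (≤-reflexive (trans (^-distribʳ-* r 2 (J ^ suc m)) (cong (2 ^ r *_) (^-*-assoc J (suc m) r))))) ⊠ ^-monoˡ-≤ μ J≤2^n)
  (≤-reflexive (trans (cong (2 ^ r * J ^ (suc m * r) *_) (^-*-assoc 2 (suc m) μ)) (trans (lem (2 ^ r) (J ^ (suc m * r)) (2 ^ (suc m * μ))) (cong (_* J ^ (suc m * r)) (sym (^-distribˡ-+-* 2 r (suc m * μ)))))))))))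
  where
  J d : ℕ
  J = m + suc m
  d = suc m * r ∸ l
  1≤J : 1 ≤ J
  1≤J = ≤-trans (s≤s z≤n) (m≤n+m (suc m) m)
  J≤2^n : J ≤ 2 ^ suc m
  J≤2^n = cert 1 (scale 2 (n<2^n m)) (lem′ m (2 ^ m))
    where
    lem′ : ∀ m x → m + (1 + m) + 2 * x + 1 ≡ 2 * x + 2 * (1 + m)
    lem′ = solve-∀
  lem : ∀ x y z → x * y * z ≡ x * z * y
  lem = solve-∀

-- w / g² = p q / (2 Π²) + O(1 / q) with Π = p + 2 q; the main term tends to 1 / (10 φ) as p / q → φ.
record Close (q p g w : ℕ) : Set where
  constructor close
  field
    upper : 2 * q * ((p + 2 * q) * (p + 2 * q)) * w ≤ p * (q * q) * (g * g) + 74 * ((p + 2 * q) * (p + 2 * q)) * (g * g)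
    lower : p * (q * q) * (g * g) ≤ 2 * q * ((p + 2 * q) * (p + 2 * q)) * w + 74 * ((p + 2 * q) * (p + 2 * q)) * (g * g)

close-to-word : ∀ {q p g w i h E} (let Π = p + 2 * q) → 1 ≤ q → q * E ≤ g → h ≤ g + E → g ≤ h + E → i ≤ w → w ≤ i + g * E →
  2 * q * (Π * Π) * i ≤ p * (q * q) * (h * h) + 6 * (Π * Π) * (h * h) →
  p * (q * q) * (h * h) ≤ 2 * q * (Π * Π) * i + 18 * (Π * Π) * (h * h) → Close q p g w
close-to-word {q} {p} {g} {w} {i} {h} {E} 1≤q qE≤g h≤ g≤ i≤w w≤ upper lower = close close-≤ close-≥
  where
  Π : ℕ
  Π = p + 2 * q
  E≤g : E ≤ g
  E≤g = ≤-trans (≤-trans (≤-reflexive (sym (*-identityˡ E))) (1≤q ⊠ ≤-refl {E})) qE≤g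
  h≤2g : h ≤ 2 * g
  h≤2g = cert 0 (h≤ ⊞ E≤g) (lem h g E)
    where
    lem : ∀ h g E → h + (g + E + g) + 0 ≡ 2 * g + (h + E)
    lem = solve-∀
  hh≤ : h * h ≤ 4 * (g * g)
  hh≤ = ≤-trans (h≤2g ⊠ h≤2g) (≤-reflexive (lem g))
    where
    lem : ∀ g → 2 * g * (2 * g) ≡ 4 * (g * g)
    lem = solve-∀
  qh≤ : q * h ≤ (q + 1) * g
  qh≤ = cert 0 (scale q h≤ ⊞ qE≤g) (lem q h g E)
    where
    lem : ∀ q h g E → q * h + (q * (g + E) + g) + 0 ≡ (q + 1) * g + (q * h + q * E)
    lem = solve-∀
  qg≤ : q * g ≤ q * h + g
  qg≤ = cert 0 (scale q g≤ ⊞ qE≤g) (lem q h g E)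
    where
    lem : ∀ q h g E → q * g + (q * (h + E) + g) + 0 ≡ q * h + g + (q * g + q * E)
    lem = solve-∀
  pq≤ : p * (2 * q + 1) ≤ Π * Π
  pq≤ = cert (p * p + p * q + 4 * q * q) (scale p 1≤q) (lem p q)
    where
    lem : ∀ p q → p * (2 * q + 1) + p * q + (p * p + p * q + 4 * q * q) ≡ (p + 2 * q) * (p + 2 * q) + p * 1
    lem = solve-∀
  close-≤ : 2 * q * (Π * Π) * w ≤ p * (q * q) * (g * g) + 74 * (Π * Π) * (g * g)
  close-≤ = cert (47 * (Π * Π * (g * g)))
    (scale (2 * q * (Π * Π)) w≤ ⊞ upper ⊞ scale p (qh≤ ⊠ qh≤) ⊞ scale (6 * (Π * Π)) hh≤ ⊞ scale (2 * (Π * Π) * g) qE≤g ⊞ scale (g * g) pq≤)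
    (lem q p (Π * Π) w i h g E)
    where
    lem : ∀ q p S w i h g E → 2 * q * S * w + (2 * q * S * (i + g * E) + (p * (q * q) * (h * h) + 6 * S * (h * h)) + p * ((q + 1) * g * ((q + 1) * g)) + 6 * S * (4 * (g * g)) + 2 * S * g * g + g * g * S) + 47 * (S * (g * g))
      ≡ p * (q * q) * (g * g) + 74 * S * (g * g) + (2 * q * S * w + 2 * q * S * i + p * (q * h * (q * h)) + 6 * S * (h * h) + 2 * S * g * (q * E) + g * g * (p * (2 * q + 1)))
    lem = solve-∀
  -- The 74 is 4 * 18 + 2: from h ≤ 2 g the error 18 h² becomes 72 g², and replacing q g by q h + g
  -- costs 2 more.
  close-≥ : p * (q * q) * (g * g) ≤ 2 * q * (Π * Π) * w + 74 * (Π * Π) * (g * g)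
  close-≥ = cert (p * (g * g))
    (scale p (qg≤ ⊠ qg≤) ⊞ lower ⊞ scale (2 * q * (Π * Π)) i≤w ⊞ scale (18 * (Π * Π)) hh≤ ⊞ scale (2 * p * q) (h≤2g ⊠ ≤-refl {g}) ⊞ scale (2 * (g * g)) pq≤)
    (lem q p (Π * Π) w i h g)
    where
    lem : ∀ q p S w i h g → p * (q * q) * (g * g) + (p * ((q * h + g) * (q * h + g)) + (2 * q * S * i + 18 * S * (h * h)) + 2 * q * S * w + 18 * S * (4 * (g * g)) + 2 * p * q * (2 * g * g) + 2 * (g * g) * S) + p * (g * g)
      ≡ 2 * q * S * w + 74 * S * (g * g) + (p * (q * g * (q * g)) + p * (q * q) * (h * h) + 2 * q * S * i + 18 * S * (h * h) + 2 * p * q * (h * g) + 2 * (g * g) * (p * (2 * q + 1)))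
    lem = solve-∀

short-sparse : ℕ → ℕ → List (List Bool)
short-sparse m μ = concatMap (λ l → sparse l μ) (upTo (suc m))

∈-short-sparse : ∀ v {m μ} → length v ≤ m → trues v ≤ μ → v ∈ short-sparse m μ
∈-short-sparse v {m} {μ} len few = ∈-concatMap (λ l → sparse l μ) (∈-upTo⁺ (s≤s len)) (∈-sparse v few)

length-triples : ∀ {A B C : Set} (xs : List A) (ys : List B) (zs : List C) → length (cartesianProduct xs (cartesianProduct ys zs)) ≡ length xs * (length ys * length zs)
length-triples xs ys zs = trans (length-cartesianProductWith _,_ xs (cartesianProduct ys zs)) (cong (length xs *_) (length-cartesianProductWith _,_ ys zs))

-- The weight enters as the w that solves the equation for `2 * sum H`, which avoids halving and
-- subtraction in ℕ.
Bad : (q p g : ℕ) → List ℕ → Set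
Bad q p g H = IsGapSetOfGenus g H × (∀ w → 2 * sum H ≡ 2 * w + g * (g + 1) → ¬ Close q p g w)

module Counting (q p : ℕ) (1≤q : 1 ≤ q) (1≤p : 1 ≤ p)
  (below : p * p ℕ.< p * q + q * q) (above : (2 + p) * q + q * q ℕ.< (2 + p) * (2 + p)) (δ : ℕ) where

  private
    P : ℕ
    P = 2 + p

  -- Here n and k are constants and g is of order n² u. By 400 q ≤ n the error 7 u + 6 e with e ≤ 64
  -- n u is at most g / q (7 + 6 * 64 = 391); the bound with 64 keeps the deviation margin below the
  -- size of the free word; 16 n² ≤ k yields the hypothesis 8 g ≤ k u of `summary`.
  module _ (n k : ℕ) (64m≤n : 64 * (P * P * (P + 2 * q)) ≤ n) (400q≤n : 400 * q ≤ n) (16nn≤k : 16 * (n * n) ≤ k)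
    (g u : ℕ) (n²u≤g : n * n * u ≤ g) (g≤2n²u : g ≤ 2 * (n * n) * u) (1≤u : 1 ≤ u) (p≤u : p ≤ u)
    (2L≤u : 2 * Code.L k g ≤ u) (const≤u : 4 * suc δ * (8 * (n * n)) ^ 5 ≤ u) where

    open Code k g

    private
      -- The gain `2 ^ j` must outweigh two sparse lists of 7 n u bits each and 8 u bits of smaller
      -- factors. `h₁` bounds the size of the free word.
      j h₁ : ℕ
      j  = 32 * (n * u)
      h₁ = g + 2 * u + 1

      open LargeDeviations q p P j 1≤q 1≤p (m≤n+m p 2) below above

      400≤n : 400 ≤ n
      400≤n = ≤-trans (scale 400 1≤q) 400q≤n

      1≤n : 1 ≤ n
      1≤n = ≤-trans (s≤s z≤n) 400≤n

      400nu≤g : 400 * (n * u) ≤ g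
      400nu≤g = ≤-trans (400≤n ⊠ ≤-refl {n * u}) (≤-trans (≤-reflexive (sym (*-assoc n n u))) n²u≤g)

      u≤nu : u ≤ n * u
      u≤nu = ≤-trans (≤-reflexive (sym (*-identityˡ u))) (1≤n ⊠ ≤-refl {u})

      400u≤g : 400 * u ≤ g
      400u≤g = ≤-trans (scale 400 u≤nu) 400nu≤g

      u≤g : u ≤ g
      u≤g = ≤-trans (m≤m+n u _) 400u≤g

      2≤g : 2 ≤ g
      2≤g = ≤-trans (≤-trans (s≤s (s≤s z≤n)) (scale 400 1≤u)) 400u≤g

      2≤k : 2 ≤ k
      2≤k = ≤-trans (≤-trans (s≤s (s≤s z≤n)) (scale 16 (1≤n ⊠ 1≤n))) 16nn≤k

      8g≤ku : 8 * g ≤ k * u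
      8g≤ku = ≤-trans (≤-trans (scale 8 g≤2n²u) (≤-reflexive (lem (n * n) u))) (16nn≤k ⊠ ≤-refl {u})
        where
        lem : ∀ m u → 8 * (2 * m * u) ≡ 16 * m * u
        lem = solve-∀

      short : List (List Bool)
      short = short-sparse (3 * g) u

      few-words typical-but-deviating free-words : List (List Bool)
      few-words = concatMap words (upTo (suc (h₁ ∸ 2 * j)))
      typical-but-deviating = concatMap deviating (upTo (suc h₁))
      free-words = few-words ++ typical-but-deviating

      codes : List (List Bool × List Bool × List Bool)
      codes = cartesianProduct short (cartesianProduct short free-words)

      module _ {H : List ℕ} (isGap : IsGapSetOfGenus g H) (far : ∀ w → 2 * sum H ≡ 2 * w + g * (g + 1) → ¬ Close q p g w) where
        open Summary (summary 2≤k 2≤g 8g≤ku 2L≤u u≤g isGap)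

        private
          v : List Bool
          v = freeOf H
          E : ℕ
          E = 7 * u + 6 * e

        typical : e ≤ 2 * j → Balanced q p P margin 0 0 v → ⊥
        typical e≤ bal = far w sum≡ (close-to-word {q} {p} {g} {w} {inversions v} {size v} {E} 1≤q qE≤g h≤ g≤ w-lower w-upper
            (word-inversions-≤ q p margin 1≤q v bal margin≤h) (word-inversions-≥ q p margin 1≤q v bal margin≤h p≤h))
          where
          qE≤g : q * E ≤ g
          qE≤g = ≤-trans (cert (9 * (q * (n * u))) (scale (6 * q) e≤ ⊞ scale (7 * q) u≤nu) (lem q u e (n * u)))
            (≤-trans (≤-reflexive (lem₁ q (n * u))) (≤-trans (400q≤n ⊠ ≤-refl {n * u}) (≤-trans (≤-reflexive (sym (*-assoc n n u))) n²u≤g)))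
            where
            lem : ∀ q u e z → q * (7 * u + 6 * e) + (6 * q * (2 * (32 * z)) + 7 * q * z) + 9 * (q * z) ≡ 400 * (q * z) + (6 * q * e + 7 * q * u)
            lem = solve-∀
            lem₁ : ∀ q z → 400 * (q * z) ≡ 400 * q * z
            lem₁ = solve-∀
          h≤ : size v ≤ g + E
          h≤ = cert (4 * u + 7 * e) (size-upper ⊞ 1≤u) (lem (size v) e g u)
            where
            lem : ∀ s e g u → s + (g + 2 * u + 1 + u) + (4 * u + 7 * e) ≡ g + (7 * u + 6 * e) + (s + e + 1)
            lem = solve-∀
          g≤ : g ≤ size v + E
          g≤ = cert (5 * u + 4 * e) size-lower (lem g (size v) e u)
            where
            lem : ∀ g s e u → g + (s + 2 * e + 2 * u) + (5 * u + 4 * e) ≡ s + (7 * u + 6 * e) + g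
            lem = solve-∀
          half : g ≤ 2 * size v
          half = cert 0 (scale 2 size-lower ⊞ scale 4 e≤ ⊞ scale 4 u≤nu ⊞ 400nu≤g ⊞ z≤n {140 * (n * u)}) (lem g (size v) e u (n * u))
            where
            lem : ∀ g s e u z → g + (2 * (s + 2 * e + 2 * u) + 4 * (2 * (32 * z)) + 4 * z + g + 140 * z) + 0 ≡ 2 * s + (2 * g + 4 * e + 4 * u + 400 * z + 0)
            lem = solve-∀
          margin≤h : margin ≤ size v
          margin≤h = *-cancelʳ-≤′ 2 (s≤s z≤n) (≤-trans (≤-reflexive (lem P q (n * u))) (≤-trans (64m≤n ⊠ ≤-refl {n * u})
            (≤-trans (≤-reflexive (sym (*-assoc n n u))) (≤-trans n²u≤g (≤-trans half (≤-reflexive (*-comm 2 (size v))))))))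
            where
            lem : ∀ P q z → P * P * (32 * z) * (P + 2 * q) * 2 ≡ 64 * (P * P * (P + 2 * q)) * z
            lem = solve-∀
          p≤h : p ≤ size v
          p≤h = *-cancelʳ-≤′ 2 (s≤s z≤n) (cert (398 * u) (scale 2 p≤u ⊞ 400u≤g ⊞ half) (lem p u g (size v)))
            where
            lem : ∀ p u g s → p * 2 + (2 * u + g + 2 * s) + 398 * u ≡ s * 2 + (2 * p + 400 * u + g)
            lem = solve-∀

        -- If e ≥ 2 j, the free word has size at most h₁ - 2 j, and every two units of size are
        -- worth a factor 2. If e ≤ 2 j, some prefix deviates, since a balanced word would make H
        -- close.
        free∈ : v ∈ free-words
        free∈ with ≤-total (2 * j) e
        ... | inj₁ 2j≤e = ∈-++⁺ˡ (∈-concatMap words (∈-upTo⁺ (s≤s (m+n≤o⇒m≤o∸n (size v) (≤-trans (+-monoʳ-≤ (size v) 2j≤e) size-upper)))) (∈-words v))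
        ... | inj₂ e≤2j with balanced-or-deviates q p P margin 0 0 v
        ...   | inj₂ bal = ⊥-elim (typical e≤2j bal)
        ...   | inj₁ (v₁ , v₂ , eq , dev) = ∈-++⁺ʳ few-words (∈-concatMap deviating (∈-upTo⁺ (s≤s (≤-trans (m≤m+n (size v) e) size-upper)))
                  (subst (λ z → z ∈ deviating (size z)) (sym eq) (∈-deviating v₁ v₂ (subst₂′ (+-identityʳ (trues v₁)) (+-identityʳ (falses v₁)) dev))))
          where
          subst₂′ : ∀ {b a b′ a′} → b ≡ b′ → a ≡ a′ → Deviates q p P margin b a → Deviates q p P margin b′ a′
          subst₂′ refl refl d = d

        code∈ : code H ∈ codes
        code∈ = ∈-cartesianProduct⁺ (∈-short-sparse (prefix (indicator H)) prefix-length prefix-sparse)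
          (∈-cartesianProduct⁺ (∈-short-sparse (heavyOf H) heavy-length heavy-sparse) free∈)

      length-short : length short ≤ suc (3 * g) * 2 ^ (7 * (n * u))
      length-short = ≤-trans (≤-reflexive (sym (*-identityˡ _))) (≤-trans (go (upTo (suc (3 * g))) (λ l∈ → ≤-pred (∈-upTo⁻ l∈)))
          (≤-reflexive (cong (_* 2 ^ (7 * (n * u))) (length-upTo (suc (3 * g))))))
        where
        lem : ∀ n u → 3 * (2 * (n * n) * u) ≡ n * (6 * (n * u))
        lem = solve-∀
        lem′ : ∀ z → 6 * z + z ≡ 7 * z
        lem′ = solve-∀
        go : ∀ ls → (∀ {l} → l ∈ ls → l ≤ 3 * g) → 1 * length (concatMap (λ l → sparse l u) ls) ≤ length ls * 2 ^ (7 * (n * u))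
        go []       _ = z≤n
        go (l ∷ ls) h = ≤-trans (≤-reflexive (trans (*-identityˡ _) (length-++ (sparse l u))))
          ((≤-trans (length-sparse-2^ n (6 * (n * u)) l u 1≤n (≤-trans (h (here refl)) (≤-trans (scale 3 g≤2n²u) (≤-reflexive (lem n u))))) (≤-reflexive (cong (2 ^_) (lem′ (n * u)))))
           ⊞ ≤-trans (≤-reflexive (sym (*-identityˡ _))) (go ls (h ∘ there)))

      length-few : 2 ^ j * length few-words ≤ suc h₁ * fib h₁
      length-few = ≤-trans (go (upTo (suc (h₁ ∸ 2 * j))) (λ l∈ → ≤-pred (∈-upTo⁻ l∈)))
          (≤-trans (≤-reflexive (cong (_* fib h₁) (length-upTo (suc (h₁ ∸ 2 * j))))) (s≤s (m∸n≤m h₁ (2 * j)) ⊠ ≤-refl {fib h₁}))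
        where
        2j≤h₁ : 2 * j ≤ h₁
        2j≤h₁ = cert (336 * (n * u) + 2 * u + 1) 400nu≤g (lem (n * u) g u)
          where
          lem : ∀ z g u → 2 * (32 * z) + g + (336 * z + 2 * u + 1) ≡ g + 2 * u + 1 + 400 * z
          lem = solve-∀
        go : ∀ ls → (∀ {l} → l ∈ ls → l ≤ h₁ ∸ 2 * j) → 2 ^ j * length (concatMap words ls) ≤ length ls * fib h₁
        go []       _ = ≤-reflexive (*-zeroʳ (2 ^ j))
        go (l ∷ ls) h = ≤-trans (≤-reflexive (trans (cong (2 ^ j *_) (length-++ (words l))) (*-distribˡ-+ (2 ^ j) _ _)))
          (≤-trans (≤-trans (≤-reflexive (cong (2 ^ j *_) (length-words l))) (2^*fib≤fib j l)) (fib-mono (≤-trans (+-monoʳ-≤ (2 * j) (h (here refl))) (≤-reflexive (m+[n∸m]≡n 2j≤h₁)))) ⊞ go ls (h ∘ there))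

      length-typical : 2 ^ j * length typical-but-deviating ≤ suc h₁ * (suc h₁ * (suc h₁ * fib h₁))
      length-typical = ≤-trans (go (upTo (suc h₁)) (λ l∈ → ≤-pred (∈-upTo⁻ l∈))) (≤-reflexive (cong (_* (suc h₁ * (suc h₁ * fib h₁))) (length-upTo (suc h₁))))
        where
        go : ∀ ls → (∀ {l} → l ∈ ls → l ≤ h₁) → 2 ^ j * length (concatMap deviating ls) ≤ length ls * (suc h₁ * (suc h₁ * fib h₁))
        go []       _ = ≤-reflexive (*-zeroʳ (2 ^ j))
        go (l ∷ ls) h = ≤-trans (≤-reflexive (trans (cong (2 ^ j *_) (length-++ (deviating l))) (*-distribˡ-+ (2 ^ j) _ _)))
          (≤-trans (length-deviating l) (s≤s (h (here refl)) ⊠ (s≤s (h (here refl)) ⊠ fib-mono (h (here refl)))) ⊞ go ls (h ∘ there))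

      length-free : 2 ^ j * length free-words ≤ 2 * (suc h₁ * suc h₁ * suc h₁) * fib h₁
      length-free = ≤-trans (≤-reflexive (trans (cong (2 ^ j *_) (length-++ few-words)) (*-distribˡ-+ (2 ^ j) _ _)))
        (≤-trans (length-few ⊞ length-typical) (≤-trans (+-monoˡ-≤ _ (≤-trans (≤-reflexive (lem₁ (suc h₁) (fib h₁))) (scale (suc h₁) (1≤x ⊠ (1≤x ⊠ ≤-refl {fib h₁}))))) (≤-reflexive (lem₂ (suc h₁) (fib h₁)))))
        where
        1≤x : 1 ≤ suc h₁
        1≤x = s≤s z≤n
        lem₁ : ∀ x f → x * f ≡ x * (1 * (1 * f))
        lem₁ = solve-∀
        lem₂ : ∀ x f → x * (x * (x * f)) + x * (x * (x * f)) ≡ 2 * (x * x * x) * f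
        lem₂ = solve-∀

      -- Each of the five factors linear in g is at most 8 n² u. The constants are at most u by
      -- `const≤u`, and u < 2^u, so the exponent is u + 5 u.
      polynomial : suc δ * (suc (3 * g) * suc (3 * g)) * (2 * (suc h₁ * suc h₁ * suc h₁)) * 2 ≤ 2 ^ (6 * u)
      polynomial = ≤-trans (≤-reflexive (lem₁ (suc δ) (suc (3 * g)) (suc h₁)))
        (≤-trans (scale (4 * suc δ) (G≤ ⊠ G≤ ⊠ h≤ ⊠ h≤ ⊠ h≤))
        (≤-trans (≤-reflexive (lem₂ (4 * suc δ) (8 * (n * n)) u))
        (≤-trans (≤-trans const≤u (<⇒≤ (n<2^n u)) ⊠ ^-monoˡ-≤ 5 (<⇒≤ (n<2^n u)))
        (≤-reflexive (trans (cong (2 ^ u *_) (trans (^-*-assoc 2 u 5) (cong (2 ^_) (*-comm u 5)))) (sym (^-distribˡ-+-* 2 u (5 * u))))))))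
        where
        lem₁ : ∀ d x y → d * (x * x) * (2 * (y * y * y)) * 2 ≡ 4 * d * (x * x * y * y * y)
        lem₁ = solve-∀
        lem₂ : ∀ c m u → c * (m * u * (m * u) * (m * u) * (m * u) * (m * u)) ≡ c * (m * (m * (m * (m * (m * 1))))) * (u * (u * (u * (u * (u * 1)))))
        lem₂ = solve-∀
        1≤g : 1 ≤ g
        1≤g = ≤-trans (s≤s z≤n) 2≤g
        G≤ : suc (3 * g) ≤ 8 * (n * n) * u
        G≤ = cert 0 (1≤g ⊞ scale 4 g≤2n²u) (lem g (n * n) u)
          where
          lem : ∀ g m u → 1 + 3 * g + (g + 4 * (2 * m * u)) + 0 ≡ 8 * m * u + (1 + 4 * g)
          lem = solve-∀
        h≤ : suc h₁ ≤ 8 * (n * n) * u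
        h≤ = cert (398 * u) (2≤g ⊞ scale 4 g≤2n²u ⊞ 400u≤g ⊞ z≤n {g}) (lem g (n * n) u)
          where
          lem : ∀ g m u → 1 + (g + 2 * u + 1) + (g + 4 * (2 * m * u) + g + g) + 398 * u ≡ 8 * m * u + (2 + 4 * g + 400 * u + 0)
          lem = solve-∀

    few-bad : ∀ xs → Unique xs → (∀ {H} → H ∈ xs → Bad q p g H) → suc δ * length xs ≤ fib g
    few-bad xs unique bad = *-cancelʳ-≤′ (2 ^ j) (^-≥1 j (s≤s z≤n))
        (≤-trans (scale (suc δ) (length-injection code xs codes unique (λ H∈ → code∈ (proj₁ (bad H∈)) (proj₂ (bad H∈)))
                   (λ H∈ H∈′ → code-injective (proj₁ (bad H∈)) (proj₁ (bad H∈′)))) ⊠ ≤-refl {2 ^ j})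
        (≤-trans (≤-reflexive (trans (cong (λ c → suc δ * c * 2 ^ j) (length-triples short short free-words)) (lem₁ (suc δ) (length short) (length free-words) (2 ^ j))))
        (≤-trans (scale (suc δ) (length-short ⊠ length-short) ⊠ (≤-trans length-free (scale (2 * (suc h₁ * suc h₁ * suc h₁)) fib-h₁)))
        (≤-trans (≤-reflexive (lem₂ (suc δ) (suc (3 * g)) (2 ^ (7 * (n * u))) (2 * (suc h₁ * suc h₁ * suc h₁)) (2 ^ (2 * u)) (fib g)))
        (≤-trans (polynomial ⊠ ≤-refl {2 ^ (7 * (n * u)) * 2 ^ (7 * (n * u)) * 2 ^ (2 * u)} ⊠ ≤-refl {fib g})
        (≤-trans (≤-reflexive (cong (_* fib g) powers)) (≤-trans (^-monoʳ-≤ 2 exponent ⊠ ≤-refl {fib g}) (≤-reflexive (*-comm (2 ^ j) (fib g))))))))))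
      where
      fib-h₁ : fib h₁ ≤ 2 * 2 ^ (2 * u) * fib g
      fib-h₁ = ≤-trans (≤-reflexive (cong fib (lem g u))) (fib≤2^*fib (suc (2 * u)) g)
        where
        lem : ∀ g u → g + 2 * u + 1 ≡ 1 + 2 * u + g
        lem = solve-∀
      lem₁ : ∀ d s f x → d * (s * (s * f)) * x ≡ d * (s * s) * (x * f)
      lem₁ = solve-∀
      lem₂ : ∀ d G s h x f → d * (G * s * (G * s)) * (h * (2 * x * f)) ≡ d * (G * G) * h * 2 * (s * s * x) * f
      lem₂ = solve-∀
      powers : 2 ^ (6 * u) * (2 ^ (7 * (n * u)) * 2 ^ (7 * (n * u)) * 2 ^ (2 * u)) ≡ 2 ^ (6 * u + (7 * (n * u) + 7 * (n * u) + 2 * u))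
      powers = sym (trans (^-distribˡ-+-* 2 (6 * u) _) (cong (2 ^ (6 * u) *_) (trans (^-distribˡ-+-* 2 (7 * (n * u) + 7 * (n * u)) (2 * u)) (cong (_* 2 ^ (2 * u)) (^-distribˡ-+-* 2 (7 * (n * u)) (7 * (n * u)))))))
      exponent : 6 * u + (7 * (n * u) + 7 * (n * u) + 2 * u) ≤ 32 * (n * u)
      exponent = cert (10 * (n * u)) (scale 8 u≤nu) (lem u (n * u))
        where
        lem : ∀ u z → 6 * u + (7 * z + 7 * z + 2 * u) + 8 * z + 10 * z ≡ 32 * z + 8 * u
        lem = solve-∀

  eventually-few-bad : ∃ λ G → ∀ g → G ≤ g → ∀ xs → Unique xs → (∀ {H} → H ∈ xs → Bad q p g H) → suc δ * length xs ≤ fib g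
  -- n is the sum of its two lower bounds and k is 16 n²; both are fixed before g, and u is g / n²
  -- rounded down.
  eventually-few-bad = main _ _ (m≤m+n (64 * (P * P * (P + 2 * q))) (400 * q)) (m≤n+m (400 * q) (64 * (P * P * (P + 2 * q)))) ≤-refl
    where
    quotient : ∀ t m → 1 ≤ t → 1 ≤ m → ∀ g → m * t ≤ g → ∃ λ u → m * u ≤ g × g ≤ 2 * m * u × t ≤ u
    quotient t m@(suc _) 1≤t _ g h = u , mu≤g , g≤2mu , t≤u
      where
      u : ℕ
      u = g / m
      g≡ : g ≡ g % m + u * m
      g≡ = m≡m%n+[m/n]*n g m
      mu≤g : m * u ≤ g
      mu≤g = ≤-trans (≤-reflexive (*-comm m u)) (≤-trans (m≤n+m (u * m) (g % m)) (≤-reflexive (sym g≡)))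
      g< : g ℕ.< suc u * m
      g< = ≤-trans (s≤s (≤-reflexive g≡)) (+-monoˡ-< (u * m) (m%n<n g m))
      t≤u : t ≤ u
      t≤u = ≤-pred (*-cancelʳ-< m t (suc u) (≤-trans (s≤s (≤-trans (≤-reflexive (*-comm t m)) h)) g<))
      g≤2mu : g ≤ 2 * m * u
      g≤2mu = ≤-trans (<⇒≤ g<) (cert 0 (≤-trans 1≤t t≤u ⊠ ≤-refl {m}) (lem u m))
        where
        lem : ∀ u m → (1 + u) * m + u * m + 0 ≡ 2 * m * u + 1 * m
        lem = solve-∀
    main : ∀ n k → 64 * (P * P * (P + 2 * q)) ≤ n → 400 * q ≤ n → 16 * (n * n) ≤ k →
      ∃ λ G → ∀ g → G ≤ g → ∀ xs → Unique xs → (∀ {H} → H ∈ xs → Bad q p g H) → suc δ * length xs ≤ fib g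
    -- `L` depends on k alone; the genus 0 is a dummy argument.
    main n k 64m≤n 400q≤n 16nn≤k = n * n * (1 + p + 2 * Code.L k 0 + 4 * suc δ * (8 * (n * n)) ^ 5) , bound _ _ refl refl
      where
      1≤n : 1 ≤ n
      1≤n = ≤-trans (≤-trans 1≤q (m≤m+n q _)) 400q≤n
      bound : ∀ l c → l ≡ 2 * Code.L k 0 → c ≡ 4 * suc δ * (8 * (n * n)) ^ 5 →
        ∀ g → n * n * (1 + p + l + c) ≤ g → ∀ xs → Unique xs → (∀ {H} → H ∈ xs → Bad q p g H) → suc δ * length xs ≤ fib g
      bound l c l≡ c≡ g h with quotient (1 + p + l + c) (n * n) (s≤s z≤n) (1≤n ⊠ 1≤n) g h
      ... | u , lower , upper , large = few-bad n k 64m≤n 400q≤n 16nn≤k g u lower upper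
              (≤-trans (s≤s z≤n) large) (≤-trans (≤-trans (n≤1+n p) (≤-trans (m≤m+n (1 + p) l) (m≤m+n _ c))) large)
              (≤-trans (≤-reflexive (sym l≡)) (≤-trans (≤-trans (m≤n+m l (1 + p)) (m≤m+n _ c)) large))
              (≤-trans (≤-reflexive (sym c≡)) (≤-trans (m≤n+m c (1 + p + l)) large))

-- Enumerating the semigroups of genus g

positions-< : ∀ a v → All (ℕ._< a + length v) (positions a v)
positions-< a []          = []
positions-< a (true  ∷ v) = All.map (λ h → ≤-trans h (≤-reflexive (sym (+-suc a (length v))))) (positions-< (suc a) v)
positions-< a (false ∷ v) = m<m+n a (s≤s z≤n) ∷ All.map (λ h → ≤-trans h (≤-reflexive (sym (+-suc a (length v))))) (positions-< (suc a) v)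

∉-positions-suc : ∀ a v → a ∉ positions (suc a) v
∉-positions-suc a v a∈ = <-irrefl refl (All.lookup (positions-≥ (suc a) v) a∈)

positions-injective : ∀ a v w → length v ≡ length w → positions a v ≡ positions a w → v ≡ w
positions-injective a []          []          _   _ = refl
positions-injective a (true  ∷ v) (true  ∷ w) len e = cong (true ∷_) (positions-injective (suc a) v w (cong pred len) e)
positions-injective a (false ∷ v) (false ∷ w) len e = cong (false ∷_) (positions-injective (suc a) v w (cong pred len) (∷-injectiveʳ e))
positions-injective a (true  ∷ v) (false ∷ w) len e = ⊥-elim (∉-positions-suc a v (subst (a ∈_) (sym e) (here refl)))
positions-injective a (false ∷ v) (true  ∷ w) len e = ⊥-elim (∉-positions-suc a w (subst (a ∈_) e (here refl)))

-- The semigroup with multiplicity m = |v| + 1, containing [2m, ∞), whose elements in (m, 2m) are given by v.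
wordBits : List Bool → List Bool
wordBits v = replicate (length v) false ++ true ∷ v

wordGaps : List Bool → List ℕ
wordGaps v = positions 1 (wordBits v)

-- The initial run of gaps ends just before the multiplicity and reveals the length of the word; the
-- later gaps then reveal its bits.
wordGaps-injective : ∀ {v w} → wordGaps v ≡ wordGaps w → v ≡ w
wordGaps-injective {v} {w} e with go 1 (length v) (length w) e
  where
  go : ∀ a m n → positions a (replicate m false ++ true ∷ v) ≡ positions a (replicate n false ++ true ∷ w) →
    m ≡ n × positions (suc (m + a)) v ≡ positions (suc (m + a)) w
  go a zero    zero    e = refl , e
  go a zero    (suc n) e = ⊥-elim (∉-positions-suc a v (subst (a ∈_) (sym e) (here refl)))
  go a (suc m) zero    e = ⊥-elim (∉-positions-suc a w (subst (a ∈_) e (here refl)))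
  go a (suc m) (suc n) e with go (suc a) m n (∷-injectiveʳ e)
  ... | refl , e′ = refl , subst (λ k → positions (suc k) v ≡ positions (suc k) w) (+-suc m a) e′
... | len , e′ = positions-injective (suc (length v + 1)) v w len e′

-- Nonzero elements are at least m and gaps are below 2 m, which gives closure. The genus is (m - 1)
-- + `falses v`, the size of v.
wordGaps-isGapSet : ∀ v → IsGapSetOfGenus (size v) (wordGaps v)
wordGaps-isGapSet v = record
  { strictlySorted = AllPairs⇒Linked (positions-sorted 1 (wordBits v))
  ; genus          = trans (length-positions 1 (wordBits v)) (trans (falses-++ (replicate (length v) false) (true ∷ v)) (trans (cong₂ _+_ (falses-replicate (length v)) refl) sizes))
  ; zero∈S         = λ 0∈ → <-irrefl refl (All.lookup (positions-≥ 1 (wordBits v)) 0∈)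
  ; closed         = closed
  }
  where
  m : ℕ
  m = suc (length v)
  falses-replicate : ∀ n → falses (replicate n false) ≡ n
  falses-replicate zero    = refl
  falses-replicate (suc n) = cong suc (falses-replicate n)
  sizes : length v + falses v ≡ size v
  sizes = trans (cong (_+ falses v) (sym (trues+falses v))) (trans (lem (trues v) (falses v)) (sym (size≡ v)))
    where
    lem : ∀ t f → t + f + f ≡ t + 2 * f
    lem = solve-∀
  below : ∀ {x} → x ∈ wordGaps v → x ℕ.< m + m
  below x∈ = ≤-trans (All.lookup (positions-< 1 (wordBits v)) x∈) (≤-reflexive (cong suc (trans (length-++ (replicate (length v) false)) (cong (_+ suc (length v)) (length-replicate (length v))))))
  initial : ∀ n a i → a ≤ i → i ℕ.< n + a → i ∈ positions a (replicate n false ++ true ∷ v)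
  initial zero    a i a≤ i< = ⊥-elim (<⇒≱ i< a≤)
  initial (suc n) a i a≤ i< with m≤n⇒m<n∨m≡n a≤
  ... | inj₁ a<i  = there (initial n (suc a) i a<i (≤-trans i< (≤-reflexive (sym (+-suc n a)))))
  ... | inj₂ refl = here refl
  large : ∀ x → x ∉ wordGaps v → 1 ≤ x → m ≤ x
  large x x∉ 1≤x with m ℕₚ.≤? x
  ... | yes m≤x = m≤x
  ... | no  m≰x = ⊥-elim (x∉ (initial (length v) 1 x 1≤x (≤-trans (≰⇒> m≰x) (≤-reflexive (+-comm 1 (length v))))))
  closed : ∀ a b → a ∉ wordGaps v → b ∉ wordGaps v → a + b ∉ wordGaps v
  closed zero    b       a∉ b∉ = b∉
  closed (suc a) zero    a∉ b∉ = subst (_∉ wordGaps v) (sym (+-identityʳ (suc a))) a∉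
  closed (suc a) (suc b) a∉ b∉ x∈ = <⇒≱ (below x∈) (large (suc a) a∉ (s≤s z≤n) ⊞ large (suc b) b∉ (s≤s z≤n))

fib≤enumeration : ∀ {g L} → Enumerates g L → fib g ≤ length L
fib≤enumeration {g} {L} (_ , _ , complete) = ≤-trans (≤-reflexive (sym (length-words g)))
  (length-injection wordGaps (words g) L (words-unique g) (λ {v} v∈ → complete (wordGaps v) (subst (λ k → IsGapSetOfGenus k (wordGaps v)) (size-words g v∈) (wordGaps-isGapSet v)))
    (λ _ _ → wordGaps-injective))

-- Closure quantifies over all of ℕ. It is decided through its contrapositive: for every gap x and
-- every a ≤ x, one of a and x - a is a gap.
isGapSet? : ∀ g H → Dec (IsGapSetOfGenus g H)
isGapSet? g H = map′ (λ { (s , l , z , c) → record { strictlySorted = s ; genus = l ; zero∈S = z ; closed = closed-sound c } })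
    (λ i → let open IsGapSetOfGenus i in strictlySorted , genus , zero∈S , closed-complete closed)
    (linked? ℕ._<?_ H ×-dec (length H ℕ.≟ g) ×-dec ¬? (0 ∈? H) ×-dec All.all? (λ x → All.all? (λ a → (a ∈? H) ⊎-dec ((x ∸ a) ∈? H)) (upTo (suc x))) H)
  where
  Closed : Set
  Closed = All (λ x → All (λ a → a ∈ H ⊎ x ∸ a ∈ H) (upTo (suc x))) H
  closed-sound : Closed → ∀ a b → a ∉ H → b ∉ H → a + b ∉ H
  closed-sound c a b a∉ b∉ a+b∈ with All.lookup (All.lookup c a+b∈) (∈-upTo⁺ (s≤s (m≤m+n a b)))
  ... | inj₁ a∈ = a∉ a∈
  ... | inj₂ b∈ = b∉ (subst (_∈ H) (m+n∸m≡n a b) b∈)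
  closed-complete : (∀ a b → a ∉ H → b ∉ H → a + b ∉ H) → Closed
  closed-complete closed = All.tabulate (λ {x} x∈ → All.tabulate (λ {a} a∈ → split x a x∈ (≤-pred (∈-upTo⁻ a∈))))
    where
    split : ∀ x a → x ∈ H → a ≤ x → a ∈ H ⊎ x ∸ a ∈ H
    split x a x∈ a≤ with a ∈? H | (x ∸ a) ∈? H
    ... | yes p | _     = inj₁ p
    ... | no  _ | yes p = inj₂ p
    ... | no  p | no  r = ⊥-elim (closed a (x ∸ a) p r (subst (_∈ H) (sym (m+[n∸m]≡n a≤)) x∈))

enumeration : ∀ g → Σ (List (List ℕ)) (Enumerates g)
enumeration g = deduplicate (≡-dec ℕ._≟_) (filter (isGapSet? g) candidates) , deduplicate-! (≡-dec ℕ._≟_) _ ,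
    All.tabulate (λ H∈ → proj₂ (∈-filter⁻ (isGapSet? g) {xs = candidates} (∈-deduplicate⁻ (≡-dec ℕ._≟_) (filter (isGapSet? g) candidates) H∈))) ,
    λ H isGap → ∈-deduplicate⁺ (≡-dec ℕ._≟_) (∈-filter⁺ (isGapSet? g) (candidate H isGap) isGap)
  where
  candidates : List (List ℕ)
  -- With as many trues allowed as there are positions, `sparse` lists all words of length 2 g.
  candidates = map (positions 1) (sparse (2 * g) (2 * g))
  candidate : ∀ H → IsGapSetOfGenus g H → H ∈ candidates
  candidate H isGap = subst (_∈ candidates) (GapSet.positions-χ isGap (2 * g) (n≤1+n (2 * g)))
    (∈-map⁺ (positions 1) (subst (λ k → bits (indicator H) 1 (2 * g) ∈ sparse k (2 * g)) len (∈-sparse _ (≤-trans (m≤m+n _ _) (≤-reflexive (trans (trues+falses (bits (indicator H) 1 (2 * g))) len))))))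
    where
    len : length (bits (indicator H) 1 (2 * g)) ≡ 2 * g
    len = length-bits (indicator H) 1 (2 * g)

-- From natural numbers to the rational statement

ℚ-ring : AlmostCommutativeRing _ _
ℚ-ring = fromCommutativeSemiring (CommutativeRing.commutativeSemiring ℚₚ.+-*-commutativeRing) (λ _ → nothing)

toℚᵘ-ℕ→ℚ : ∀ n → ℚ.toℚᵘ (ℕ→ℚ n) ℚᵘ.≃ ℚᵘ.mkℚᵘ (ℤ.+ n) 0
toℚᵘ-ℕ→ℚ n = ℚₚ.toℚᵘ-fromℚᵘ (ℚᵘ.mkℚᵘ (ℤ.+ n) 0)

ℕ→ℚ-+ : ∀ m n → ℕ→ℚ (m + n) ≡ ℕ→ℚ m ℚ.+ ℕ→ℚ n
ℕ→ℚ-+ m n = ℚₚ.toℚᵘ-injective (ℚᵘₚ.≃-trans (toℚᵘ-ℕ→ℚ (m + n)) (ℚᵘₚ.≃-trans (ℚᵘ.*≡* eq)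
    (ℚᵘₚ.≃-sym (ℚᵘₚ.≃-trans (ℚₚ.toℚᵘ-homo-+ (ℕ→ℚ m) (ℕ→ℚ n)) (ℚᵘₚ.+-cong (toℚᵘ-ℕ→ℚ m) (toℚᵘ-ℕ→ℚ n))))))
  where
  eq : ℤ.+ (m + n) ℤ.* ℤ.+ 1 ≡ (ℤ.+ m ℤ.* ℤ.+ 1 ℤ.+ ℤ.+ n ℤ.* ℤ.+ 1) ℤ.* ℤ.+ 1
  eq = cong (ℤ._* ℤ.+ 1) (trans (ℤₚ.pos-+ m n) (cong₂ ℤ._+_ (sym (ℤₚ.*-identityʳ (ℤ.+ m))) (sym (ℤₚ.*-identityʳ (ℤ.+ n)))))

ℕ→ℚ-* : ∀ m n → ℕ→ℚ (m * n) ≡ ℕ→ℚ m ℚ.* ℕ→ℚ n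
ℕ→ℚ-* m n = ℚₚ.toℚᵘ-injective (ℚᵘₚ.≃-trans (toℚᵘ-ℕ→ℚ (m * n)) (ℚᵘₚ.≃-trans (ℚᵘ.*≡* (cong (ℤ._* ℤ.+ 1) (ℤₚ.pos-* m n)))
    (ℚᵘₚ.≃-sym (ℚᵘₚ.≃-trans (ℚₚ.toℚᵘ-homo-* (ℕ→ℚ m) (ℕ→ℚ n)) (ℚᵘₚ.*-cong (toℚᵘ-ℕ→ℚ m) (toℚᵘ-ℕ→ℚ n))))))

ℕ→ℚ-mono-≤ : ∀ {m n} → m ≤ n → ℕ→ℚ m ℚ.≤ ℕ→ℚ n
ℕ→ℚ-mono-≤ {m} {n} h = ℚₚ.toℚᵘ-cancel-≤ (ℚᵘₚ.≤-respˡ-≃ (ℚᵘₚ.≃-sym (toℚᵘ-ℕ→ℚ m)) (ℚᵘₚ.≤-respʳ-≃ (ℚᵘₚ.≃-sym (toℚᵘ-ℕ→ℚ n))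
  (ℚᵘ.*≤* (ℤₚ.*-monoʳ-≤-nonNeg (ℤ.+ 1) (ℤ.+≤+ h)))))

ℕ→ℚ-mono-< : ∀ {m n} → m ℕ.< n → ℕ→ℚ m < ℕ→ℚ n
ℕ→ℚ-mono-< {m} {n} h = ℚₚ.toℚᵘ-cancel-< (ℚᵘₚ.<-respˡ-≃ (ℚᵘₚ.≃-sym (toℚᵘ-ℕ→ℚ m)) (ℚᵘₚ.<-respʳ-≃ (ℚᵘₚ.≃-sym (toℚᵘ-ℕ→ℚ n))
  (ℚᵘ.*<* (ℤₚ.*-monoʳ-<-pos (ℤ.+ 1) (ℤ.+<+ h)))))

ℕ→ℚ-nonNeg : ∀ n → ℚ.NonNegative (ℕ→ℚ n)
ℕ→ℚ-nonNeg n = ℚ.nonNegative (ℕ→ℚ-mono-≤ {0} {n} z≤n)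

1/n*n : ∀ n → (ℤ.+ 1) ℚ./ suc n ℚ.* ℕ→ℚ (suc n) ≡ 1ℚ
1/n*n n = ℚₚ.toℚᵘ-injective (ℚᵘₚ.≃-trans (ℚₚ.toℚᵘ-homo-* ((ℤ.+ 1) ℚ./ suc n) (ℕ→ℚ (suc n)))
  (ℚᵘₚ.≃-trans (ℚᵘₚ.*-cong (ℚₚ.toℚᵘ-fromℚᵘ (ℚᵘ.mkℚᵘ (ℤ.+ 1) n)) (toℚᵘ-ℕ→ℚ (suc n)))
  (ℚᵘ.*≡* (trans (ℤₚ.*-identityʳ (ℤ.+ 1 ℤ.* ℤ.+ suc n)) (cong (λ k → ℤ.+ 1 ℤ.* ℤ.+ suc k) (sym (*-identityʳ n)))))))

divℕ-* : ∀ y {n} → 1 ≤ n → divℕ y n ℚ.* ℕ→ℚ n ≡ y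
divℕ-* y {suc n} _ = trans (ℚₚ.*-assoc y _ _) (trans (cong (y ℚ.*_) (1/n*n n)) (ℚₚ.*-identityʳ y))

-- A positive rational is at least 1 over its denominator.
archimedean : ∀ ε → 0ℚ < ε → ∃ λ E → 1 ≤ E × 1ℚ ℚ.≤ ε ℚ.* ℕ→ℚ E
archimedean ε@(ℚ.mkℚ (ℤ.+ zero) d c) (ℚ.*<* (ℤ.+<+ ()))
archimedean ε@(ℚ.mkℚ (ℤ.+ suc n) d c) _ = suc d , s≤s z≤n , ℚₚ.toℚᵘ-cancel-≤ (ℚᵘₚ.≤-respʳ-≃ (ℚᵘₚ.≃-sym (ℚᵘₚ.≃-trans (ℚₚ.toℚᵘ-homo-* ε (ℕ→ℚ (suc d))) (ℚᵘₚ.*-cong (ℚᵘₚ.≃-refl {ℚ.toℚᵘ ε}) (toℚᵘ-ℕ→ℚ (suc d)))))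
    (ℚᵘ.*≤* (ℤ.+≤+ (cert (n * suc d) (≤-refl {0}) (lem n d)))))
  where
  lem : ∀ n d → 1 * ((1 + d) * 1) + 0 + n * (1 + d) ≡ (1 + n) * (1 + d) * 1 + 0
  lem = solve-∀
archimedean ε@(ℚ.mkℚ (ℤ.-[1+ n ]) d c) (ℚ.*<* ())

belowC : ∀ z {A B} → 1 ≤ B → t z ℚ.* ℕ→ℚ B ℚ.≤ ℕ→ℚ A → A * A ℕ.< 5 * (B * B) → BelowC z
belowC z {A} {B} 1≤B h sq with 0ℚ ℚₚ.≤? t z
... | no  neg = inj₁ (ℚₚ.≰⇒> neg)
... | yes nn  = inj₂ (nn , ℚₚ.*-cancelʳ-<-nonNeg (ℕ→ℚ (B * B)) {{ℕ→ℚ-nonNeg (B * B)}} (ℚₚ.≤-<-trans sq≤ (subst (ℕ→ℚ (A * A) <_) (ℕ→ℚ-* 5 (B * B)) (ℕ→ℚ-mono-< sq))))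
  where
  lem : ∀ x b → x ℚ.* x ℚ.* (b ℚ.* b) ≡ x ℚ.* b ℚ.* (x ℚ.* b)
  lem = Ring.solve-∀ ℚ-ring
  nnB : ℚ.NonNegative (t z ℚ.* ℕ→ℚ B)
  nnB = ℚₚ.nonNeg*nonNeg⇒nonNeg (t z) {{ℚ.nonNegative nn}} (ℕ→ℚ B) {{ℕ→ℚ-nonNeg B}}
  sq≤ : t z ℚ.* t z ℚ.* ℕ→ℚ (B * B) ℚ.≤ ℕ→ℚ (A * A)
  sq≤ = ℚₚ.≤-trans (ℚₚ.≤-reflexive (trans (cong (t z ℚ.* t z ℚ.*_) (ℕ→ℚ-* B B)) (lem (t z) (ℕ→ℚ B))))
    (ℚₚ.≤-trans (ℚₚ.*-monoˡ-≤-nonNeg (t z ℚ.* ℕ→ℚ B) {{nnB}} h)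
    (ℚₚ.≤-trans (ℚₚ.*-monoʳ-≤-nonNeg (ℕ→ℚ A) {{ℕ→ℚ-nonNeg A}} h) (ℚₚ.≤-reflexive (sym (ℕ→ℚ-* A A)))))

aboveC : ∀ z {A B} → 1 ≤ A → 1 ≤ B → ℕ→ℚ A ℚ.≤ t z ℚ.* ℕ→ℚ B → 5 * (B * B) ℕ.< A * A → AboveC z
aboveC z {A} {B} 1≤A 1≤B h sq = pos , ℚₚ.*-cancelʳ-<-nonNeg (ℕ→ℚ (B * B)) {{ℕ→ℚ-nonNeg (B * B)}} (ℚₚ.<-≤-trans (subst (_< ℕ→ℚ (A * A)) (ℕ→ℚ-* 5 (B * B)) (ℕ→ℚ-mono-< sq)) sq≤)
  where
  lem : ∀ x b → x ℚ.* b ℚ.* (x ℚ.* b) ≡ x ℚ.* x ℚ.* (b ℚ.* b)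
  lem = Ring.solve-∀ ℚ-ring
  posB : 0ℚ < t z ℚ.* ℕ→ℚ B
  posB = ℚₚ.<-≤-trans (ℕ→ℚ-mono-< 1≤A) h
  pos : 0ℚ < t z
  pos = ℚₚ.*-cancelʳ-<-nonNeg (ℕ→ℚ B) {{ℕ→ℚ-nonNeg B}} (subst (_< t z ℚ.* ℕ→ℚ B) (sym (ℚₚ.*-zeroˡ (ℕ→ℚ B))) posB)
  sq≤ : ℕ→ℚ (A * A) ℚ.≤ t z ℚ.* t z ℚ.* ℕ→ℚ (B * B)
  sq≤ = ℚₚ.≤-trans (ℚₚ.≤-reflexive (ℕ→ℚ-* A A)) (ℚₚ.≤-trans (ℚₚ.*-monoˡ-≤-nonNeg (ℕ→ℚ A) {{ℕ→ℚ-nonNeg A}} h)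
    (ℚₚ.≤-trans (ℚₚ.*-monoʳ-≤-nonNeg (t z ℚ.* ℕ→ℚ B) {{ℚ.nonNegative (ℚₚ.<⇒≤ posB)}} h) (ℚₚ.≤-reflexive (trans (lem (t z) (ℕ→ℚ B)) (cong (t z ℚ.* t z ℚ.*_) (sym (ℕ→ℚ-* B B)))))))

-- For Π = p + 2 q, 5 Π⁴ - (10 p q + Π²)² = 4 (p² - p q - q²) (p² + 4 p q - 16 q²), and the last
-- factor is negative when p ≤ 2 q.
module _ (p q : ℕ) (1≤q : 1 ≤ q) (p≤2q : p ≤ 2 * q) where

  private
    Π N v : ℕ
    Π = p + 2 * q
    -- N / Π² is the value of `t` at the main term p q / (2 Π²), to be compared with √5.
    N = 10 * p * q + Π * Π
    v = 16 * (q * q) ∸ (p * p + 4 * p * q)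
    v≡ : p * p + 4 * p * q + v ≡ 16 * (q * q)
    v≡ = m+[n∸m]≡n {p * p + 4 * p * q} (cert (4 * q * q) (p≤2q ⊠ p≤2q ⊞ scale (4 * q) p≤2q) (lem p q))
      where
      lem : ∀ p q → p * p + 4 * p * q + (2 * q * (2 * q) + 4 * q * (2 * q)) + 4 * q * q ≡ 16 * (q * q) + (p * p + 4 * q * p)
      lem = solve-∀
    1≤v : 1 ≤ v
    1≤v = ≤-trans (1≤q ⊠ 1≤q) (cert (3 * q * q) (p≤2q ⊠ p≤2q ⊞ scale (4 * q) p≤2q ⊞ ≤-reflexive (sym v≡)) (lem p q v))
      where
      lem : ∀ p q v → q * q + (2 * q * (2 * q) + 4 * q * (2 * q) + (p * p + 4 * p * q + v)) + 3 * q * q ≡ v + (p * p + 4 * q * p + 16 * (q * q))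
      lem = solve-∀

  below-√5 : p * p ℕ.< p * q + q * q → N * N ℕ.< 5 * (Π * Π * (Π * Π))
  below-√5 h = cert 3 (≤-reflexive prod ⊞ scale 4 (m<n⇒0<n∸m h ⊠ 1≤v)) (lem p q u v)
    where
    u : ℕ
    u = p * q + q * q ∸ p * p
    u≡ : p * p + u ≡ p * q + q * q
    u≡ = m+[n∸m]≡n (<⇒≤ h)
    prod : 4 * (u * v) + 4 * ((p * q + q * q) * (p * p + 4 * p * q)) + 4 * (p * p * (16 * (q * q))) ≡ 4 * ((p * q + q * q) * (16 * (q * q))) + 4 * (p * p * (p * p + 4 * p * q))
    prod = trans (cong₂ (λ x y → 4 * (u * v) + 4 * (x * (p * p + 4 * p * q)) + 4 * (p * p * y)) (sym u≡) (sym v≡))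
      (trans (lem′ (p * p) u (p * p + 4 * p * q) v) (cong₂ (λ x y → 4 * (x * y) + 4 * (p * p * (p * p + 4 * p * q))) u≡ v≡))
      where
      lem′ : ∀ a u b v → 4 * (u * v) + 4 * ((a + u) * b) + 4 * (a * (b + v)) ≡ 4 * ((a + u) * (b + v)) + 4 * (a * b)
      lem′ = solve-∀
    lem : ∀ p q u v → 1 + (10 * p * q + (p + 2 * q) * (p + 2 * q)) * (10 * p * q + (p + 2 * q) * (p + 2 * q))
        + (4 * ((p * q + q * q) * (16 * (q * q))) + 4 * (p * p * (p * p + 4 * p * q)) + 4 * (u * v)) + 3
      ≡ 5 * ((p + 2 * q) * (p + 2 * q) * ((p + 2 * q) * (p + 2 * q))) + (4 * (u * v) + 4 * ((p * q + q * q) * (p * p + 4 * p * q)) + 4 * (p * p * (16 * (q * q))) + 4)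
    lem = solve-∀

  above-√5 : p * q + q * q ℕ.< p * p → 5 * (Π * Π * (Π * Π)) ℕ.< N * N
  above-√5 h = cert 3 (≤-reflexive prod ⊞ scale 4 (m<n⇒0<n∸m h ⊠ 1≤v)) (lem p q u v)
    where
    u : ℕ
    u = p * p ∸ (p * q + q * q)
    u≡ : p * q + q * q + u ≡ p * p
    u≡ = m+[n∸m]≡n (<⇒≤ h)
    prod : 4 * (u * v) + 4 * (p * p * (p * p + 4 * p * q)) + 4 * ((p * q + q * q) * (16 * (q * q))) ≡ 4 * (p * p * (16 * (q * q))) + 4 * ((p * q + q * q) * (p * p + 4 * p * q))
    prod = trans (cong₂ (λ x y → 4 * (u * v) + 4 * (x * (p * p + 4 * p * q)) + 4 * ((p * q + q * q) * y)) (sym u≡) (sym v≡))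
      (trans (lem′ (p * q + q * q) u (p * p + 4 * p * q) v) (cong₂ (λ x y → 4 * (x * y) + 4 * ((p * q + q * q) * (p * p + 4 * p * q))) u≡ v≡))
      where
      lem′ : ∀ a u b v → 4 * (u * v) + 4 * ((a + u) * b) + 4 * (a * (b + v)) ≡ 4 * ((a + u) * (b + v)) + 4 * (a * b)
      lem′ = solve-∀
    lem : ∀ p q u v → 1 + 5 * ((p + 2 * q) * (p + 2 * q) * ((p + 2 * q) * (p + 2 * q)))
        + (4 * (p * p * (16 * (q * q))) + 4 * ((p * q + q * q) * (p * p + 4 * p * q)) + 4 * (u * v)) + 3
      ≡ (10 * p * q + (p + 2 * q) * (p + 2 * q)) * (10 * p * q + (p + 2 * q) * (p + 2 * q)) + (4 * (u * v) + 4 * (p * p * (p * p + 4 * p * q)) + 4 * ((p * q + q * q) * (16 * (q * q))) + 4)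
    lem = solve-∀

-- x = W / D is within 75 / (2 q) of p q / (2 S). From above it is compared with the constant
-- through p / q < φ, from below through P / q > φ, whose main term is larger by at most q / S′ ≤ 1
-- / (4 q). As 75 / 2 + 1 / 4 < 38, the total error is below 1 / E ≤ ε.
near : ∀ {q p E D W x ε} → 1 ≤ q → 38 * E ≤ q → 2 + p ≤ 2 * q → p * p ℕ.< p * q + q * q → (2 + p) * q + q * q ℕ.< (2 + p) * (2 + p) →
  1 ≤ E → 1 ≤ D → x ℚ.* ℕ→ℚ D ≡ ℕ→ℚ W → 1ℚ ℚ.≤ ε ℚ.* ℕ→ℚ E → (let S = (p + 2 * q) * (p + 2 * q)) →
  2 * q * S * W ≤ p * (q * q) * D + 75 * S * D → p * (q * q) * D ≤ 2 * q * S * W + 75 * S * D → Near ε x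
near {q} {p} {E} {D} {W} {x} {ε} 1≤q 38E≤q P≤2q below above 1≤E 1≤D xD≡W 1≤εE upper lower =
    belowC (x - ε) {N * (D * E)} {S * (D * E)} (1≤S p ⊠ (1≤D ⊠ 1≤E)) t≤
      (scaled-< {N * N} {5 * (S * S)} {N * (D * E) * (N * (D * E))} {5 * (S * (D * E) * (S * (D * E)))} (lem₁ N (D * E)) (lem₂ S (D * E)) (below-√5 p q 1≤q (≤-trans (m≤n+m p 2) P≤2q) below)) ,
    aboveC (x ℚ.+ ε) {N′ * (D * E)} {S′ * (D * E)} (≤-trans (1≤S P) (m≤n+m S′ (10 * P * q)) ⊠ (1≤D ⊠ 1≤E)) (1≤S P ⊠ (1≤D ⊠ 1≤E)) ≤t
      (scaled-< {5 * (S′ * S′)} {N′ * N′} {5 * (S′ * (D * E) * (S′ * (D * E)))} {N′ * (D * E) * (N′ * (D * E))} (lem₂ S′ (D * E)) (lem₁ N′ (D * E)) (above-√5 P q 1≤q P≤2q above))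
  where
  P S S′ N N′ : ℕ
  P  = 2 + p
  S  = (p + 2 * q) * (p + 2 * q)
  S′ = (P + 2 * q) * (P + 2 * q)
  N  = 10 * p * q + S
  N′ = 10 * P * q + S′
  1≤S : ∀ r → 1 ≤ (r + 2 * q) * (r + 2 * q)
  1≤S r = 1≤Π ⊠ 1≤Π
    where
    1≤Π : 1 ≤ r + 2 * q
    1≤Π = ≤-trans (≤-trans 1≤q (m≤m+n q (q + 0))) (m≤n+m (2 * q) r)
  lem₁ : ∀ n d → n * n * (d * d) ≡ n * d * (n * d)
  lem₁ = solve-∀
  lem₂ : ∀ s d → 5 * (s * s) * (d * d) ≡ 5 * (s * d * (s * d))
  lem₂ = solve-∀
  scaled-< : ∀ {a b a′ b′} → a * (D * E * (D * E)) ≡ a′ → b * (D * E * (D * E)) ≡ b′ → a ℕ.< b → a′ ℕ.< b′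
  scaled-< {a} {b} refl refl h = cert {x = suc a * (D * E * (D * E)) + 1} 0 (h ⊠ ≤-refl {D * E * (D * E)} ⊞ ((1≤D ⊠ 1≤E) ⊠ (1≤D ⊠ 1≤E))) (lem a (b * (D * E * (D * E))) (D * E * (D * E)))
    where
    lem : ∀ a z d → 1 + a * d + (z + d) + 0 ≡ z + ((1 + a) * d + 1)
    lem = solve-∀
  nat-≤ : 20 * S * E * W + S * (D * E) ≤ N * (D * E) + 20 * S * D
  nat-≤ = *-cancelʳ-≤′ q 1≤q (cert (10 * S * D * E) (scale (10 * E) upper ⊞ scale (20 * S * D) 38E≤q) (lem p q S D E W))
    where
    lem : ∀ p q S D E W → (20 * S * E * W + S * (D * E)) * q + (10 * E * (p * (q * q) * D + 75 * S * D) + 20 * S * D * q) + 10 * S * D * E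
      ≡ ((10 * p * q + S) * (D * E) + 20 * S * D) * q + (10 * E * (2 * q * S * W) + 20 * S * D * (38 * E))
    lem = solve-∀
  nat-≥ : N′ * (D * E) ≤ 20 * S′ * E * W + 20 * S′ * D + S′ * (D * E)
  nat-≥ = *-cancelʳ-≤′ q 1≤q (cert (5 * S′ * D * E) (scale (10 * E) lower ⊞ scale (20 * q * E * W) S≤S′ ⊞ scale (750 * E * D) S≤S′ ⊞ scale (5 * E * D) 4qq≤S′ ⊞ scale (20 * S′ * D) 38E≤q) (lem p q S S′ D E W))
    where
    S≤S′ : S ≤ S′
    S≤S′ = m≤n+m (p + 2 * q) 2 ⊠ m≤n+m (p + 2 * q) 2
    4qq≤S′ : 4 * (q * q) ≤ S′
    4qq≤S′ = ≤-trans (≤-reflexive (lem′ q)) (m≤n+m (2 * q) P ⊠ m≤n+m (2 * q) P)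
      where
      lem′ : ∀ q → 4 * (q * q) ≡ 2 * q * (2 * q)
      lem′ = solve-∀
    lem : ∀ p q S S′ D E W → (10 * (2 + p) * q + S′) * (D * E) * q + (10 * E * (2 * q * S * W + 75 * S * D) + 20 * q * E * W * S′ + 750 * E * D * S′ + 5 * E * D * S′ + 20 * S′ * D * q) + 5 * S′ * D * E
      ≡ (20 * S′ * E * W + 20 * S′ * D + S′ * (D * E)) * q + (10 * E * (p * (q * q) * D) + 20 * q * E * W * S + 750 * E * D * S + 5 * E * D * (4 * (q * q)) + 20 * S′ * D * (38 * E))
    lem = solve-∀
  c d f : ℚ
  c = ℕ→ℚ 20
  d = ℕ→ℚ D
  f = ℕ→ℚ E
  product₃ : ∀ S → ℕ→ℚ (S * (D * E)) ≡ ℕ→ℚ S ℚ.* (d ℚ.* f)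
  product₃ S = trans (ℕ→ℚ-* S (D * E)) (cong (ℕ→ℚ S ℚ.*_) (ℕ→ℚ-* D E))
  product₄ : ∀ S → ℕ→ℚ (20 * S * E * W) ≡ c ℚ.* ℕ→ℚ S ℚ.* f ℚ.* (x ℚ.* d)
  product₄ S = trans (ℕ→ℚ-* (20 * S * E) W) (cong₂ ℚ._*_ (trans (ℕ→ℚ-* (20 * S) E) (cong (ℚ._* f) (ℕ→ℚ-* 20 S))) (sym xD≡W))
  product₅ : ∀ S → ℕ→ℚ (20 * S * D) ≡ c ℚ.* ℕ→ℚ S ℚ.* d
  product₅ S = trans (ℕ→ℚ-* (20 * S) D) (cong (ℚ._* d) (ℕ→ℚ-* 20 S))
  stretch : ∀ S → ℕ→ℚ (20 * S * D) ℚ.≤ ℕ→ℚ (20 * S * D) ℚ.* (ε ℚ.* f)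
  stretch S = ℚₚ.≤-trans (ℚₚ.≤-reflexive (sym (ℚₚ.*-identityʳ _))) (ℚₚ.*-monoˡ-≤-nonNeg (ℕ→ℚ (20 * S * D)) {{ℕ→ℚ-nonNeg (20 * S * D)}} 1≤εE)
  z+ε≡x : (x - ε) ℚ.+ ε ≡ x
  z+ε≡x = trans (ℚₚ.+-assoc x (ℚ.- ε) ε) (trans (cong (x ℚ.+_) (ℚₚ.+-inverseˡ ε)) (ℚₚ.+-identityʳ x))
  expand-below : t (x - ε) ℚ.* ℕ→ℚ (S * (D * E)) ℚ.+ ℕ→ℚ (20 * S * D) ℚ.* (ε ℚ.* f) ≡ ℕ→ℚ (20 * S * E * W + S * (D * E))
  expand-below = trans (cong₂ (λ u v → t (x - ε) ℚ.* u ℚ.+ v ℚ.* (ε ℚ.* f)) (product₃ S) (product₅ S)) (trans (lem c (x - ε) (ℕ→ℚ S) d f ε)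
    (trans (cong (λ y → c ℚ.* ℕ→ℚ S ℚ.* f ℚ.* (y ℚ.* d) ℚ.+ ℕ→ℚ S ℚ.* (d ℚ.* f)) z+ε≡x) (sym (trans (ℕ→ℚ-+ (20 * S * E * W) (S * (D * E))) (cong₂ ℚ._+_ (product₄ S) (product₃ S))))))
    where
    lem : ∀ c z s d f e → (c ℚ.* z ℚ.+ 1ℚ) ℚ.* (s ℚ.* (d ℚ.* f)) ℚ.+ c ℚ.* s ℚ.* d ℚ.* (e ℚ.* f) ≡ c ℚ.* s ℚ.* f ℚ.* ((z ℚ.+ e) ℚ.* d) ℚ.+ s ℚ.* (d ℚ.* f)
    lem = Ring.solve-∀ ℚ-ring
  t≤ : t (x - ε) ℚ.* ℕ→ℚ (S * (D * E)) ℚ.≤ ℕ→ℚ (N * (D * E))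
  t≤ = +-cancelʳ-≤ℚ (ℕ→ℚ (20 * S * D)) (ℚₚ.≤-trans (ℚₚ.+-monoʳ-≤ (t (x - ε) ℚ.* ℕ→ℚ (S * (D * E))) (stretch S))
    (ℚₚ.≤-trans (ℚₚ.≤-reflexive expand-below) (ℚₚ.≤-trans (ℕ→ℚ-mono-≤ nat-≤) (ℚₚ.≤-reflexive (ℕ→ℚ-+ (N * (D * E)) (20 * S * D))))))
    where
    +-cancelʳ-≤ℚ : ∀ r {u v} → u ℚ.+ r ℚ.≤ v ℚ.+ r → u ℚ.≤ v
    +-cancelʳ-≤ℚ r {u} {v} h = ℚₚ.≤-trans (ℚₚ.≤-reflexive (sym (undo u))) (ℚₚ.≤-trans (ℚₚ.+-monoˡ-≤ (ℚ.- r) h) (ℚₚ.≤-reflexive (undo v)))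
      where
      undo : ∀ u → u ℚ.+ r ℚ.+ ℚ.- r ≡ u
      undo u = trans (ℚₚ.+-assoc u r (ℚ.- r)) (trans (cong (u ℚ.+_) (ℚₚ.+-inverseʳ r)) (ℚₚ.+-identityʳ u))
  ≤t : ℕ→ℚ (N′ * (D * E)) ℚ.≤ t (x ℚ.+ ε) ℚ.* ℕ→ℚ (S′ * (D * E))
  ≤t = ℚₚ.≤-trans (ℕ→ℚ-mono-≤ nat-≥) (ℚₚ.≤-trans (ℚₚ.≤-reflexive (trans (ℕ→ℚ-+ (20 * S′ * E * W + 20 * S′ * D) (S′ * (D * E))) (cong (ℚ._+ ℕ→ℚ (S′ * (D * E))) (ℕ→ℚ-+ (20 * S′ * E * W) (20 * S′ * D)))))
    (ℚₚ.≤-trans (ℚₚ.+-monoˡ-≤ (ℕ→ℚ (S′ * (D * E))) (ℚₚ.+-monoʳ-≤ (ℕ→ℚ (20 * S′ * E * W)) (stretch S′)))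
    (ℚₚ.≤-reflexive (trans (cong₂ ℚ._+_ (cong₂ (λ u v → u ℚ.+ v ℚ.* (ε ℚ.* f)) (product₄ S′) (product₅ S′)) (product₃ S′)) (trans (lem c x (ℕ→ℚ S′) d f ε) (cong (t (x ℚ.+ ε) ℚ.*_) (sym (product₃ S′))))))))
    where
    lem : ∀ c x s d f e → c ℚ.* s ℚ.* f ℚ.* (x ℚ.* d) ℚ.+ c ℚ.* s ℚ.* d ℚ.* (e ℚ.* f) ℚ.+ s ℚ.* (d ℚ.* f) ≡ (c ℚ.* (x ℚ.+ e) ℚ.+ 1ℚ) ℚ.* (s ℚ.* (d ℚ.* f))
    lem = Ring.solve-∀ ℚ-ring

-- p is the last integer before p² < p q + q² fails. At p + 1 the reverse inequality may be read off
-- only in non-strict form; at p + 2 it is strict.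
golden-approximant : ∀ q → 3 ≤ q → ∃ λ p → 1 ≤ p × 2 + p ≤ 2 * q × p * p ℕ.< p * q + q * q × (2 + p) * q + q * q ℕ.< (2 + p) * (2 + p)
golden-approximant q 3≤q with search (2 * q)
  where
  Below : ℕ → Set
  Below p = p * p ℕ.< p * q + q * q
  search : ∀ n → (∃ λ p → 1 ≤ p × Below p × ¬ Below (suc p)) ⊎ Below (suc n)
  search zero    = inj₂ (≤-trans (s≤s (s≤s z≤n)) (3≤q′ ⊞ z≤n {q * q}))
    where
    3≤q′ : 3 ≤ 1 * q
    3≤q′ = ≤-trans 3≤q (≤-reflexive (sym (*-identityˡ q)))
  search (suc n) with search n
  ... | inj₁ found = inj₁ found
  ... | inj₂ b with suc (suc n) * suc (suc n) ℕₚ.<? suc (suc n) * q + q * q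
  ...   | yes b′ = inj₂ b′
  ...   | no ¬b′ = inj₁ (suc n , s≤s z≤n , b , ¬b′)
... | inj₂ b = ⊥-elim (<⇒≱ b (cert (q * q + 3 * q + 1) (≤-refl {0}) (lem q)))
  where
  lem : ∀ q → (1 + 2 * q) * q + q * q + 0 + (q * q + 3 * q + 1) ≡ (1 + 2 * q) * (1 + 2 * q) + 0
  lem = solve-∀
... | inj₁ (p , 1≤p , b , ¬b) = p , 1≤p , small , b , cert 1 (≮⇒≥ ¬b ⊞ q≤suc-p ⊞ z≤n {p}) (lem₂ p q)
  where
  q≤suc-p : q ≤ suc p
  q≤suc-p = *-cancelʳ-≤′ (suc p) (s≤s z≤n) (cert (q * q) (≮⇒≥ ¬b) (lem p q))
    where
    lem : ∀ p q → q * (1 + p) + ((1 + p) * (1 + p)) + q * q ≡ (1 + p) * (1 + p) + ((1 + p) * q + q * q)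
    lem = solve-∀
  lem₂ : ∀ p q → 1 + ((2 + p) * q + q * q) + ((1 + p) * (1 + p) + (1 + p) + p) + 1 ≡ (2 + p) * (2 + p) + ((1 + p) * q + q * q + q + 0)
  lem₂ = solve-∀
  small : 2 + p ≤ 2 * q
  small with 2 + p ℕₚ.≤? 2 * q
  ... | yes h = h
  ... | no ¬h = ⊥-elim (<⇒≱ b (sq-≥ (q ∸ 3) (suc p ∸ 2 * q) (m+[n∸m]≡n 3≤q) (m+[n∸m]≡n (≤-pred (≰⇒> ¬h)))))
    where
    sq-≥ : ∀ s r → 3 + s ≡ q → 2 * q + r ≡ suc p → p * q + q * q ≤ p * p
    sq-≥ s r refl e = subst (λ p → p * (3 + s) + (3 + s) * (3 + s) ≤ p * p) (cong pred (trans (lem₁ s r) e))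
        (cert (1 + 3 * s + s * s + 7 * r + 3 * (r * s) + r * r) (≤-refl {0}) (lem′ s r))
      where
      lem₁ : ∀ s r → 1 + (5 + 2 * s + r) ≡ 2 * (3 + s) + r
      lem₁ = solve-∀
      lem′ : ∀ s r → (5 + 2 * s + r) * (3 + s) + (3 + s) * (3 + s) + 0 + (1 + 3 * s + s * s + 7 * r + 3 * (r * s) + r * r) ≡ (5 + 2 * s + r) * (5 + 2 * s + r) + 0
      lem′ = solve-∀

-- Weights, their mean and their concentration

weightℕ : List ℕ → ℕ
weightℕ H = inversions (bits (indicator H) 1 (2 * length H))

length-filter-¬ : ∀ {A : Set} {P : A → Set} (P? : ∀ x → Dec (P x)) xs → length (filter P? xs) + length (filter (¬? ∘ P?) xs) ≡ length xs
length-filter-¬ P? []       = refl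
length-filter-¬ P? (x ∷ xs) with P? x
... | yes _ = cong suc (length-filter-¬ P? xs)
... | no  _ = trans (+-suc _ _) (cong suc (length-filter-¬ P? xs))

module _ {g : ℕ} {H : List ℕ} (isGap : IsGapSetOfGenus g H) where
  open IsGapSetOfGenus isGap using (genus)

  weightℕ-sum : 2 * sum H ≡ 2 * weightℕ H + g * (g + 1)
  weightℕ-sum = subst (λ n → 2 * sum H ≡ 2 * inversions (bits (indicator H) 1 (2 * n)) + g * (g + 1)) (sym genus) (GapSet.sum≡ isGap (2 * g) (n≤1+n (2 * g)))

  weightℕ-unique : ∀ {w} → 2 * sum H ≡ 2 * w + g * (g + 1) → weightℕ H ≡ w
  weightℕ-unique e = *-cancelˡ-≡ _ _ 2 (+-cancelʳ-≡ (g * (g + 1)) _ _ (trans (sym weightℕ-sum) e))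

  weightℕ-≤ : weightℕ H ≤ 2 * (g * g)
  weightℕ-≤ = ≤-trans (inversions≤ v) (≤-trans (trues≤ ⊠ ≤-reflexive falses≡) (≤-reflexive (*-assoc 2 g g)))
    where
    v : List Bool
    v = bits (indicator H) 1 (2 * length H)
    trues≤ : trues v ≤ 2 * g
    trues≤ = ≤-trans (m≤m+n _ (falses v)) (≤-reflexive (trans (trues+falses v) (trans (length-bits (indicator H) 1 (2 * length H)) (cong (2 *_) genus))))
    falses≡ : falses v ≡ g
    falses≡ = trans (cong (λ n → falses (bits (indicator H) 1 (2 * n))) genus) (GapSet.falses-χ isGap (2 * g) (n≤1+n (2 * g)))

  weight≡ : weight H ≡ ℕ→ℚ (weightℕ H)
  weight≡ = trans (cong (λ n → ℕ→ℚ (sum H) - ℕ→ℚ (n * (n + 1)) ℚ.* half) genus) (trans (cong (_- ℕ→ℚ (g * (g + 1)) ℚ.* half) doubled) (undo (ℕ→ℚ (weightℕ H)) (ℕ→ℚ (g * (g + 1)) ℚ.* half)))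
    where
    half : ℚ
    half = (ℤ.+ 1) ℚ./ 2
    undo : ∀ u r → u ℚ.+ r - r ≡ u
    undo u r = trans (ℚₚ.+-assoc u r (ℚ.- r)) (trans (cong (u ℚ.+_) (ℚₚ.+-inverseʳ r)) (ℚₚ.+-identityʳ u))
    halve : ∀ n → ℕ→ℚ (2 * n) ℚ.* half ≡ ℕ→ℚ n
    halve n = trans (cong (ℚ._* half) (ℕ→ℚ-* 2 n)) (trans (lem (ℕ→ℚ 2) (ℕ→ℚ n) half) (trans (cong (ℚ._* ℕ→ℚ n) (1/n*n 1)) (ℚₚ.*-identityˡ (ℕ→ℚ n))))
      where
      lem : ∀ a b c → a ℚ.* b ℚ.* c ≡ c ℚ.* a ℚ.* b
      lem = Ring.solve-∀ ℚ-ring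
    doubled : ℕ→ℚ (sum H) ≡ ℕ→ℚ (weightℕ H) ℚ.+ ℕ→ℚ (g * (g + 1)) ℚ.* half
    doubled = trans (sym (halve (sum H))) (trans (cong (λ n → ℕ→ℚ n ℚ.* half) weightℕ-sum)
      (trans (cong (ℚ._* half) (ℕ→ℚ-+ (2 * weightℕ H) (g * (g + 1)))) (trans (ℚₚ.*-distribʳ-+ half (ℕ→ℚ (2 * weightℕ H)) (ℕ→ℚ (g * (g + 1)))) (cong (ℚ._+ ℕ→ℚ (g * (g + 1)) ℚ.* half) (halve (weightℕ H))))))

close? : ∀ q p g w → Dec (Close q p g w)
close? q p g w = map′ (λ { (upper , lower) → close upper lower }) (λ { (close upper lower) → upper , lower }) (_ ℕₚ.≤? _ ×-dec _ ℕₚ.≤? _)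

module _ (q p g : ℕ) (close-at? : ∀ H → Dec (Close q p g (weightℕ H))) where

  private
    S : ℕ
    S = (p + 2 * q) * (p + 2 * q)

  farFrom : List (List ℕ) → List (List ℕ)
  farFrom = filter (¬? ∘ close-at?)

  -- A far semigroup still has weight between 0 and 2 g², so each of them disturbs the total by
  -- O(g²).
  total-weight-≤ : ∀ L → All (IsGapSetOfGenus g) L →
    2 * q * S * sum (map weightℕ L) ≤ length L * (p * (q * q) * (g * g) + 74 * S * (g * g)) + length (farFrom L) * (2 * q * S * (2 * (g * g)))
  total-weight-≤ []      _              = ≤-reflexive (*-zeroʳ (2 * q * S))
  total-weight-≤ (H ∷ L) (isGap ∷ gaps) with close-at? H
  ... | yes c = cert 0 (Close.upper c ⊞ total-weight-≤ L gaps) (lem (2 * q * S) (weightℕ H) (sum (map weightℕ L)) (length L) (p * (q * q) * (g * g)) (74 * S * (g * g)) (length (farFrom L) * (2 * q * S * (2 * (g * g)))))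
    where
    lem : ∀ a w s l u v b → a * (w + s) + (u + v + (l * (u + v) + b)) + 0 ≡ (1 + l) * (u + v) + b + (a * w + a * s)
    lem = solve-∀
  ... | no  _ = cert (p * (q * q) * (g * g) + 74 * S * (g * g)) (scale (2 * q * S) (weightℕ-≤ isGap) ⊞ total-weight-≤ L gaps) (lem (2 * q * S) (weightℕ H) (sum (map weightℕ L)) (length L) (p * (q * q) * (g * g) + 74 * S * (g * g)) (length (farFrom L)) (2 * (g * g)))
    where
    lem : ∀ a w s l u b z → a * (w + s) + (a * z + (l * u + b * (a * z))) + u ≡ (1 + l) * u + (1 + b) * (a * z) + (a * w + a * s)
    lem = solve-∀

  total-weight-≥ : ∀ L → length L * (p * (q * q) * (g * g)) ≤ 2 * q * S * sum (map weightℕ L) + length L * (74 * S * (g * g)) + length (farFrom L) * (p * (q * q) * (g * g))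
  total-weight-≥ []      = z≤n
  total-weight-≥ (H ∷ L) with close-at? H
  ... | yes c = cert 0 (Close.lower c ⊞ total-weight-≥ L) (lem (2 * q * S) (weightℕ H) (sum (map weightℕ L)) (length L) (p * (q * q) * (g * g)) (74 * S * (g * g)) (length (farFrom L) * (p * (q * q) * (g * g))))
    where
    lem : ∀ a w s l u v b → (1 + l) * u + (a * w + v + (a * s + l * v + b)) + 0 ≡ a * (w + s) + (1 + l) * v + b + (u + l * u)
    lem = solve-∀
  ... | no  _ = cert (2 * q * S * weightℕ H + 74 * S * (g * g)) (total-weight-≥ L) (lem (2 * q * S) (weightℕ H) (sum (map weightℕ L)) (length L) (p * (q * q) * (g * g)) (74 * S * (g * g)) (length (farFrom L)))
    where
    lem : ∀ a w s l u v b → (1 + l) * u + (a * s + l * v + b * u) + (a * w + v) ≡ a * (w + s) + (1 + l) * v + (1 + b) * u + l * u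
    lem = solve-∀

sumℚ-weight : ∀ {g} L → All (IsGapSetOfGenus g) L → sumℚ (map weight L) ≡ ℕ→ℚ (sum (map weightℕ L))
sumℚ-weight []      _              = refl
sumℚ-weight (H ∷ L) (isGap ∷ gaps) = trans (cong₂ ℚ._+_ (weight≡ isGap) (sumℚ-weight L gaps)) (sym (ℕ→ℚ-+ (weightℕ H) (sum (map weightℕ L))))

filter-bad : ∀ {q p g L} {P : List ℕ → Set} (P? : ∀ H → Dec (P H)) → All (IsGapSetOfGenus g) L →
  (∀ {H} → IsGapSetOfGenus g H → P H → ¬ Close q p g (weightℕ H)) → ∀ {H} → H ∈ filter P? L → Bad q p g H
filter-bad {q} {p} {g} {L} P? gaps far H∈ with ∈-filter⁻ P? {xs = L} H∈
... | H∈L , PH = isGap , λ w e c → far isGap PH (subst (Close q p g) (sym (weightℕ-unique isGap e)) c)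
  where
  isGap = All.lookup gaps H∈L

record Approximation (ε : ℚ) : Set where
  field
    {E q p} : ℕ
    1≤E     : 1 ≤ E
    1≤εE    : 1ℚ ℚ.≤ ε ℚ.* ℕ→ℚ E
    38E≤q   : 38 * E ≤ q
    1≤p     : 1 ≤ p
    P≤2q    : 2 + p ≤ 2 * q
    below   : p * p ℕ.< p * q + q * q
    above   : (2 + p) * q + q * q ℕ.< (2 + p) * (2 + p)

approximation : ∀ ε → 0ℚ < ε → Approximation ε
approximation ε 0<ε = from-E (archimedean ε 0<ε)
  where
  from-p : ∀ {E} → 1 ≤ E → 1ℚ ℚ.≤ ε ℚ.* ℕ→ℚ E → (∃ λ p → 1 ≤ p × 2 + p ≤ 2 * (38 * E) × p * p ℕ.< p * (38 * E) + 38 * E * (38 * E) × (2 + p) * (38 * E) + 38 * E * (38 * E) ℕ.< (2 + p) * (2 + p)) → Approximation ε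
  from-p 1≤E 1≤εE (p , 1≤p , P≤2q , below , above) = record { 1≤E = 1≤E ; 1≤εE = 1≤εE ; 38E≤q = ≤-refl ; 1≤p = 1≤p ; P≤2q = P≤2q ; below = below ; above = above }
  from-E : (∃ λ E → 1 ≤ E × 1ℚ ℚ.≤ ε ℚ.* ℕ→ℚ E) → Approximation ε
  from-E (E , 1≤E , 1≤εE) = from-p 1≤E 1≤εE (golden-approximant (38 * E) (≤-trans (s≤s (s≤s (s≤s z≤n))) (scale 38 1≤E)))

module Concentration {ε : ℚ} (approx : Approximation ε) where
  open Approximation approx

  private
    S : ℕ
    S = (p + 2 * q) * (p + 2 * q)

    1≤q : 1 ≤ q
    1≤q = ≤-trans (≤-trans (s≤s z≤n) (scale 38 1≤E)) 38E≤q

    slack : ∀ D → 74 * S * D ≤ 75 * S * D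
    slack D = *-monoˡ-≤ D (*-monoˡ-≤ S {74} {75} (n≤1+n 74))

  event : ∀ {g H} → 1 ≤ g → IsGapSetOfGenus g H → Close q p g (weightℕ H) → Event g ε H
  event {g} {H} 1≤g isGap (close upper lower) = near {q} {p} {E} {g * g} {weightℕ H} {divℕ (weight H) (g * g)} {ε} 1≤q 38E≤q P≤2q below above 1≤E (1≤g ⊠ 1≤g)
    (trans (divℕ-* (weight H) (1≤g ⊠ 1≤g)) (weight≡ isGap)) 1≤εE (≤-trans upper (+-monoʳ-≤ _ (slack (g * g)))) (≤-trans lower (+-monoʳ-≤ _ (slack (g * g))))

  FewBad : ℕ → ℕ → Set
  FewBad δ g = ∀ xs → Unique xs → (∀ {H} → H ∈ xs → Bad q p g H) → suc δ * length xs ≤ fib g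

  mean-near : ∀ g → 1 ≤ g → FewBad (4 * q) g → ∀ L → Enumerates g L → Near ε (normMean g L)
  mean-near g 1≤g few L enum@(unique , gaps , _) = near {q} {p} {E} {g * g * length L} {W} {normMean g L} {ε} 1≤q 38E≤q P≤2q below above 1≤E (1≤gg ⊠ 1≤ℓ) scaled 1≤εE upper lower
    where
    close-at? : ∀ H → Dec (Close q p g (weightℕ H))
    close-at? H = close? q p g (weightℕ H)
    W b ℓ : ℕ
    W = sum (map weightℕ L)
    b = length (farFrom q p g close-at? L)
    ℓ = length L
    1≤gg : 1 ≤ g * g
    1≤gg = 1≤g ⊠ 1≤g
    1≤ℓ : 1 ≤ ℓ
    1≤ℓ = ≤-trans (fib-pos g) (fib≤enumeration enum)
    -- At most a share 1 / (4 q) of the semigroups is far. With weights up to 2 g² this costs one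
    -- more unit of error, from 74 to 75.
    4qb≤ℓ : 4 * q * b ≤ ℓ
    4qb≤ℓ = ≤-trans (m≤n+m _ b) (≤-trans (few (farFrom q p g close-at? L) (Uniqueₚ.filter⁺ (¬? ∘ close-at?) unique) (filter-bad (¬? ∘ close-at?) gaps (λ _ far → far))) (fib≤enumeration enum))
    scaled : normMean g L ℚ.* ℕ→ℚ (g * g * ℓ) ≡ ℕ→ℚ W
    scaled = trans (cong (normMean g L ℚ.*_) (ℕ→ℚ-* (g * g) ℓ)) (trans (sym (ℚₚ.*-assoc (normMean g L) (ℕ→ℚ (g * g)) (ℕ→ℚ ℓ)))
      (trans (cong (ℚ._* ℕ→ℚ ℓ) (divℕ-* (expectW L) 1≤gg)) (trans (divℕ-* (sumℚ (map weight L)) 1≤ℓ) (sumℚ-weight L gaps))))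
    upper : 2 * q * S * W ≤ p * (q * q) * (g * g * ℓ) + 75 * S * (g * g * ℓ)
    upper = cert 0 (total-weight-≤ q p g close-at? L gaps ⊞ scale (S * (g * g)) 4qb≤ℓ) (lem q p S (g * g) W b ℓ)
      where
      lem : ∀ q p S D W b l → 2 * q * S * W + (l * (p * (q * q) * D + 74 * S * D) + b * (2 * q * S * (2 * D)) + S * D * l) + 0
        ≡ p * (q * q) * (D * l) + 75 * S * (D * l) + (2 * q * S * W + S * D * (4 * q * b))
      lem = solve-∀
    pq≤S : p * q ≤ S
    pq≤S = m≤m+n p (2 * q) ⊠ ≤-trans (m≤m+n q (q + 0)) (m≤n+m (2 * q) p)
    lower : p * (q * q) * (g * g * ℓ) ≤ 2 * q * S * W + 75 * S * (g * g * ℓ)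
    lower = cert (3 * (b * (q * (p * q) * (g * g)))) (total-weight-≥ q p g close-at? L ⊞ scale (p * q * (g * g)) 4qb≤ℓ ⊞ scale (g * g * ℓ) pq≤S) (lem q p S (g * g) W b ℓ)
      where
      lem : ∀ q p S D W b l → p * (q * q) * (D * l) + (2 * q * S * W + l * (74 * S * D) + b * (p * (q * q) * D) + p * q * D * l + D * l * S) + 3 * (b * (q * (p * q) * D))
        ≡ 2 * q * S * W + 75 * S * (D * l) + (l * (p * (q * q) * D) + p * q * D * (4 * q * b) + D * l * (p * q))
      lem = solve-∀

  event-likely : ∀ δ d → 0ℚ < δ → 1 ≤ d → 1ℚ ℚ.≤ δ ℚ.* ℕ→ℚ d → ∀ g → 1 ≤ g → FewBad d g → ∀ L → Enumerates g L → 1ℚ - δ < prob g ε L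
  event-likely δ d 0<δ 1≤d 1≤δd g 1≤g few L enum@(unique , gaps , _) = ℚₚ.*-cancelʳ-<-nonNeg (ℕ→ℚ ℓ) {{ℕ→ℚ-nonNeg ℓ}} (subst ((1ℚ - δ) ℚ.* ℕ→ℚ ℓ <_) (sym (divℕ-* (ℕ→ℚ good) 1≤ℓ)) scaled)
    where
    not? : ∀ H → Dec (¬ Event g ε H)
    not? H = ¬? (Event? g ε H)
    good b ℓ : ℕ
    good = length (filter (Event? g ε) L)
    b = length (filter not? L)
    ℓ = length L
    1≤ℓ : 1 ≤ ℓ
    1≤ℓ = ≤-trans (fib-pos g) (fib≤enumeration enum)
    [1+d]b≤ℓ : suc d * b ≤ ℓ
    [1+d]b≤ℓ = ≤-trans (few (filter not? L) (Uniqueₚ.filter⁺ not? unique) (filter-bad not? gaps (λ isGap no-event c → no-event (event 1≤g isGap c)))) (fib≤enumeration enum)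
    -- The additional b in `suc d * b` makes the inequality strict; for b = 0 it is 1 ≤ ℓ.
    db<ℓ : d * b ℕ.< ℓ
    db<ℓ = strict b [1+d]b≤ℓ
      where
      strict : ∀ b → suc d * b ≤ ℓ → d * b ℕ.< ℓ
      strict zero    _ = ≤-trans (s≤s (≤-reflexive (*-zeroʳ d))) 1≤ℓ
      strict (suc b) h = ≤-trans (s≤s (m≤n+m (d * suc b) b)) h
    b<δℓ : ℕ→ℚ b < δ ℚ.* ℕ→ℚ ℓ
    b<δℓ = ℚₚ.≤-<-trans (ℚₚ.≤-trans (ℚₚ.≤-reflexive (sym (ℚₚ.*-identityˡ (ℕ→ℚ b)))) (ℚₚ.≤-trans (ℚₚ.*-monoʳ-≤-nonNeg (ℕ→ℚ b) {{ℕ→ℚ-nonNeg b}} 1≤δd)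
        (ℚₚ.≤-reflexive (trans (ℚₚ.*-assoc δ (ℕ→ℚ d) (ℕ→ℚ b)) (cong (δ ℚ.*_) (sym (ℕ→ℚ-* d b)))))))
      (ℚₚ.*-monoʳ-<-pos δ {{ℚ.positive 0<δ}} (ℕ→ℚ-mono-< db<ℓ))
    scaled : (1ℚ - δ) ℚ.* ℕ→ℚ ℓ < ℕ→ℚ good
    scaled = subst₂ _<_ left right (ℚₚ.+-monoˡ-< (ℚ.- (δ ℚ.* ℕ→ℚ ℓ)) (ℚₚ.+-monoʳ-< (ℕ→ℚ good) b<δℓ))
      where
      left : ℕ→ℚ good ℚ.+ ℕ→ℚ b ℚ.+ ℚ.- (δ ℚ.* ℕ→ℚ ℓ) ≡ (1ℚ - δ) ℚ.* ℕ→ℚ ℓ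
      left = trans (cong₂ ℚ._+_ (trans (sym (ℕ→ℚ-+ good b)) (trans (cong ℕ→ℚ (length-filter-¬ (Event? g ε) L)) (sym (ℚₚ.*-identityˡ (ℕ→ℚ ℓ))))) (ℚₚ.neg-distribˡ-* δ (ℕ→ℚ ℓ)))
        (sym (ℚₚ.*-distribʳ-+ (ℕ→ℚ ℓ) 1ℚ (ℚ.- δ)))
      right : ℕ→ℚ good ℚ.+ δ ℚ.* ℕ→ℚ ℓ ℚ.+ ℚ.- (δ ℚ.* ℕ→ℚ ℓ) ≡ ℕ→ℚ good
      right = trans (ℚₚ.+-assoc (ℕ→ℚ good) _ _) (trans (cong (ℕ→ℚ good ℚ.+_) (ℚₚ.+-inverseʳ (δ ℚ.* ℕ→ℚ ℓ))) (ℚₚ.+-identityʳ (ℕ→ℚ good)))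

  eventually-mean : ∃ λ G → ∀ g → G ≤ g → ∀ L → Enumerates g L → Near ε (normMean g L)
  eventually-mean = from (Counting.eventually-few-bad q p 1≤q 1≤p below above (4 * q))
    where
    from : (∃ λ G → ∀ g → G ≤ g → FewBad (4 * q) g) → ∃ λ G → ∀ g → G ≤ g → ∀ L → Enumerates g L → Near ε (normMean g L)
    from (G , few) = suc G , λ g G<g → mean-near g (≤-trans (s≤s z≤n) G<g) (few g (<⇒≤ G<g))

  eventually-likely : ∀ δ → 0ℚ < δ → ∃ λ G → ∀ g → G ≤ g → ∀ L → Enumerates g L → 1ℚ - δ < prob g ε L
  eventually-likely δ 0<δ = from (archimedean δ 0<δ)
    where
    from′ : ∀ d → 1 ≤ d → 1ℚ ℚ.≤ δ ℚ.* ℕ→ℚ d → (∃ λ G → ∀ g → G ≤ g → FewBad d g) → ∃ λ G → ∀ g → G ≤ g → ∀ L → Enumerates g L → 1ℚ - δ < prob g ε L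
    from′ d 1≤d 1≤δd (G , few) = suc G , λ g G<g → event-likely δ d 0<δ 1≤d 1≤δd g (≤-trans (s≤s z≤n) G<g) (few g (<⇒≤ G<g))
    from : (∃ λ d → 1 ≤ d × 1ℚ ℚ.≤ δ ℚ.* ℕ→ℚ d) → ∃ λ G → ∀ g → G ≤ g → ∀ L → Enumerates g L → 1ℚ - δ < prob g ε L
    from (d , 1≤d , 1≤δd) = from′ d 1≤d 1≤δd (Counting.eventually-few-bad q p 1≤q 1≤p below above d)

theorem1p7 : ((g : ℕ) → Σ (List (List ℕ)) (Enumerates g)) ×
    ((enum : ℕ → List (List ℕ)) → ((g : ℕ) → Enumerates g (enum g)) →
    ((ε : ℚ) → 0ℚ < ε → Σ ℕ (λ G → (g : ℕ) → G ≤ g → Near ε (normMean g (enum g))))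
    ×
    ((ε : ℚ) → 0ℚ < ε → (δ : ℚ) → 0ℚ < δ →
    Σ ℕ (λ G → (g : ℕ) → G ≤ g → (1ℚ - δ) < prob g ε (enum g))))
theorem1p7 = enumeration , λ enum enumerates →
  (λ ε 0<ε → restrict (λ g L → Near ε (normMean g L)) enum enumerates (Concentration.eventually-mean (approximation ε 0<ε))) ,
  (λ ε 0<ε δ 0<δ → restrict (λ g L → 1ℚ - δ < prob g ε L) enum enumerates (Concentration.eventually-likely (approximation ε 0<ε) δ 0<δ))
  where
  restrict : ∀ (R : ℕ → List (List ℕ) → Set) (enum : ℕ → List (List ℕ)) → (∀ g → Enumerates g (enum g)) →
    (∃ λ G → ∀ g → G ≤ g → ∀ L → Enumerates g L → R g L) → ∃ λ G → ∀ g → G ≤ g → R g (enum g)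
  restrict R enum enumerates (G , eventually) = G , λ g G≤g → eventually g G≤g (enum g) (enumerates g)
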